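{- Let $P$ be an $r$-differential poset such that: (i) the down maps $D_n:\mathbb{Z}P_n\to\mathbb{Z}P_{n-1}$ are surjective for all $n\ge1$; (ii) there exists $l\ge0$ such that $\Delta p_n\ge\Delta p_{n-1-\delta_{r,1}}+1$ for every $n\ge l+1$ (where $\delta_{r,1}=1$ if $r=1$ and $0$ otherwise); (iii) the maps $DU_n$ have rational canonical form over $\mathbb{Z}$ for all $n\in\{0,1,\dots,l\}$. Then $DU_n$ has rational canonical form over $\mathbb{Z}$ for all $n\ge0$; equivalently, $[DU_n]+xI_{p_n}$ has Smith normal form over $\mathbb{Z}[x]$ for all $n\ge0$.
   Context: For a positive integer $r$, a poset $P$ is $r$-differential if: (D1) $P$ is graded, locally finite, has all rank sizes finite and a unique minimum element; (D2) if two distinct elements of $P$ both cover exactly $k$ common elements, then exactly $k$ elements cover them both; (D3) if an element covers $k$ elements then it is covered by exactly $k+r$ elements. $P_n$ is the $n$-th rank (empty for $n<0$), $p_n=|P_n|$, $\Delta p_n=p_n-p_{n-1}$, and $\mathbb{Z}P_n\cong\mathbb{Z}^{p_n}$ is the free $\mathbb{Z}$-module with basis $P_n$. $U_n:\mathbb{Z}P_n\to\mathbb{Z}P_{n+1}$ sends an element to the sum of all elements covering it; $D_n:\mathbb{Z}P_n\to\mathbb{Z}P_{n-1}$ sends an element to the sum of all elements it covers; $DU_n=D_{n+1}U_n$, with matrix $[DU_n]$ in the standard basis. An endomorphism $\varphi$ of a free $\mathbb{Z}$-module $M$ of finite rank has rational canonical form over $\mathbb{Z}$ if, viewing $M$ as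 a $\mathbb{Z}[x]$-module with $x$ acting by $\varphi$, $M=V_1\oplus\cdots\oplus V_k$ with $V_i$ cyclic $\mathbb{Z}[x]$-submodules, $\operatorname{Ann}(V_i)=(a_i(x))$, each $a_i$ monic non-constant in $\mathbb{Z}[x]$, and $a_1\mid a_2\mid\cdots\mid a_k$. A matrix over a commutative ring $R$ has Smith normal form over $R$ if it can be multiplied on both sides by invertible matrices over $R$ to obtain a diagonal matrix whose diagonal entries satisfy $s_1\mid s_2\mid\cdots$. -}

module Defs where

open import Algebra.Bundles using (CommutativeMonoid; CommutativeRing; CommutativeSemigroup; Ring)
open import Algebra.Module.Bundles using (LeftModule)
open import Algebra.Module.Morphism.Structures using (IsLeftModuleHomomorphism)
open import Data.Bool.Base using (if_then_else_)
open import Data.Fin.Base as Fin using (Fin; toℕ)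
import Data.Fin.Properties as Fin
open import Data.Integer.Base as ℤ using (ℤ; +_; -[1+_]; 0ℤ; 1ℤ)
import Data.Integer.Properties as ℤ
open import Data.List.Base using (List; []; _∷_; map)
open import Data.Nat.Base as ℕ using (ℕ; zero; suc)
import Data.Nat.Properties as ℕ
open import Data.Product.Base using (_×_; _,_; ∃; ∃₂; proj₁; proj₂)
open import Data.Vec.Functional using (Vector)
open import Function.Base using (_∘_)
open import Function.Bundles using (_⇔_)
import Function.Definitions as FunctionDefinitions
open import Level using (Level; _⊔_) renaming (suc to lsuc)
open import Relation.Binary.Bundles using (Poset; Setoid)
open import Relation.Binary.Definitions using (Decidable)
open import Relation.Binary.PropositionalEquality as ≡ using (_≡_; _≢_)
open import Relation.Nullary using (¬_; yes; no; does)
open import Relation.Nullary.Decidable using (map′; _×-dec_; ¬?)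
open import Relation.Unary using (Pred; _∈_)

import Algebra.Definitions.RawMagma as RawMagmaDefinitions
import Algebra.Module.Morphism.Construct.Composition as Composition
import Algebra.Properties.CommutativeMonoid.Sum as Sum
import Algebra.Properties.CommutativeSemigroup as CommutativeSemigroupProperties
import Algebra.Properties.Group as GroupProperties
import Relation.Binary.Properties.Poset as PosetProperties
import Relation.Binary.Reasoning.Setoid as SetoidReasoning

private
  variable
    r ℓr m ℓm m₁ ℓm₁ m₂ ℓm₂ m₃ ℓm₃ s ℓ : Level

δ : ℕ → ℕ → ℤ
δ i j = if does (i ℕ.≟ j) then 1ℤ else 0ℤ

module Cardinality (S : Setoid s ℓ) where
  open Setoid S

  -- "Exactly k elements, counted up to _≈_, satisfy Q."
  record _HasCard_ {q} (Q : Pred Carrier q) (k : ℕ) : Set (s ⊔ ℓ ⊔ q) where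
    field
      elem     : Fin k → Carrier
      sound    : ∀ i → elem i ∈ Q
      distinct : ∀ {i j} → elem i ≈ elem j → i ≡ j
      complete : ∀ {x} → x ∈ Q → ∃ λ i → x ≈ elem i

module Covering {c ℓ₁ ℓ₂} (P : Poset c ℓ₁ ℓ₂) where
  open Poset P
  open PosetProperties P using (_<_)

  infix 4 _⋖_

  _⋖_ : Carrier → Carrier → Set (c ⊔ ℓ₁ ⊔ ℓ₂)
  x ⋖ y = x < y × (∀ z → ¬ (x < z × z < y))

record DifferentialPoset (r : ℕ) c ℓ₁ ℓ₂ : Set (lsuc (c ⊔ ℓ₁ ⊔ ℓ₂)) where
  field
    poset : Poset c ℓ₁ ℓ₂

  open Poset poset public
  open PosetProperties poset public using (_<_; ≤-dec⇒≈-dec)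
  open Covering poset public
  open Cardinality Eq.setoid public

  field
    rank          : Carrier → ℕ
    rank-cong     : ∀ {x y} → x ≈ y → rank x ≡ rank y
    rank-⋖        : ∀ {x y} → x ⋖ y → rank y ≡ suc (rank x)
    0̂             : Carrier
    0̂-minimum     : ∀ x → 0̂ ≤ x
    rank-0̂        : rank 0̂ ≡ 0
    locallyFinite : ∀ x y → ∃ λ k → (λ z → x ≤ z × z ≤ y) HasCard k
    finiteRanks   : ∀ n → ∃ λ k → (λ x → rank x ≡ n) HasCard k
    D2            : ∀ {x y} k → ¬ x ≈ y →
                    (λ z → z ⋖ x × z ⋖ y) HasCard k →
                    (λ z → x ⋖ z × y ⋖ z) HasCard k
    D3            : ∀ {x} k → (λ z → z ⋖ x) HasCard k →
                    (λ z → x ⋖ z) HasCard (k ℕ.+ r)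

  -- x ≤ y iff the interval [x , y] is inhabited, so local finiteness
  -- already makes the order decidable.
  _≤?_ : Decidable _≤_
  x ≤? y with locallyFinite x y
  ... | suc _ , I = yes (trans (proj₁ (I.sound Fin.zero)) (proj₂ (I.sound Fin.zero)))
    where module I = _HasCard_ I
  ... | zero  , I = no λ x≤y → Fin.¬Fin0 (proj₁ (I.complete (refl , x≤y)))
    where module I = _HasCard_ I

  _≈?_ : Decidable _≈_
  _≈?_ = ≤-dec⇒≈-dec _≤?_

  _<?_ : Decidable _<_
  x <? y = (x ≤? y) ×-dec ¬? (x ≈? y)

  _⋖?_ : Decidable _⋖_
  x ⋖? y = (x <? y) ×-dec map′ to from
             (Fin.all? λ i → ¬? ((x <? I.elem i) ×-dec (I.elem i <? y)))
    where
    module I = _HasCard_ (proj₂ (locallyFinite x y))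
    open PosetProperties poset using (<-respˡ-≈; <-respʳ-≈)

    to : (∀ i → ¬ (x < I.elem i × I.elem i < y)) → ∀ z → ¬ (x < z × z < y)
    to none z (x<z , z<y) with I.complete (proj₁ x<z , proj₁ z<y)
    ... | i , z≈ = none i (<-respʳ-≈ z≈ x<z , <-respˡ-≈ z≈ z<y)

    from : (∀ z → ¬ (x < z × z < y)) → ∀ i → ¬ (x < I.elem i × I.elem i < y)
    from none i = none (I.elem i)

  ∣P_∣ : ℕ → ℕ
  ∣P n ∣ = proj₁ (finiteRanks n)

  P[_] : ∀ n → Fin ∣P n ∣ → Carrier
  P[ n ] = _HasCard_.elem (proj₂ (finiteRanks n))

  p : ℤ → ℤ
  p (+ n)     = + ∣P n ∣
  p -[1+ _ ]  = 0ℤ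

  Δp : ℤ → ℤ
  Δp n = p n ℤ.- p (n ℤ.- 1ℤ)

module _ {R : Ring r ℓr} where

  record LinearMap (M : LeftModule R m₁ ℓm₁) (N : LeftModule R m₂ ℓm₂) :
                   Set (r ⊔ m₁ ⊔ ℓm₁ ⊔ m₂ ⊔ ℓm₂) where
    private
      module M = LeftModule M
      module N = LeftModule N
    field
      ⟦_⟧                      : M.Carrierᴹ → N.Carrierᴹ
      isLeftModuleHomomorphism : IsLeftModuleHomomorphism M.rawLeftModule N.rawLeftModule ⟦_⟧

    open IsLeftModuleHomomorphism isLeftModuleHomomorphism public

    Surjective : Set (m₁ ⊔ ℓm₁ ⊔ m₂ ⊔ ℓm₂)
    Surjective = FunctionDefinitions.Surjective M._≈ᴹ_ N._≈ᴹ_ ⟦_⟧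

  Endomorphism : LeftModule R m ℓm → Set (r ⊔ m ⊔ ℓm)
  Endomorphism M = LinearMap M M

  infixr 9 _∘ₗ_

  _∘ₗ_ : {M : LeftModule R m₁ ℓm₁} {N : LeftModule R m₂ ℓm₂} {O : LeftModule R m₃ ℓm₃} →
         LinearMap N O → LinearMap M N → LinearMap M O
  _∘ₗ_ {O = O} g f = record
    { ⟦_⟧                      = G.⟦_⟧ ∘ F.⟦_⟧
    ; isLeftModuleHomomorphism = Composition.isLeftModuleHomomorphism
        (LeftModule.≈ᴹ-trans O) F.isLeftModuleHomomorphism G.isLeftModuleHomomorphism
    }
    where
    module F = LinearMap f
    module G = LinearMap g

  module _ (M : LeftModule R m₁ ℓm₁) (N : LeftModule R m₂ ℓm₂) where
    private
      module R = Ring R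
      module M = LeftModule M
      module N = LeftModule N

    linearMap : (f : M.Carrierᴹ → N.Carrierᴹ) →
                (∀ {v w} → v M.≈ᴹ w → f v N.≈ᴹ f w) →
                (∀ v w → f (v M.+ᴹ w) N.≈ᴹ f v N.+ᴹ f w) →
                (∀ a v → f (a M.*ₗ v) N.≈ᴹ a N.*ₗ f v) →
                LinearMap M N
    linearMap f f-cong f-+ f-* = record
      { ⟦_⟧ = f
      ; isLeftModuleHomomorphism = record
        { +ᴹ-isGroupHomomorphism = record
          { isMonoidHomomorphism = record
            { isMagmaHomomorphism = record
              { isRelHomomorphism = record { cong = f-cong }
              ; homo              = f-+
              }
            ; ε-homo = f-0
            }
          ; ⁻¹-homo = λ v → GroupProperties.inverseˡ-unique N.+ᴹ-group _ _
              (N.≈ᴹ-trans (N.≈ᴹ-sym (f-+ _ _))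
                (N.≈ᴹ-trans (f-cong (M.-ᴹ‿inverseˡ v)) f-0))
          }
        ; *ₗ-homo = f-*
        }
      }
      where
      f-0 : f M.0ᴹ N.≈ᴹ N.0ᴹ
      f-0 = N.≈ᴹ-trans (f-cong (M.≈ᴹ-sym (M.*ₗ-zeroˡ M.0ᴹ)))
              (N.≈ᴹ-trans (f-* R.0# M.0ᴹ) (N.*ₗ-zeroˡ _))

module _ (R : Ring r ℓr) where
  open Ring R

  freeModule : ℕ → LeftModule R r ℓr
  freeModule n = record
    { Carrierᴹ = Vector Carrier n
    ; _≈ᴹ_     = λ v w → ∀ i → v i ≈ w i
    ; _+ᴹ_     = λ v w i → v i + w i
    ; _*ₗ_     = λ a v i → a * v i
    ; 0ᴹ       = λ _ → 0#
    ; -ᴹ_      = λ v i → - v i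
    ; isLeftModule = record
      { isLeftSemimodule = record
        { +ᴹ-isCommutativeMonoid = record
          { isMonoid = record
            { isSemigroup = record
              { isMagma = record
                { isEquivalence = record
                  { refl  = λ _ → refl
                  ; sym   = λ e i → sym (e i)
                  ; trans = λ e f i → trans (e i) (f i)
                  }
                ; ∙-cong = λ e f i → +-cong (e i) (f i)
                }
              ; assoc = λ u v w i → +-assoc (u i) (v i) (w i)
              }
            ; identity = (λ v i → +-identityˡ (v i)) , (λ v i → +-identityʳ (v i))
            }
          ; comm = λ v w i → +-comm (v i) (w i)
          }
        ; isPreleftSemimodule = record
          { *ₗ-cong      = λ e f i → *-cong e (f i)
          ; *ₗ-zeroˡ     = λ v i → zeroˡ (v i)
          ; *ₗ-distribʳ  = λ v a b i → distribʳ (v i) a b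
          ; *ₗ-identityˡ = λ v i → *-identityˡ (v i)
          ; *ₗ-assoc     = λ a b v i → *-assoc a b (v i)
          ; *ₗ-zeroʳ     = λ a i → zeroʳ a
          ; *ₗ-distribˡ  = λ a v w i → distribˡ a (v i) (w i)
          }
        }
      ; -ᴹ‿cong    = λ e i → -‿cong (e i)
      ; -ᴹ‿inverse = (λ v i → -‿inverseˡ (v i)) , (λ v i → -‿inverseʳ (v i))
      }
    }

  basis : ∀ {n} → Fin n → Vector Carrier n
  basis j i = if does (i Fin.≟ j) then 1# else 0#

module _ {R : Ring r ℓr} (M : LeftModule R m ℓm) where
  private module M = LeftModule M
  open M using (_≈ᴹ_; _*ₗ_; Carrierᴹ)
  open Sum M.+ᴹ-commutativeMonoid using (sum; sum-cong-≋; ∑-distrib-+)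

  linearExtension : ∀ {n} → Vector Carrierᴹ n → LinearMap (freeModule R n) M
  linearExtension {n} f = linearMap (freeModule R n) M
    (λ v → sum λ i → v i *ₗ f i)
    (λ v≈w → sum-cong-≋ λ i → M.*ₗ-congʳ (v≈w i))
    (λ v w → M.≈ᴹ-trans
      (sum-cong-≋ λ i → M.*ₗ-distribʳ (f i) (v i) (w i))
      (∑-distrib-+ (λ i → v i *ₗ f i) (λ i → w i *ₗ f i)))
    (λ a v → M.≈ᴹ-trans
      (sum-cong-≋ λ i → M.*ₗ-assoc a (v i) (f i))
      (M.≈ᴹ-sym (*ₗ-sum a (λ i → v i *ₗ f i))))
    where
    *ₗ-sum : ∀ {n} a (w : Vector Carrierᴹ n) → a *ₗ sum w ≈ᴹ sum (λ i → a *ₗ w i)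
    *ₗ-sum {zero}  a w = M.*ₗ-zeroʳ a
    *ₗ-sum {suc _} a w = M.≈ᴹ-trans (M.*ₗ-distribˡ a _ _)
                           (M.+ᴹ-congˡ (*ₗ-sum a (w ∘ Fin.suc)))

Matrix : Set s → ℕ → ℕ → Set s
Matrix A m n = Fin m → Fin n → A

matrixOf : (R : Ring r ℓr) → ∀ {m n} →
           LinearMap (freeModule R n) (freeModule R m) → Matrix (Ring.Carrier R) m n
matrixOf R φ i j = LinearMap.⟦_⟧ φ (basis R j) i

module SmithNormalForm (R : CommutativeRing r ℓr) where
  open CommutativeRing R
  open Sum +-commutativeMonoid using (sum)
  open RawMagmaDefinitions *-rawMagma using (_∣_)

  infix  4 _≈ₘ_
  infixl 7 _*ₘ_
  infixl 6 _+ₘ_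

  _≈ₘ_ : ∀ {m n} → Matrix Carrier m n → Matrix Carrier m n → Set ℓr
  A ≈ₘ B = ∀ i j → A i j ≈ B i j

  _+ₘ_ : ∀ {m n} → Matrix Carrier m n → Matrix Carrier m n → Matrix Carrier m n
  (A +ₘ B) i j = A i j + B i j

  _*ₘ_ : ∀ {l m n} → Matrix Carrier l m → Matrix Carrier m n → Matrix Carrier l n
  (A *ₘ B) i k = sum λ j → A i j * B j k

  scalarₘ : ∀ {n} → Carrier → Matrix Carrier n n
  scalarₘ a i j = if does (i Fin.≟ j) then a else 0#

  Iₘ : ∀ {n} → Matrix Carrier n n
  Iₘ = scalarₘ 1#

  Invertible : ∀ {n} → Matrix Carrier n n → Set (r ⊔ ℓr)
  Invertible A = ∃ λ B → A *ₘ B ≈ₘ Iₘ × B *ₘ A ≈ₘ Iₘ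

  -- Rectangular matrices are allowed; the diagonal entries are the
  -- S i j with toℕ i ≡ toℕ j.
  record IsSmith {m n} (S : Matrix Carrier m n) : Set (r ⊔ ℓr) where
    field
      diagonal : ∀ i j → toℕ i ≢ toℕ j → S i j ≈ 0#
      chain    : ∀ i j i′ j′ → toℕ i ≡ toℕ j → toℕ i′ ≡ toℕ j′ →
                 toℕ i ℕ.≤ toℕ i′ → S i j ∣ S i′ j′

  HasSmithNormalForm : ∀ {m n} → Matrix Carrier m n → Set (r ⊔ ℓr)
  HasSmithNormalForm A = ∃₂ λ L R →
    Invertible L × Invertible R × IsSmith (L *ₘ A *ₘ R)

ℤ-ring : Ring _ _
ℤ-ring = ℤ.+-*-ring

module Polynomial where

  -- Coefficient lists, constant term first; trailing zeros are
  -- permitted, so equality is equality of all coefficients.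
  ℤ[x] : Set
  ℤ[x] = List ℤ

  coeff : ℤ[x] → ℕ → ℤ
  coeff []      _       = 0ℤ
  coeff (a ∷ _) zero    = a
  coeff (_ ∷ f) (suc i) = coeff f i

  infix 4 _≈_

  record _≈_ (f g : ℤ[x]) : Set where
    constructor mk≈
    field coeff-≡ : ∀ i → coeff f i ≡ coeff g i

  open _≈_ public

  const : ℤ → ℤ[x]
  const a = a ∷ []

  X : ℤ[x]
  X = 0ℤ ∷ 1ℤ ∷ []

  0ᴾ 1ᴾ : ℤ[x]
  0ᴾ = []
  1ᴾ = const 1ℤ

  infix  8 -_
  infixl 7 _*_ _·_
  infixl 6 _+_

  _+_ : ℤ[x] → ℤ[x] → ℤ[x]
  []      + g       = g
  (a ∷ f) + []      = a ∷ f
  (a ∷ f) + (b ∷ g) = (a ℤ.+ b) ∷ (f + g)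

  -_ : ℤ[x] → ℤ[x]
  -_ = map (λ a → ℤ.- a)

  _·_ : ℤ → ℤ[x] → ℤ[x]
  a · f = map (a ℤ.*_) f

  _*_ : ℤ[x] → ℤ[x] → ℤ[x]
  []      * g = []
  (a ∷ f) * g = a · g + (0ℤ ∷ f * g)

  MonicOfDegree : ℕ → ℤ[x] → Set
  MonicOfDegree d f = coeff f d ≡ 1ℤ × (∀ i → d ℕ.< i → coeff f i ≡ 0ℤ)

  MonicNonconstant : ℤ[x] → Set
  MonicNonconstant f = ∃ λ d → 1 ℕ.≤ d × MonicOfDegree d f

  coeff-+ : ∀ f g i → coeff (f + g) i ≡ coeff f i ℤ.+ coeff g i
  coeff-+ []      g       i       = ≡.sym (ℤ.+-identityˡ _)
  coeff-+ (a ∷ f) []      i       = ≡.sym (ℤ.+-identityʳ _)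
  coeff-+ (a ∷ f) (b ∷ g) zero    = ≡.refl
  coeff-+ (a ∷ f) (b ∷ g) (suc i) = coeff-+ f g i

  coeff-· : ∀ a f i → coeff (a · f) i ≡ a ℤ.* coeff f i
  coeff-· a []      i       = ≡.sym (ℤ.*-zeroʳ a)
  coeff-· a (b ∷ f) zero    = ≡.refl
  coeff-· a (b ∷ f) (suc i) = coeff-· a f i

  coeff-neg : ∀ f i → coeff (- f) i ≡ ℤ.- coeff f i
  coeff-neg []      i       = ≡.refl
  coeff-neg (a ∷ f) zero    = ≡.refl
  coeff-neg (a ∷ f) (suc i) = coeff-neg f i

  ≈-refl : ∀ {f} → f ≈ f
  ≈-refl = mk≈ λ _ → ≡.refl

  ≈-sym : ∀ {f g} → f ≈ g → g ≈ f
  ≈-sym e = mk≈ λ i → ≡.sym (coeff-≡ e i)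

  ≈-trans : ∀ {f g h} → f ≈ g → g ≈ h → f ≈ h
  ≈-trans e e′ = mk≈ λ i → ≡.trans (coeff-≡ e i) (coeff-≡ e′ i)

  ≈-setoid : Setoid _ _
  ≈-setoid = record
    { _≈_ = _≈_
    ; isEquivalence = record { refl = ≈-refl ; sym = ≈-sym ; trans = ≈-trans }
    }

  open SetoidReasoning ≈-setoid

  ∷-cong : ∀ {a b f g} → a ≡ b → f ≈ g → a ∷ f ≈ b ∷ g
  ∷-cong a≡b f≈g = mk≈ λ { zero → a≡b ; (suc i) → coeff-≡ f≈g i }

  head-≡ : ∀ {a b f g} → a ∷ f ≈ b ∷ g → a ≡ b
  head-≡ e = coeff-≡ e 0

  tail-≈ : ∀ {a b f g} → a ∷ f ≈ b ∷ g → f ≈ g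
  tail-≈ e = mk≈ λ i → coeff-≡ e (suc i)

  0∷[]≈[] : 0ℤ ∷ [] ≈ []
  0∷[]≈[] = mk≈ λ { zero → ≡.refl ; (suc _) → ≡.refl }

  ∷≈[]⇒tail≈[] : ∀ {a f} → a ∷ f ≈ [] → f ≈ []
  ∷≈[]⇒tail≈[] e = mk≈ λ i → coeff-≡ e (suc i)

  +-cong : ∀ {f f′ g g′} → f ≈ f′ → g ≈ g′ → f + g ≈ f′ + g′
  +-cong {f} {f′} {g} {g′} e e′ = mk≈ λ i → ≡.trans (coeff-+ f g i)
    (≡.trans (≡.cong₂ ℤ._+_ (coeff-≡ e i) (coeff-≡ e′ i)) (≡.sym (coeff-+ f′ g′ i)))

  +-congˡ : ∀ {f g g′} → g ≈ g′ → f + g ≈ f + g′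
  +-congˡ = +-cong ≈-refl

  +-congʳ : ∀ {f f′ g} → f ≈ f′ → f + g ≈ f′ + g
  +-congʳ e = +-cong e ≈-refl

  +-comm : ∀ f g → f + g ≈ g + f
  +-comm f g = mk≈ λ i → ≡.trans (coeff-+ f g i)
    (≡.trans (ℤ.+-comm (coeff f i) (coeff g i)) (≡.sym (coeff-+ g f i)))

  +-assoc : ∀ f g h → (f + g) + h ≈ f + (g + h)
  +-assoc f g h = mk≈ λ i →
    ≡.trans (coeff-+ (f + g) h i)
    (≡.trans (≡.cong (ℤ._+ coeff h i) (coeff-+ f g i))
    (≡.trans (ℤ.+-assoc (coeff f i) (coeff g i) (coeff h i))
    (≡.trans (≡.cong (λ a → coeff f i ℤ.+ a) (≡.sym (coeff-+ g h i)))
    (≡.sym (coeff-+ f (g + h) i)))))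

  +-identityʳ : ∀ f → f + [] ≈ f
  +-identityʳ []      = ≈-refl
  +-identityʳ (_ ∷ _) = ≈-refl

  -‿cong : ∀ {f g} → f ≈ g → - f ≈ - g
  -‿cong {f} {g} e = mk≈ λ i → ≡.trans (coeff-neg f i)
    (≡.trans (≡.cong (λ a → ℤ.- a) (coeff-≡ e i)) (≡.sym (coeff-neg g i)))

  -‿inverseˡ : ∀ f → - f + f ≈ []
  -‿inverseˡ f = mk≈ λ i → ≡.trans (coeff-+ (- f) f i)
    (≡.trans (≡.cong (ℤ._+ coeff f i) (coeff-neg f i)) (ℤ.+-inverseˡ (coeff f i)))

  -‿inverseʳ : ∀ f → f + - f ≈ []
  -‿inverseʳ f = ≈-trans (+-comm f (- f)) (-‿inverseˡ f)

  +-commutativeSemigroup : CommutativeSemigroup _ _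
  +-commutativeSemigroup = record
    { Carrier = ℤ[x]
    ; _≈_     = _≈_
    ; _∙_     = _+_
    ; isCommutativeSemigroup = record
      { isSemigroup = record
        { isMagma = record
          { isEquivalence = Setoid.isEquivalence ≈-setoid
          ; ∙-cong        = +-cong
          }
        ; assoc = +-assoc
        }
      ; comm = +-comm
      }
    }

  open CommutativeSemigroupProperties +-commutativeSemigroup
    using () renaming (interchange to +-interchange; x∙yz≈y∙xz to x+[y+z]≈y+[x+z])

  ·-cong : ∀ {a b f g} → a ≡ b → f ≈ g → a · f ≈ b · g
  ·-cong {a} {b} {f} {g} a≡b e = mk≈ λ i → ≡.trans (coeff-· a f i)
    (≡.trans (≡.cong₂ ℤ._*_ a≡b (coeff-≡ e i)) (≡.sym (coeff-· b g i)))

  ·-zeroˡ : ∀ f → 0ℤ · f ≈ []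
  ·-zeroˡ f = mk≈ λ i → ≡.trans (coeff-· 0ℤ f i) (ℤ.*-zeroˡ (coeff f i))

  ·-identityˡ : ∀ f → 1ℤ · f ≈ f
  ·-identityˡ f = mk≈ λ i → ≡.trans (coeff-· 1ℤ f i) (ℤ.*-identityˡ (coeff f i))

  ·-assoc : ∀ a b f → (a ℤ.* b) · f ≈ a · (b · f)
  ·-assoc a b f = mk≈ λ i → ≡.trans (coeff-· (a ℤ.* b) f i)
    (≡.trans (ℤ.*-assoc a b (coeff f i))
    (≡.trans (≡.cong (a ℤ.*_) (≡.sym (coeff-· b f i))) (≡.sym (coeff-· a (b · f) i))))

  ·-distribˡ : ∀ a f g → a · (f + g) ≈ a · f + a · g
  ·-distribˡ a f g = mk≈ λ i → ≡.trans (coeff-· a (f + g) i)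
    (≡.trans (≡.cong (a ℤ.*_) (coeff-+ f g i))
    (≡.trans (ℤ.*-distribˡ-+ a (coeff f i) (coeff g i))
    (≡.trans (≡.sym (≡.cong₂ ℤ._+_ (coeff-· a f i) (coeff-· a g i)))
    (≡.sym (coeff-+ (a · f) (a · g) i)))))

  ·-distribʳ : ∀ f a b → (a ℤ.+ b) · f ≈ a · f + b · f
  ·-distribʳ f a b = mk≈ λ i → ≡.trans (coeff-· (a ℤ.+ b) f i)
    (≡.trans (ℤ.*-distribʳ-+ (coeff f i) a b)
    (≡.trans (≡.sym (≡.cong₂ ℤ._+_ (coeff-· a f i) (coeff-· b f i)))
    (≡.sym (coeff-+ (a · f) (b · f) i))))

  *-zeroʳ : ∀ f → f * [] ≈ []
  *-zeroʳ []      = ≈-refl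
  *-zeroʳ (a ∷ f) = ≈-trans (∷-cong ≡.refl (*-zeroʳ f)) 0∷[]≈[]

  f≈[]⇒f*g≈[] : ∀ {f} → f ≈ [] → ∀ g → f * g ≈ []
  f≈[]⇒f*g≈[] {[]}    e g = ≈-refl
  f≈[]⇒f*g≈[] {a ∷ f} e g = begin
    a · g + (0ℤ ∷ f * g) ≈⟨ +-cong (·-cong (coeff-≡ e 0) ≈-refl)
                                   (∷-cong ≡.refl (f≈[]⇒f*g≈[] (∷≈[]⇒tail≈[] e) g)) ⟩
    0ℤ · g + (0ℤ ∷ [])   ≈⟨ +-cong (·-zeroˡ g) 0∷[]≈[] ⟩
    []                   ∎

  *-congʳ : ∀ {f f′} → f ≈ f′ → ∀ g → f * g ≈ f′ * g
  *-congʳ {[]}    {f′}     e g = ≈-sym (f≈[]⇒f*g≈[] (≈-sym e) g)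
  *-congʳ {a ∷ f} {[]}     e g = f≈[]⇒f*g≈[] e g
  *-congʳ {a ∷ f} {b ∷ f′} e g =
    +-cong (·-cong (head-≡ e) ≈-refl) (∷-cong ≡.refl (*-congʳ (tail-≈ e) g))

  *-∷ʳ : ∀ f b g → f * (b ∷ g) ≈ b · f + (0ℤ ∷ f * g)
  *-∷ʳ []      b g = ≈-sym 0∷[]≈[]
  *-∷ʳ (a ∷ f) b g = ∷-cong (≡.cong (ℤ._+ 0ℤ) (ℤ.*-comm a b)) (begin
    a · g + f * (b ∷ g)             ≈⟨ +-congˡ (*-∷ʳ f b g) ⟩
    a · g + (b · f + (0ℤ ∷ f * g))  ≈⟨ x+[y+z]≈y+[x+z] (a · g) (b · f) (0ℤ ∷ f * g) ⟩
    b · f + (a · g + (0ℤ ∷ f * g))  ∎)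

  *-comm : ∀ f g → f * g ≈ g * f
  *-comm []      g = ≈-sym (*-zeroʳ g)
  *-comm (a ∷ f) g = begin
    a · g + (0ℤ ∷ f * g) ≈⟨ +-congˡ (∷-cong ≡.refl (*-comm f g)) ⟩
    a · g + (0ℤ ∷ g * f) ≈⟨ *-∷ʳ g a f ⟨
    g * (a ∷ f)          ∎

  *-cong : ∀ {f f′ g g′} → f ≈ f′ → g ≈ g′ → f * g ≈ f′ * g′
  *-cong {f} {f′} {g} {g′} e e′ = begin
    f * g   ≈⟨ *-congʳ e g ⟩
    f′ * g  ≈⟨ *-comm f′ g ⟩
    g * f′  ≈⟨ *-congʳ e′ f′ ⟩
    g′ * f′ ≈⟨ *-comm g′ f′ ⟩
    f′ * g′ ∎

  *-distribʳ : ∀ h f g → (f + g) * h ≈ f * h + g * h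
  *-distribʳ h []      g       = ≈-refl
  *-distribʳ h (a ∷ f) []      = ≈-sym (+-identityʳ _)
  *-distribʳ h (a ∷ f) (b ∷ g) = begin
    (a ℤ.+ b) · h + (0ℤ ∷ (f + g) * h)
      ≈⟨ +-cong (·-distribʳ h a b) (∷-cong ≡.refl (*-distribʳ h f g)) ⟩
    (a · h + b · h) + ((0ℤ ∷ f * h) + (0ℤ ∷ g * h))
      ≈⟨ +-interchange (a · h) (b · h) (0ℤ ∷ f * h) (0ℤ ∷ g * h) ⟩
    (a · h + (0ℤ ∷ f * h)) + (b · h + (0ℤ ∷ g * h)) ∎

  *-distribˡ : ∀ h f g → h * (f + g) ≈ h * f + h * g
  *-distribˡ h f g = begin
    h * (f + g)   ≈⟨ *-comm h (f + g) ⟩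
    (f + g) * h   ≈⟨ *-distribʳ h f g ⟩
    f * h + g * h ≈⟨ +-cong (*-comm f h) (*-comm g h) ⟩
    h * f + h * g ∎

  ·-*-assoc : ∀ a f g → (a · f) * g ≈ a · (f * g)
  ·-*-assoc a []      g = ≈-refl
  ·-*-assoc a (b ∷ f) g = begin
    (a ℤ.* b) · g + (0ℤ ∷ (a · f) * g)
      ≈⟨ +-cong (·-assoc a b g) (∷-cong (≡.sym (ℤ.*-zeroʳ a)) (·-*-assoc a f g)) ⟩
    a · (b · g) + a · (0ℤ ∷ f * g)
      ≈⟨ ·-distribˡ a (b · g) (0ℤ ∷ f * g) ⟨
    a · (b · g + (0ℤ ∷ f * g)) ∎

  0∷-* : ∀ f g → (0ℤ ∷ f) * g ≈ 0ℤ ∷ f * g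
  0∷-* f g = +-congʳ (·-zeroˡ g)

  *-assoc : ∀ f g h → (f * g) * h ≈ f * (g * h)
  *-assoc []      g h = ≈-refl
  *-assoc (a ∷ f) g h = begin
    (a · g + (0ℤ ∷ f * g)) * h      ≈⟨ *-distribʳ h (a · g) (0ℤ ∷ f * g) ⟩
    (a · g) * h + (0ℤ ∷ f * g) * h  ≈⟨ +-cong (·-*-assoc a g h) (0∷-* (f * g) h) ⟩
    a · (g * h) + (0ℤ ∷ f * g * h)  ≈⟨ +-congˡ (∷-cong ≡.refl (*-assoc f g h)) ⟩
    a · (g * h) + (0ℤ ∷ f * (g * h)) ∎

  *-identityˡ : ∀ f → 1ᴾ * f ≈ f
  *-identityˡ f = begin
    1ℤ · f + (0ℤ ∷ []) ≈⟨ +-cong (·-identityˡ f) 0∷[]≈[] ⟩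
    f + []             ≈⟨ +-identityʳ f ⟩
    f                  ∎

  *-identityʳ : ∀ f → f * 1ᴾ ≈ f
  *-identityʳ f = ≈-trans (*-comm f 1ᴾ) (*-identityˡ f)

  ℤ[x]-commutativeRing : CommutativeRing _ _
  ℤ[x]-commutativeRing = record
    { Carrier = ℤ[x]
    ; _≈_     = _≈_
    ; _+_     = _+_
    ; _*_     = _*_
    ; -_      = -_
    ; 0#      = 0ᴾ
    ; 1#      = 1ᴾ
    ; isCommutativeRing = record
      { isRing = record
        { +-isAbelianGroup = record
          { isGroup = record
            { isMonoid = record
              { isSemigroup = record
                { isMagma = record
                  { isEquivalence = Setoid.isEquivalence ≈-setoid
                  ; ∙-cong        = +-cong
                  }
                ; assoc = +-assoc
                }
              ; identity = (λ _ → ≈-refl) , +-identityʳ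
              }
            ; inverse = -‿inverseˡ , -‿inverseʳ
            ; ⁻¹-cong = -‿cong
            }
          ; comm = +-comm
          }
        ; *-cong     = *-cong
        ; *-assoc    = *-assoc
        ; *-identity = *-identityˡ , *-identityʳ
        ; distrib    = *-distribˡ , *-distribʳ
        }
      ; *-comm = *-comm
      }
    }

open Polynomial public
  using (ℤ[x]; coeff; const; X; MonicOfDegree; MonicNonconstant; ℤ[x]-commutativeRing)

ℤ[x]-ring : Ring _ _
ℤ[x]-ring = CommutativeRing.ring ℤ[x]-commutativeRing

module PolynomialAction (M : LeftModule ℤ-ring m ℓm) (φ : Endomorphism M) where
  open LeftModule M
  private
    module P = Polynomial
    module φ = LinearMap φ
  open φ using (⟦_⟧)
  open CommutativeSemigroupProperties (CommutativeMonoid.commutativeSemigroup +ᴹ-commutativeMonoid)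
    using () renaming (interchange to +ᴹ-interchange)
  open SetoidReasoning ≈ᴹ-setoid

  -- Horner evaluation of f at φ, so that x acts as φ.
  act : ℤ[x] → Carrierᴹ → Carrierᴹ
  act []      v = 0ᴹ
  act (a ∷ f) v = a *ₗ v +ᴹ ⟦ act f v ⟧

  act-congʳ : ∀ f {v w} → v ≈ᴹ w → act f v ≈ᴹ act f w
  act-congʳ []      e = ≈ᴹ-refl
  act-congʳ (a ∷ f) e = +ᴹ-cong (*ₗ-congˡ e) (φ.⟦⟧-cong (act-congʳ f e))

  act-≈0 : ∀ f {v} → f P.≈ [] → act f v ≈ᴹ 0ᴹ
  act-≈0 []      e = ≈ᴹ-refl
  act-≈0 (a ∷ f) {v} e = begin
    a *ₗ v +ᴹ ⟦ act f v ⟧ ≈⟨ +ᴹ-cong (*ₗ-congʳ (P.coeff-≡ e 0))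
                                     (φ.⟦⟧-cong (act-≈0 f (P.∷≈[]⇒tail≈[] e))) ⟩
    0ℤ *ₗ v +ᴹ ⟦ 0ᴹ ⟧     ≈⟨ +ᴹ-cong (*ₗ-zeroˡ v) φ.0ᴹ-homo ⟩
    0ᴹ +ᴹ 0ᴹ              ≈⟨ +ᴹ-identityˡ 0ᴹ ⟩
    0ᴹ                    ∎

  act-congˡ : ∀ f g {v} → f P.≈ g → act f v ≈ᴹ act g v
  act-congˡ []      g       e = ≈ᴹ-sym (act-≈0 g (P.≈-sym e))
  act-congˡ (a ∷ f) []      e = act-≈0 (a ∷ f) e
  act-congˡ (a ∷ f) (b ∷ g) e =
    +ᴹ-cong (*ₗ-congʳ (P.head-≡ e)) (φ.⟦⟧-cong (act-congˡ f g (P.tail-≈ e)))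

  act-distribʳ : ∀ v f g → act (f P.+ g) v ≈ᴹ act f v +ᴹ act g v
  act-distribʳ v []      g       = ≈ᴹ-sym (+ᴹ-identityˡ _)
  act-distribʳ v (a ∷ f) []      = ≈ᴹ-sym (+ᴹ-identityʳ _)
  act-distribʳ v (a ∷ f) (b ∷ g) = begin
    (a ℤ.+ b) *ₗ v +ᴹ ⟦ act (f P.+ g) v ⟧
      ≈⟨ +ᴹ-cong (*ₗ-distribʳ v a b)
                 (≈ᴹ-trans (φ.⟦⟧-cong (act-distribʳ v f g)) (φ.+ᴹ-homo _ _)) ⟩
    (a *ₗ v +ᴹ b *ₗ v) +ᴹ (⟦ act f v ⟧ +ᴹ ⟦ act g v ⟧)
      ≈⟨ +ᴹ-interchange _ _ _ _ ⟩
    (a *ₗ v +ᴹ ⟦ act f v ⟧) +ᴹ (b *ₗ v +ᴹ ⟦ act g v ⟧) ∎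

  act-distribˡ : ∀ f v w → act f (v +ᴹ w) ≈ᴹ act f v +ᴹ act f w
  act-distribˡ []      v w = ≈ᴹ-sym (+ᴹ-identityˡ _)
  act-distribˡ (a ∷ f) v w = begin
    a *ₗ (v +ᴹ w) +ᴹ ⟦ act f (v +ᴹ w) ⟧
      ≈⟨ +ᴹ-cong (*ₗ-distribˡ a v w)
                 (≈ᴹ-trans (φ.⟦⟧-cong (act-distribˡ f v w)) (φ.+ᴹ-homo _ _)) ⟩
    (a *ₗ v +ᴹ a *ₗ w) +ᴹ (⟦ act f v ⟧ +ᴹ ⟦ act f w ⟧)
      ≈⟨ +ᴹ-interchange _ _ _ _ ⟩
    (a *ₗ v +ᴹ ⟦ act f v ⟧) +ᴹ (a *ₗ w +ᴹ ⟦ act f w ⟧) ∎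

  act-zeroʳ : ∀ f → act f 0ᴹ ≈ᴹ 0ᴹ
  act-zeroʳ []      = ≈ᴹ-refl
  act-zeroʳ (a ∷ f) = begin
    a *ₗ 0ᴹ +ᴹ ⟦ act f 0ᴹ ⟧ ≈⟨ +ᴹ-cong (*ₗ-zeroʳ a) (φ.⟦⟧-cong (act-zeroʳ f)) ⟩
    0ᴹ +ᴹ ⟦ 0ᴹ ⟧            ≈⟨ +ᴹ-identityˡ _ ⟩
    ⟦ 0ᴹ ⟧                  ≈⟨ φ.0ᴹ-homo ⟩
    0ᴹ                      ∎

  act-· : ∀ a f v → act (a P.· f) v ≈ᴹ a *ₗ act f v
  act-· a []      v = ≈ᴹ-sym (*ₗ-zeroʳ a)
  act-· a (b ∷ f) v = begin
    (a ℤ.* b) *ₗ v +ᴹ ⟦ act (a P.· f) v ⟧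
      ≈⟨ +ᴹ-cong (*ₗ-assoc a b v)
                 (≈ᴹ-trans (φ.⟦⟧-cong (act-· a f v)) (φ.*ₗ-homo a _)) ⟩
    a *ₗ b *ₗ v +ᴹ a *ₗ ⟦ act f v ⟧
      ≈⟨ *ₗ-distribˡ a _ _ ⟨
    a *ₗ (b *ₗ v +ᴹ ⟦ act f v ⟧) ∎

  act-assoc : ∀ f g v → act (f P.* g) v ≈ᴹ act f (act g v)
  act-assoc []      g v = ≈ᴹ-refl
  act-assoc (a ∷ f) g v = begin
    act (a P.· g P.+ (0ℤ ∷ f P.* g)) v
      ≈⟨ act-distribʳ v (a P.· g) (0ℤ ∷ f P.* g) ⟩
    act (a P.· g) v +ᴹ (0ℤ *ₗ v +ᴹ ⟦ act (f P.* g) v ⟧)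
      ≈⟨ +ᴹ-cong (act-· a g v) (+ᴹ-cong (*ₗ-zeroˡ v) (φ.⟦⟧-cong (act-assoc f g v))) ⟩
    a *ₗ act g v +ᴹ (0ᴹ +ᴹ ⟦ act f (act g v) ⟧)
      ≈⟨ +ᴹ-congˡ (+ᴹ-identityˡ _) ⟩
    a *ₗ act g v +ᴹ ⟦ act f (act g v) ⟧ ∎

  act-identityˡ : ∀ v → act P.1ᴾ v ≈ᴹ v
  act-identityˡ v = begin
    1ℤ *ₗ v +ᴹ ⟦ 0ᴹ ⟧ ≈⟨ +ᴹ-cong (*ₗ-identityˡ v) φ.0ᴹ-homo ⟩
    v +ᴹ 0ᴹ           ≈⟨ +ᴹ-identityʳ v ⟩
    v                 ∎

  ℤ[x]-module : LeftModule ℤ[x]-ring m ℓm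
  ℤ[x]-module = record
    { Carrierᴹ = Carrierᴹ
    ; _≈ᴹ_     = _≈ᴹ_
    ; _+ᴹ_     = _+ᴹ_
    ; _*ₗ_     = act
    ; 0ᴹ       = 0ᴹ
    ; -ᴹ_      = -ᴹ_
    ; isLeftModule = record
      { isLeftSemimodule = record
        { +ᴹ-isCommutativeMonoid = +ᴹ-isCommutativeMonoid
        ; isPreleftSemimodule = record
          { *ₗ-cong      = λ {f} {g} e e′ → ≈ᴹ-trans (act-congˡ f g e) (act-congʳ g e′)
          ; *ₗ-zeroˡ     = λ _ → ≈ᴹ-refl
          ; *ₗ-distribʳ  = act-distribʳ
          ; *ₗ-identityˡ = act-identityˡ
          ; *ₗ-assoc     = act-assoc
          ; *ₗ-zeroʳ     = act-zeroʳ
          ; *ₗ-distribˡ  = act-distribˡ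
          }
        }
      ; -ᴹ‿cong    = -ᴹ‿cong
      ; -ᴹ‿inverse = -ᴹ‿inverse
      }
    }

open PolynomialAction using (ℤ[x]-module) public

module Submodules {R : Ring r ℓr} (M : LeftModule R m ℓm) where
  open Ring R using (Carrier; *-rawMagma)
  open LeftModule M
  open Sum +ᴹ-commutativeMonoid using (sum)
  open RawMagmaDefinitions *-rawMagma using (_∣_)

  ⟨_⟩ : Carrierᴹ → Pred Carrierᴹ (r ⊔ ℓm)
  ⟨ g ⟩ v = ∃ λ f → v ≈ᴹ f *ₗ g

  Ann : ∀ {q} → Pred Carrierᴹ q → Pred Carrier (m ⊔ ℓm ⊔ q)
  Ann V f = ∀ v → v ∈ V → f *ₗ v ≈ᴹ 0ᴹ

  -- The principal ideal (a), for commutative R.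
  Principal : Carrier → Pred Carrier (r ⊔ ℓr)
  Principal a f = a ∣ f

  record IsDirectSum {q k} (V : Fin k → Pred Carrierᴹ q) : Set (m ⊔ ℓm ⊔ q) where
    field
      spans  : ∀ v → ∃ λ (w : Vector Carrierᴹ k) → (∀ i → w i ∈ V i) × v ≈ᴹ sum w
      unique : ∀ (w w′ : Vector Carrierᴹ k) → (∀ i → w i ∈ V i) → (∀ i → w′ i ∈ V i) →
               sum w ≈ᴹ sum w′ → ∀ i → w i ≈ᴹ w′ i

ℤ^ : ℕ → LeftModule ℤ-ring _ _
ℤ^ = freeModule ℤ-ring

record HasRationalCanonicalForm {n} (φ : Endomorphism (ℤ^ n)) : Set where
  open Submodules (ℤ[x]-module (ℤ^ n) φ)
  open RawMagmaDefinitions (CommutativeRing.*-rawMagma ℤ[x]-commutativeRing) using (_∣_)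
  field
    k           : ℕ
    generator   : Fin k → Vector ℤ n
    a           : Fin k → ℤ[x]
    directSum   : IsDirectSum λ i → ⟨ generator i ⟩
    annihilator : ∀ i f → f ∈ Ann ⟨ generator i ⟩ ⇔ f ∈ Principal (a i)
    monic       : ∀ i → MonicNonconstant (a i)
    chain       : ∀ i j → i Fin.≤ j → a i ∣ a j

module UpDown {r c ℓ₁ ℓ₂} (P : DifferentialPoset r c ℓ₁ ℓ₂) where
  open DifferentialPoset P

  ℤP : ℕ → LeftModule ℤ-ring _ _
  ℤP n = ℤ^ ∣P n ∣

  -- By rank-⋖, everything covering an element of rank n has rank n + 1,
  -- so the sum of all covers is the 0/1-vector indicating them.
  U : ∀ n → LinearMap (ℤP n) (ℤP (suc n))
  U n = linearExtension (ℤP (suc n)) λ i j →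
    if does (P[ n ] i ⋖? P[ suc n ] j) then 1ℤ else 0ℤ

  -- D[1+ n ] is the down map on rank n + 1; the map on rank 0, whose
  -- target is zero, is never needed.
  D[1+_] : ∀ n → LinearMap (ℤP (suc n)) (ℤP n)
  D[1+ n ] = linearExtension (ℤP n) λ j i →
    if does (P[ n ] i ⋖? P[ suc n ] j) then 1ℤ else 0ℤ

  DU : ∀ n → Endomorphism (ℤP n)
  DU n = D[1+ n ] ∘ₗ U n

  [DU_] : ∀ n → Matrix ℤ ∣P n ∣ ∣P n ∣
  [DU n ] = matrixOf ℤ-ring (DU n)

  open SmithNormalForm ℤ[x]-commutativeRing using (_+ₘ_; scalarₘ)

  [DU_]+xI : ∀ n → Matrix ℤ[x] ∣P n ∣ ∣P n ∣
  [DU n ]+xI = (λ i j → const ([DU n ] i j)) +ₘ scalarₘ X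

{-# OPTIONS --safe #-}
module Submission where

-- Let θ = U D in rank n + 1 and ψ = D U in rank n. Then D θ = ψ D, and D U = θ + r
-- in rank n + 1, so it suffices to pass from ψ to θ. Lift the cyclic generators gᵢ
-- of ψ, with annihilators aᵢ, along the surjection D to elements wᵢ. Then aᵢ(θ) wᵢ
-- lies in ker D = ker θ, and adding u ∈ ker D to wᵢ changes it by aᵢ(0) u. Once the
-- aᵢ(θ) wᵢ are part of a basis of ker D, the wᵢ (with annihilators x aᵢ) and the
-- remaining basis vectors (with annihilator x) are a rational canonical form of θ.
-- The aᵢ are treated from the largest down. As U is the transpose of D, it is
-- injective modulo every h, which makes each new aᵢ(θ) wᵢ unimodular modulo aᵢ(0)
-- over the previous ones; one spare dimension allows to lift it to a unimodular
-- vector over ℤ. The multiplicity of the root (j + 1) r among the aᵢ is at most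
-- Δpₙ₋ⱼ, so the growth condition provides the spare dimension, except possibly when
-- r = 1 and Δpₙ₊₁ = Δpₙ₋₂; but then the last aᵢ(0) divides 3, and every unit modulo 3
-- is ±1. If aᵢ(0) = ±1 and no dimension is left, aᵢ(θ) wᵢ = 0 can be achieved.
-- The Smith normal form results from eliminating in the companion blocks.

open import Defs

open import Algebra.Bundles using (CommutativeRing; Ring)
open import Algebra.Module.Bundles using (LeftModule)
open import Data.Bool.Base using (true; false; if_then_else_)
open import Data.Fin.Base as Fin using (Fin; zero; suc; toℕ)
import Data.Fin.Properties as Fin
open import Data.Integer.Base as ℤ using (ℤ; +_; 0ℤ; 1ℤ; _+_; _*_; -_; _-_)
open import Data.Integer.DivMod as ℤ using (_%_; _/_)
open import Data.Integer.Divisibility.Signed as ℤ using (_∣_; divides)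
import Data.Integer.Properties as ℤ
open import Data.Integer.Tactic.RingSolver using (solve-∀)
open import Data.List.Base using ([]; _∷_; tabulate)
open import Data.Maybe.Base using (Maybe; just; nothing)
open import Data.Nat.Base as ℕ using (ℕ; zero; suc; _∸_)
import Data.Nat.Divisibility as ℕ
open import Data.Nat.Induction using (<-wellFounded)
import Data.Nat.Properties as ℕ
open import Data.Product.Base using (_×_; _,_; Σ; ∃; ∃₂; proj₁; proj₂; uncurry)
open import Data.Sum.Base using (_⊎_; inj₁; inj₂; [_,_]′; map₁)
open import Data.Vec.Functional as V using (Vector; tail)
open import Function.Base using (_∘_; id)
open import Function.Bundles using (mk⇔; Equivalence)
open import Induction.WellFounded using (Acc; acc)
open import Level using (Level; _⊔_)
open import Relation.Binary.Bundles using (Setoid)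
open import Relation.Binary.PropositionalEquality using (_≡_; _≗_; refl; sym; trans; cong; cong₂; subst; subst₂)
open import Relation.Nullary using (Dec; ¬_; yes; no; does; contradiction)
open import Relation.Nullary.Decidable using (_×-dec_)
open import Relation.Unary using (Pred)
open import Tactic.RingSolver using () renaming (solve-∀ to solve-∀-in)

import Algebra.Definitions.RawMagma as RawMagmaDefinitions
import Algebra.Properties.CommutativeMonoid.Sum as Sum
import Algebra.Properties.Monoid.Divisibility as MonoidDivisibility
import Algebra.Properties.Semiring.Sum as SemiringSum
import Relation.Binary.Properties.Poset as PosetProperties
import Relation.Binary.Reasoning.Setoid as SetoidReasoning
import Tactic.RingSolver.Core.AlmostCommutativeRing as ACR

-- The obstacle is integral: in dimension one, a vector that is unimodular modulo `N` need not lift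
-- to a unimodular one, since units modulo `N` need not be signs. Going from the largest `aᵢ` down
-- serves two purposes. The value `aᵢ(0)` divides every `aⱼ(0)` already treated, so those terms
-- vanish modulo any divisor of `aᵢ(0)`; and while a dimension is left all treated annihilators are
-- `x aⱼ`, so the new `x aᵢ` divides them. The exception 3 arises as follows. Each `aᵢ` divides the
-- product of the `x - c r` with 1 ≤ c ≤ n + 1. When `aᵢ` takes the last dimension, exactly `Δpₙ₊₁`
-- annihilators from `aᵢ` on share its roots, so a root with a smaller multiplicity bound is
-- excluded. Ranks at distance `a` are compared modulo `a r`, which says nothing if `a r = 1`. For r
-- = 1 the hypothesis relates the ranks n + 1 and n - 1, so c = 3 stays open, and c = 1 too, but
-- that root contributes only a factor 1.

private
  variable
    r ℓr m₁ ℓm₁ m₂ ℓm₂ : Level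
    m n k d : ℕ

-- Linear maps between free modules

module _ {R : Ring r ℓr} {M : LeftModule R m₁ ℓm₁} {N : LeftModule R m₂ ℓm₂} (f : LinearMap M N) where
  private
    module M = LeftModule M
    module N = LeftModule N
    module ΣM = Sum M.+ᴹ-commutativeMonoid
    module ΣN = Sum N.+ᴹ-commutativeMonoid
  open LinearMap f

  ⟦⟧-sum : (w : Vector M.Carrierᴹ n) → ⟦ ΣM.sum w ⟧ N.≈ᴹ ΣN.sum (⟦_⟧ ∘ w)
  ⟦⟧-sum {zero}  w = 0ᴹ-homo
  ⟦⟧-sum {suc n} w = N.≈ᴹ-trans (+ᴹ-homo _ _) (N.+ᴹ-congˡ (⟦⟧-sum (w ∘ suc)))

module _ (R : Ring r ℓr) where
  open Ring R hiding (zero; _-_; -_)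
    renaming (_+_ to _⊕_; _*_ to _⊛_; refl to ≈-refl; sym to ≈-sym; trans to ≈-trans)
  open SemiringSum semiring using (sum; sum-cong-≋; sum-replicate-zero)

  sum-lookup : (w : Vector (Vector Carrier n) m) (i : Fin n) →
    Sum.sum (LeftModule.+ᴹ-commutativeMonoid (freeModule R n)) w i ≡ sum (λ j → w j i)
  sum-lookup {m = zero}  w i = refl
  sum-lookup {m = suc m} w i = cong (w zero i ⊕_) (sum-lookup (w ∘ suc) i)

  sum-basis : (v : Vector Carrier n) (i : Fin n) → sum (λ j → v j ⊛ basis R j i) ≈ v i
  sum-basis {suc n} v zero = ≈-trans
    (+-cong (*-identityʳ _)
      (≈-trans (sum-cong-≋ {n} (λ j → zeroʳ (v (suc j)))) (sum-replicate-zero n)))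
    (+-identityʳ _)
  sum-basis {suc n} v (suc i) = ≈-trans (+-cong (zeroʳ _) (sum-basis (v ∘ suc) i)) (+-identityˡ _)

  ⟦⟧-expand : (f : LinearMap (freeModule R m) (freeModule R n)) (v : Vector Carrier m) (i : Fin n) →
    LinearMap.⟦_⟧ f v i ≈ sum (λ j → v j ⊛ LinearMap.⟦_⟧ f (basis R j) i)
  ⟦⟧-expand {m = m} {n = n} f v i = begin
    ⟦ v ⟧ i                              ≈⟨ ⟦⟧-cong (λ l → ≈-trans (≈-sym (sum-basis v l))
        (reflexive (sym (sum-lookup e l)))) i ⟩
    ⟦ ΣM e ⟧ i                           ≈⟨ ⟦⟧-sum f e i ⟩
    ΣN (⟦_⟧ ∘ e) i                       ≡⟨ sum-lookup (⟦_⟧ ∘ e) i ⟩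
    sum (λ j → ⟦ e j ⟧ i)                ≈⟨ sum-cong-≋ (λ j → *ₗ-homo (v j) (basis R j) i) ⟩
    sum (λ j → v j ⊛ ⟦ basis R j ⟧ i)    ∎
    where
    open LinearMap f
    open SetoidReasoning setoid
    ΣM = Sum.sum (LeftModule.+ᴹ-commutativeMonoid (freeModule R m))
    ΣN = Sum.sum (LeftModule.+ᴹ-commutativeMonoid (freeModule R n))
    e : Vector (Vector Carrier m) m
    e j = LeftModule._*ₗ_ (freeModule R m) (v j) (basis R j)

-- Integer linear algebra

module Zⁿ {n} = LeftModule (ℤ^ n)
open Zⁿ using (_+ᴹ_; _*ₗ_; 0ᴹ)
open SemiringSum ℤ.+-*-semiring using (*-distribˡ-sum; *-distribʳ-sum)
  renaming (sum to ∑; sum-cong-≗ to ∑-cong; ∑-comm to ∑-swap; ∑-distrib-+ to ∑-+)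

infix 4 _⇒ᶻ_
_⇒ᶻ_ : ℕ → ℕ → Set
m ⇒ᶻ n = LinearMap (ℤ^ m) (ℤ^ n)

linearMapᶻ : (f : Vector ℤ m → Vector ℤ n) → (∀ {v w} → v ≗ w → f v ≗ f w) →
  (∀ v w → f (v +ᴹ w) ≗ f v +ᴹ f w) → (∀ a v → f (a *ₗ v) ≗ a *ₗ f v) → m ⇒ᶻ n
linearMapᶻ {m} {n} = linearMap (ℤ^ m) (ℤ^ n)

open LinearMap using (⟦_⟧; ⟦⟧-cong; +ᴹ-homo; *ₗ-homo; 0ᴹ-homo)

idₗ : n ⇒ᶻ n
idₗ = linearMapᶻ id id (λ _ _ _ → refl) (λ _ _ _ → refl)

_∣ᵛ_ : ℤ → Vector ℤ n → Set
h ∣ᵛ v = ∀ i → h ∣ v i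

∣ᵛ⇒≗ : ∀ {h} {v : Vector ℤ n} → h ∣ᵛ v → ∃ λ w → v ≗ h *ₗ w
∣ᵛ⇒≗ {h = h} h∣v = (λ i → _∣_.quotient (h∣v i)) ,
  λ i → trans (_∣_.equality (h∣v i)) (ℤ.*-comm _ h)

≗⇒∣ᵛ : ∀ {h} {v w : Vector ℤ n} → v ≗ h *ₗ w → h ∣ᵛ v
≗⇒∣ᵛ {h = h} {w = w} e i = divides (w i) (trans (e i) (ℤ.*-comm h (w i)))

∣ᵛ-resp : ∀ {h} {v w : Vector ℤ n} → v ≗ w → h ∣ᵛ v → h ∣ᵛ w
∣ᵛ-resp e h∣v i = subst (_ ∣_) (e i) (h∣v i)

⟦⟧-∣ᵛ : (f : m ⇒ᶻ n) → ∀ {h v} → h ∣ᵛ v → h ∣ᵛ ⟦ f ⟧ v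
⟦⟧-∣ᵛ f {h} h∣v with w , e ← ∣ᵛ⇒≗ h∣v =
  ≗⇒∣ᵛ (λ i → trans (⟦⟧-cong f e i) (*ₗ-homo f h w i))

-- The divisors include `h = 0ℤ`, so a primitive vector is also nonzero.
Primitive : Vector ℤ n → Set
Primitive v = ∀ h → h ∣ᵛ v → h ∣ 1ℤ

record Iso (n : ℕ) : Set where
  field
    to from : n ⇒ᶻ n
    to-from : ∀ v → ⟦ to ⟧ (⟦ from ⟧ v) ≗ v
    from-to : ∀ v → ⟦ from ⟧ (⟦ to ⟧ v) ≗ v

  to-injective : ∀ {v w} → ⟦ to ⟧ v ≗ ⟦ to ⟧ w → v ≗ w
  to-injective e i = trans (sym (from-to _ i)) (trans (⟦⟧-cong from e i) (from-to _ i))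

  to-Primitive : ∀ {v} → Primitive v → Primitive (⟦ to ⟧ v)
  to-Primitive prim h h∣ = prim h (∣ᵛ-resp (from-to _) (⟦⟧-∣ᵛ from h∣))

idᵢ : Iso n
idᵢ = record { to = idₗ ; from = idₗ ; to-from = λ _ _ → refl ; from-to = λ _ _ → refl }

infixr 9 _∘ᵢ_
_∘ᵢ_ : Iso n → Iso n → Iso n
G ∘ᵢ H = record
  { to      = G.to ∘ₗ H.to
  ; from    = H.from ∘ₗ G.from
  ; to-from = λ v i → trans (⟦⟧-cong G.to (H.to-from _) i) (G.to-from v i)
  ; from-to = λ v i → trans (⟦⟧-cong H.from (G.from-to _) i) (H.from-to v i)
  }
  where
  module G = Iso G
  module H = Iso H

symᵢ : Iso n → Iso n
symᵢ G = record { to = from ; from = to ; to-from = from-to ; from-to = to-from }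
  where open Iso G

infixr 5 _◁_
_◁_ : ∀ {a} {A : Set a} → A → Vector A n → Vector A (suc n)
_◁_ = V._∷_

id⊕ : m ⇒ᶻ n → suc m ⇒ᶻ suc n
id⊕ f = linearMapᶻ (λ v → v zero ◁ ⟦ f ⟧ (tail v))
  (λ { e zero → e zero ; e (suc i) → ⟦⟧-cong f (e ∘ suc) i })
  (λ { v w zero → refl ; v w (suc i) → +ᴹ-homo f (tail v) (tail w) i })
  (λ { a v zero → refl ; a v (suc i) → *ₗ-homo f a (tail v) i })

id⊕ᵢ : Iso n → Iso (suc n)
id⊕ᵢ G = record
  { to      = id⊕ G.to
  ; from    = id⊕ G.from
  ; to-from = λ { v zero → refl ; v (suc i) → G.to-from (tail v) i }
  ; from-to = λ { v zero → refl ; v (suc i) → G.from-to (tail v) i }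
  }
  where module G = Iso G

2×2 : (a b c e : ℤ) → suc (suc n) ⇒ᶻ suc (suc n)
2×2 a b c e = linearMapᶻ
  (λ v → (a * v zero + b * v (suc zero)) ◁ (c * v zero + e * v (suc zero)) ◁ tail (tail v))
  (λ { p zero          → cong₂ _+_ (cong (a *_) (p zero)) (cong (b *_) (p (suc zero)))
     ; p (suc zero)    → cong₂ _+_ (cong (c *_) (p zero)) (cong (e *_) (p (suc zero)))
     ; p (suc (suc i)) → p (suc (suc i)) })
  (λ { v w zero          → additive a b (v zero) (w zero) (v (suc zero)) (w (suc zero))
     ; v w (suc zero)    → additive c e (v zero) (w zero) (v (suc zero)) (w (suc zero))
     ; v w (suc (suc i)) → refl })
  (λ { s v zero          → homogeneous a b s (v zero) (v (suc zero))
     ; s v (suc zero)    → homogeneous c e s (v zero) (v (suc zero))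
     ; s v (suc (suc i)) → refl })
  where
  additive : ∀ a b x x′ y y′ → a * (x + x′) + b * (y + y′) ≡ (a * x + b * y) + (a * x′ + b * y′)
  additive = solve-∀
  homogeneous : ∀ a b s x y → a * (s * x) + b * (s * y) ≡ s * (a * x + b * y)
  homogeneous = solve-∀

2×2ᵢ : ∀ a b c e → a * e - b * c ≡ 1ℤ → Iso (suc (suc n))
2×2ᵢ a b c e det = record
  { to      = 2×2 a b c e
  ; from    = 2×2 e (- b) (- c) a
  ; to-from = λ { v zero → use (lemma₁ a b c e (v zero) (v (suc zero)))
                ; v (suc zero) → use (lemma₂ a b c e (v zero) (v (suc zero)))
                ; v (suc (suc i)) → refl }
  ; from-to = λ { v zero → use (lemma₃ a b c e (v zero) (v (suc zero)))
                ; v (suc zero) → use (lemma₄ a b c e (v zero) (v (suc zero)))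
                ; v (suc (suc i)) → refl }
  }
  where
  use : ∀ {x y} → y ≡ (a * e - b * c) * x → y ≡ x
  use {x} p = trans p (trans (cong (_* x) det) (ℤ.*-identityˡ x))
  lemma₁ : ∀ a b c e x y → a * (e * x + - b * y) + b * (- c * x + a * y) ≡ (a * e - b * c) * x
  lemma₁ = solve-∀
  lemma₂ : ∀ a b c e x y → c * (e * x + - b * y) + e * (- c * x + a * y) ≡ (a * e - b * c) * y
  lemma₂ = solve-∀
  lemma₃ : ∀ a b c e x y → e * (a * x + b * y) + - b * (c * x + e * y) ≡ (a * e - b * c) * x
  lemma₃ = solve-∀
  lemma₄ : ∀ a b c e x y → - c * (a * x + b * y) + a * (c * x + e * y) ≡ (a * e - b * c) * y
  lemma₄ = solve-∀

-- The cofactors `p` and `q` are kept so that `u p + v q = 1` holds even if `a` and `b` vanish; it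
-- is the determinant of the matrix that carries `(a , b)` to `(g , 0)`.
record Bézout (a b : ℤ) : Set where
  field
    g p q u v : ℤ
    a≡   : a ≡ g * p
    b≡   : b ≡ g * q
    comb : u * p + v * q ≡ 1ℤ

bézout : ∀ a b → Bézout a b
bézout a b = go a b (<-wellFounded ℤ.∣ b ∣)
  where
  go : ∀ a b → Acc ℕ._<_ ℤ.∣ b ∣ → Bézout a b
  go a b (acc rec) with b ℤ.≟ 0ℤ
  ... | yes refl = record
    { g = a ; p = 1ℤ ; q = 0ℤ ; u = 1ℤ ; v = 0ℤ
    ; a≡ = sym (ℤ.*-identityʳ a) ; b≡ = sym (ℤ.*-zeroʳ a) ; comb = refl }
  ... | no b≢0 = record
    { g = B.g ; p = B.p * Q + B.q ; q = B.p ; u = B.v ; v = B.u - B.v * Q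
    ; a≡ = trans (ℤ.a≡a%n+[a/n]*n a b) (trans (cong₂ _+_ B.b≡ (cong (Q *_) B.a≡)) (eq₁ B.g B.p B.q Q))
    ; b≡ = B.a≡
    ; comb = trans (eq₂ B.p B.q B.u B.v Q) B.comb }
    where
    instance _ = ℤ.≢-nonZero b≢0
    Q = a / b
    module B = Bézout (go b (+ (a % b)) (rec (ℤ.n%d<d a b)))
    eq₁ : ∀ g p q Q → g * q + Q * (g * p) ≡ g * (p * Q + q)
    eq₁ = solve-∀
    eq₂ : ∀ p q u v Q → v * (p * Q + q) + (u - v * Q) * p ≡ u * p + v * q
    eq₂ = solve-∀

reduce-vector : (t : Vector ℤ (suc d)) → ∃₂ λ (G : Iso (suc d)) g → ⟦ Iso.to G ⟧ t ≗ g ◁ 0ᴹ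
reduce-vector {zero}  t = idᵢ , t zero , λ { zero → refl }
reduce-vector {suc d} t with G , g′ , e ← reduce-vector (tail t) =
  2×2ᵢ B.u B.v (- B.q) B.p (trans (det B.p B.q B.u B.v) B.comb) ∘ᵢ id⊕ᵢ G , B.g , eq
  where
  module B = Bézout (bézout (t zero) g′)
  det : ∀ p q u v → u * p - v * - q ≡ u * p + v * q
  det = solve-∀
  first : ∀ g p q u v → u * (g * p) + v * (g * q) ≡ g * (u * p + v * q)
  first = solve-∀
  second : ∀ g p q → - q * (g * p) + p * (g * q) ≡ 0ℤ
  second = solve-∀
  t₁ = ⟦ Iso.to G ⟧ (tail t) zero
  t₁≡ : t₁ ≡ B.g * B.q
  t₁≡ = trans (e zero) B.b≡
  eq : (B.u * t zero + B.v * t₁) ◁ (- B.q * t zero + B.p * t₁) ◁ tail (⟦ Iso.to G ⟧ (tail t)) ≗ B.g ◁ 0ᴹ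
  eq zero = trans (cong₂ _+_ (cong (B.u *_) B.a≡) (cong (B.v *_) t₁≡))
    (trans (first B.g B.p B.q B.u B.v) (trans (cong (B.g *_) B.comb) (ℤ.*-identityʳ B.g)))
  eq (suc zero) = trans (cong₂ _+_ (cong (- B.q *_) B.a≡) (cong (B.p *_) t₁≡)) (second B.g B.p B.q)
  eq (suc (suc i)) = e (suc i)

reduce-functional : (ℓ : Vector ℤ (suc d)) → ∃₂ λ (G : Iso (suc d)) g →
  ∀ v → ∑ (λ j → ⟦ Iso.to G ⟧ v j * ℓ j) ≡ g * v zero
reduce-functional {zero}  ℓ = idᵢ , ℓ zero , λ v → trans (ℤ.+-identityʳ _) (ℤ.*-comm (v zero) (ℓ zero))
reduce-functional {suc d} ℓ with G , g′ , e ← reduce-functional (tail ℓ) =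
  H , B.g , λ v →
    trans (cong₂ _+_ (cong (⟦ Iso.to H ⟧ v zero *_) B.a≡)
        (trans (e (tail (⟦ T ⟧ v))) (cong (_* ⟦ T ⟧ v (suc zero)) B.b≡)))
      (trans (first B.g B.p B.q B.u B.v (v zero) (v (suc zero)))
        (trans (cong (λ z → B.g * (z * v zero)) B.comb) (cong (B.g *_) (ℤ.*-identityˡ (v zero)))))
  where
  module B = Bézout (bézout (ℓ zero) g′)
  det : ∀ p q u v → u * p - - q * v ≡ u * p + v * q
  det = solve-∀
  H = id⊕ᵢ G ∘ᵢ 2×2ᵢ B.u (- B.q) B.v B.p (trans (det B.p B.q B.u B.v) B.comb)
  T = 2×2 B.u (- B.q) B.v B.p
  first : ∀ g p q u v x y →
    (u * x + - q * y) * (g * p) + g * q * (v * x + p * y) ≡ g * ((u * p + v * q) * x)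
  first = solve-∀

0◁ : m ⇒ᶻ suc m
0◁ = linearMapᶻ (0ℤ ◁_) (λ { e zero → refl ; e (suc i) → e i })
  (λ { v w zero → refl ; v w (suc i) → refl }) (λ { a v zero → sym (ℤ.*-zeroʳ a) ; a v (suc i) → refl })

private
  tailₗ : suc m ⇒ᶻ m
  tailₗ = linearMapᶻ tail (λ e → e ∘ suc) (λ _ _ _ → refl) (λ _ _ _ → refl)

  -- The column operations `G` turn the first row of `F` into `(g , 0 , … , 0)`, and `F′` is what
  -- remains after deleting the first row and the first column. The pivot `g` may vanish.
  record RowReduced (F : suc m ⇒ᶻ suc n) : Set where
    field
      G   : Iso (suc m)
      g   : ℤ
      row : ∀ v → ⟦ F ⟧ (⟦ Iso.to G ⟧ v) zero ≡ g * v zero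

    F′ : m ⇒ᶻ n
    F′ = tailₗ ∘ₗ F ∘ₗ Iso.to G ∘ₗ 0◁

    F-0◁ : ∀ {u} → ⟦ F′ ⟧ u ≗ 0ᴹ → ⟦ F ⟧ (⟦ Iso.to G ⟧ (0ℤ ◁ u)) ≗ 0ᴹ
    F-0◁ e zero    = trans (row _) (ℤ.*-zeroʳ g)
    F-0◁ e (suc i) = e i

  rowReduce : (F : suc m ⇒ᶻ suc n) → RowReduced F
  rowReduce F with G , g , e ← reduce-functional (λ j → ⟦ F ⟧ (basis ℤ-ring j) zero) =
    record { G = G ; g = g ; row = λ v → trans (⟦⟧-expand ℤ-ring F (⟦ Iso.to G ⟧ v) zero) (e v) }

-- Setting the pivot coordinate to zero disposes of one row, so with fewer rows than columns a
-- coordinate stays free. Primitivity survives because the column operations are invertible.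
primitive-relation : m ℕ.< k → (F : k ⇒ᶻ m) → ∃ λ α → Primitive α × ⟦ F ⟧ α ≗ 0ᴹ
primitive-relation {zero}  {suc k} _ F = (λ _ → 1ℤ) , (λ h h∣ → h∣ zero) , λ ()
primitive-relation {suc m} {suc k} (ℕ.s≤s m<k) F
  with α , prim , e ← primitive-relation m<k (RowReduced.F′ (rowReduce F)) =
    ⟦ Iso.to G ⟧ (0ℤ ◁ α) , Iso.to-Primitive G (λ h h∣ → prim h (h∣ ∘ suc)) , F-0◁ e
  where open RowReduced (rowReduce F)

record KernelBasis (F : m ⇒ᶻ n) (d : ℕ) : Set where
  field
    κ         : d ⇒ᶻ m
    sound     : ∀ u → ⟦ F ⟧ (⟦ κ ⟧ u) ≗ 0ᴹ
    complete  : ∀ {v} → ⟦ F ⟧ v ≗ 0ᴹ → ∃ λ u → v ≗ ⟦ κ ⟧ u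
    injective : ∀ {u} → ⟦ κ ⟧ u ≗ 0ᴹ → u ≗ 0ᴹ

-- Surjectivity makes every pivot a unit, so each row removes exactly one coordinate of the kernel
-- and the reduced map is surjective again.
kernelBasis : (F : m ⇒ᶻ n) → LinearMap.Surjective F → ∃ λ d → d ℕ.+ n ≡ m × KernelBasis F d
kernelBasis {m} {zero} F surj = m , ℕ.+-identityʳ m , record
  { κ = idₗ ; sound = λ _ () ; complete = λ {v} _ → v , λ _ → refl ; injective = id }
kernelBasis {zero} {suc n} F surj with v , e ← surj (λ _ → 1ℤ) =
  contradiction (trans (sym (e {0ᴹ} (λ ()) zero)) (0ᴹ-homo F zero)) λ ()
kernelBasis {suc m} {suc n} F surj = extend (kernelBasis F′ surj′)
  where
  open RowReduced (rowReduce F)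

  -- The pivot divides every value of the first coordinate of `F`, hence 1.
  g∣1 : g ∣ 1ℤ
  g∣1 with v , e ← surj (λ _ → 1ℤ) = divides (⟦ Iso.from G ⟧ v zero)
    (trans (sym (e (Iso.to-from G v) zero)) (trans (row _) (ℤ.*-comm g _)))

  g-cancel : ∀ {x} → g * x ≡ 0ℤ → x ≡ 0ℤ
  g-cancel {x} gx≡0 with divides q 1≡qg ← g∣1 =
    trans (sym (ℤ.*-identityˡ x)) (trans (cong (_* x) 1≡qg)
      (trans (ℤ.*-assoc q g x) (trans (cong (q *_) gx≡0) (ℤ.*-zeroʳ q))))

  ker₀ : ∀ {v} → ⟦ F ⟧ v zero ≡ 0ℤ → v ≗ ⟦ Iso.to G ⟧ (0ℤ ◁ tail (⟦ Iso.from G ⟧ v))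
  ker₀ {v} e i = trans (sym (Iso.to-from G v i)) (⟦⟧-cong (Iso.to G) shape i)
    where
    shape : ⟦ Iso.from G ⟧ v ≗ 0ℤ ◁ tail (⟦ Iso.from G ⟧ v)
    shape zero    = g-cancel (trans (sym (row _)) (trans (⟦⟧-cong F (Iso.to-from G v) zero) e))
    shape (suc i) = refl

  surj′ : LinearMap.Surjective F′
  surj′ y with v , e ← surj (0ℤ ◁ y) = tail (⟦ Iso.from G ⟧ v) , λ z≗ i →
    trans (⟦⟧-cong F′ z≗ i) (trans (sym (⟦⟧-cong F (ker₀ (e (λ _ → refl) zero)) (suc i)))
      (e (λ _ → refl) (suc i)))

  extend : (∃ λ d → d ℕ.+ n ≡ m × KernelBasis F′ d) → ∃ λ d → d ℕ.+ suc n ≡ suc m × KernelBasis F d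
  extend (d , eq , K) = d , trans (ℕ.+-suc d n) (cong suc eq) , record
    { κ         = Iso.to G ∘ₗ 0◁ ∘ₗ K.κ
    ; sound     = λ u → F-0◁ (K.sound u)
    ; complete  = complete
    ; injective = λ e → K.injective λ i →
        Iso.to-injective G {w = 0ᴹ} (λ l → trans (e l) (sym (0ᴹ-homo (Iso.to G) l))) (suc i)
    }
    where
    module K = KernelBasis K
    complete : ∀ {v} → ⟦ F ⟧ v ≗ 0ᴹ → ∃ λ u → v ≗ ⟦ Iso.to G ⟧ (0ℤ ◁ ⟦ K.κ ⟧ u)
    complete {v} e with u , e′ ← K.complete {tail (⟦ Iso.from G ⟧ v)}
      (λ i → trans (sym (⟦⟧-cong F (ker₀ (e zero)) (suc i))) (e (suc i))) =
      u , λ i → trans (ker₀ (e zero) i)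
        (⟦⟧-cong (Iso.to G) (λ { zero → refl ; (suc j) → e′ j }) i)

-- Unimodular lifting of `t` modulo `N`; the lift comes as the first column of an invertible matrix,
-- whose other columns complete it to a basis.
Liftable : Vector ℤ (suc d) → ℤ → Set
Liftable {d} t N = ∃₂ λ s (G : Iso (suc d)) → ⟦ Iso.to G ⟧ (1ℤ ◁ 0ᴹ) ≗ t +ᴹ N *ₗ s

-- After reduction to t = (g , 0 , …), the congruent vector (g , N , 0 , …) is primitive.
liftable : (t : Vector ℤ (suc (suc d))) (N : ℤ) → (∀ h → h ∣ N → h ∣ᵛ t → h ∣ 1ℤ) → Liftable t N
liftable {d} t N coprime with H , g , Ht≗ ← reduce-vector t = ⟦ from ⟧ e₁ , symᵢ H ∘ᵢ J , eq
  where
  open Iso H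
  module B = Bézout (bézout g N)
  e₁ : Vector ℤ (suc (suc d))
  e₁ = 0ℤ ◁ 1ℤ ◁ 0ᴹ

  γ∣1 : B.g ∣ 1ℤ
  γ∣1 = coprime B.g (divides B.q (trans B.b≡ (ℤ.*-comm B.g B.q)))
    (∣ᵛ-resp (from-to t) (⟦⟧-∣ᵛ from (∣ᵛ-resp (sym ∘ Ht≗)
      λ { zero    → divides B.p (trans B.a≡ (ℤ.*-comm B.g B.p))
        ; (suc _) → divides 0ℤ refl })))

  ε = _∣_.quotient γ∣1

  det : g * (ε * B.u) - - (ε * B.v) * N ≡ 1ℤ
  det = trans (cong₂ (λ x y → x * (ε * B.u) - - (ε * B.v) * y) B.a≡ B.b≡)
    (trans (expand B.g B.p B.q B.u B.v ε)
      (trans (cong₂ _*_ (sym (_∣_.equality γ∣1)) B.comb) refl))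
    where
    expand : ∀ γ p q u v ε → γ * p * (ε * u) - - (ε * v) * (γ * q) ≡ ε * γ * (u * p + v * q)
    expand = solve-∀

  J = 2×2ᵢ g (- (ε * B.v)) N (ε * B.u) det

  first-column : ⟦ Iso.to J ⟧ (1ℤ ◁ 0ᴹ) ≗ ⟦ to ⟧ t +ᴹ N *ₗ e₁
  first-column zero = trans (column g (- (ε * B.v)) N)
    (cong (_+ N * 0ℤ) (sym (Ht≗ zero)))
    where
    column : ∀ a b N → a * 1ℤ + b * 0ℤ ≡ a + N * 0ℤ
    column = solve-∀
  first-column (suc zero) = trans (column N (ε * B.u)) (cong (_+ N * 1ℤ) (sym (Ht≗ (suc zero))))
    where
    column : ∀ N b → N * 1ℤ + b * 0ℤ ≡ 0ℤ + N * 1ℤ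
    column = solve-∀
  first-column (suc (suc i)) = sym (trans (cong₂ _+_ (Ht≗ (suc (suc i))) (ℤ.*-zeroʳ N)) refl)

  eq : ⟦ from ⟧ (⟦ Iso.to J ⟧ (1ℤ ◁ 0ᴹ)) ≗ t +ᴹ N *ₗ ⟦ from ⟧ e₁
  eq i = trans (⟦⟧-cong from first-column i) (trans (+ᴹ-homo from _ _ i)
    (cong₂ _+_ (from-to t i) (*ₗ-homo from N e₁ i)))

scaleₗ : ℤ → n ⇒ᶻ n
scaleₗ c = linearMapᶻ (c *ₗ_) (λ e i → cong (c *_) (e i))
  (λ v w i → ℤ.*-distribˡ-+ c (v i) (w i)) (λ a v i → comm c a (v i))
  where
  comm : ∀ c a x → c * (a * x) ≡ a * (c * x)
  comm = solve-∀

-- In dimension one nothing can be adjoined, but every unit modulo 3 is ±1.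
liftable₁ : (t : Vector ℤ 1) (N : ℤ) → N ∣ + 3 → (∀ h → h ∣ N → h ∣ᵛ t → h ∣ 1ℤ) → Liftable t N
liftable₁ t N (divides q 3≡qN) coprime = byRemainder (t zero % + 3) (ℤ.n%d<d (t zero) (+ 3))
    (ℤ.a≡a%n+[a/n]*n (t zero) (+ 3))
  where
  Q = t zero / + 3

  signᵢ : ∀ c → c * c ≡ 1ℤ → Iso 1
  signᵢ c c²≡1 = record { to = scaleₗ c ; from = scaleₗ c ; to-from = inv ; from-to = inv }
    where
    inv : ∀ v → c *ₗ (c *ₗ v) ≗ v
    inv v i = trans (sym (ℤ.*-assoc c c (v i))) (trans (cong (_* v i) c²≡1) (ℤ.*-identityˡ (v i)))

  solution : ∀ c → c * c ≡ 1ℤ → ∀ s → c ≡ t zero + N * s → Liftable t N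
  solution c c²≡1 s e = (λ _ → s) , signᵢ c c²≡1 , λ { zero → trans (ℤ.*-identityʳ c) e }

  byRemainder : ∀ ρ → ρ ℕ.< 3 → t zero ≡ + ρ + Q * + 3 → Liftable t N
  -- Here `N` divides 3 and hence `t`, so `coprime` makes `N` a unit and every integer is congruent
  -- to 1.
  byRemainder 0 _ t≡ = solution 1ℤ refl (ε * (1ℤ - t zero))
    (trans (sym (zero-case (t zero))) (cong (λ z → t zero + z)
      (trans (cong (_* (1ℤ - t zero)) (_∣_.equality N∣1)) (assoc ε N (1ℤ - t zero)))))
    where
    N∣1 : N ∣ 1ℤ
    N∣1 = coprime N ℤ.∣-refl λ { zero → divides (Q * q)
      (trans t≡ (trans (ℤ.+-identityˡ (Q * + 3)) (trans (cong (Q *_) 3≡qN) (sym (ℤ.*-assoc Q q N))))) }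
    ε = _∣_.quotient N∣1
    zero-case : ∀ x → x + 1ℤ * (1ℤ - x) ≡ 1ℤ
    zero-case = solve-∀
    assoc : ∀ ε N x → ε * N * x ≡ N * (ε * x)
    assoc = solve-∀
  byRemainder 1 _ t≡ = solution 1ℤ refl (- (Q * q))
    (trans (one-case Q) (cong₂ _+_ (sym t≡) (trans (cong (λ z → - (Q * z)) 3≡qN) (assoc Q q N))))
    where
    one-case : ∀ Q → 1ℤ ≡ + 1 + Q * + 3 + - (Q * + 3)
    one-case = solve-∀
    assoc : ∀ Q q N → - (Q * (q * N)) ≡ N * - (Q * q)
    assoc = solve-∀
  byRemainder 2 _ t≡ = solution (- 1ℤ) refl (- ((Q + 1ℤ) * q))
    (trans (two-case Q) (cong₂ _+_ (sym t≡) (trans (cong (λ z → - ((Q + 1ℤ) * z)) 3≡qN) (assoc Q q N))))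
    where
    two-case : ∀ Q → - 1ℤ ≡ + 2 + Q * + 3 + - ((Q + 1ℤ) * + 3)
    two-case = solve-∀
    assoc : ∀ Q q N → - ((Q + 1ℤ) * (q * N)) ≡ N * - ((Q + 1ℤ) * q)
    assoc = solve-∀
  byRemainder (suc (suc (suc _))) (ℕ.s≤s (ℕ.s≤s (ℕ.s≤s ()))) _

-- Divisibility and reduction in the polynomial ring over the integers

module P = Polynomial
open P using (_≈_; mk≈; coeff-≡; ≈-refl; ≈-sym; ≈-trans)

-- Lets the ring solver discard coefficients equal to zero, trailing zeros included.
≈0? : ∀ f → Maybe ([] ≈ f)
≈0? []              = just ≈-refl
≈0? (+ zero ∷ f)    with ≈0? f
... | just e        = just (≈-trans (≈-sym P.0∷[]≈[]) (P.∷-cong refl e))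
... | nothing       = nothing
≈0? (_ ∷ _)         = nothing

ℤ[x]-almostCommutativeRing : ACR.AlmostCommutativeRing _ _
ℤ[x]-almostCommutativeRing = ACR.fromCommutativeRing ℤ[x]-commutativeRing ≈0?

open RawMagmaDefinitions (CommutativeRing.*-rawMagma ℤ[x]-commutativeRing) using (_,_)
  renaming (_∣ʳ_ to _∣ᴾ_)
open MonoidDivisibility (CommutativeRing.*-monoid ℤ[x]-commutativeRing)
  using () renaming (∣ʳ-refl to ∣ᴾ-refl; ∣ʳ-trans to ∣ᴾ-trans; ∣ʳ-respʳ-≈ to ∣ᴾ-respʳ; ∣ʳ-respˡ-≈ to ∣ᴾ-respˡ)

module ≈ᴾ-Reasoning = SetoidReasoning P.≈-setoid

*ᴾ-congˡ : ∀ f {g g′} → g ≈ g′ → f P.* g ≈ f P.* g′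
*ᴾ-congˡ f = P.*-cong {f} ≈-refl

const-* : ∀ c f → const c P.* f ≈ c P.· f
const-* c f = ≈-trans (P.+-congˡ {c P.· f} P.0∷[]≈[]) (P.+-identityʳ _)

∣ᴾ-+ : ∀ {a f g} → a ∣ᴾ f → a ∣ᴾ g → a ∣ᴾ (f P.+ g)
∣ᴾ-+ {a} (q , e) (q′ , e′) = (q P.+ q′) , ≈-trans (P.*-distribʳ a q q′) (P.+-cong e e′)

∣ᴾ-* : ∀ {a f} g → a ∣ᴾ f → a ∣ᴾ (g P.* f)
∣ᴾ-* {a} g (q , e) = (g P.* q) , ≈-trans (P.*-assoc g q a) (*ᴾ-congˡ g e)

x·_ : ℤ[x] → ℤ[x]
x· f = 0ℤ ∷ f

*-x· : ∀ f g → f P.* (x· g) ≈ x· (f P.* g)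
*-x· f g = ≈-trans (P.*-∷ʳ f 0ℤ g) (P.+-congʳ (P.·-zeroˡ f))

∣ᴾ-x· : ∀ f → f ∣ᴾ (x· f)
∣ᴾ-x· f = X , ≈-trans (P.0∷-* (1ℤ ∷ []) f) (P.∷-cong refl (P.*-identityˡ f))

x·-mono : ∀ {f g} → f ∣ᴾ g → (x· f) ∣ᴾ (x· g)
x·-mono {f} (q , e) = q , ≈-trans (*-x· q f) (P.∷-cong refl e)

tailᴾ : ℤ[x] → ℤ[x]
tailᴾ []      = []
tailᴾ (_ ∷ f) = f

head∷tail : ∀ f → f ≈ (coeff f 0 ∷ tailᴾ f)
head∷tail []      = ≈-sym P.0∷[]≈[]
head∷tail (_ ∷ f) = ≈-refl

coeff-tail : ∀ f i → coeff (tailᴾ f) i ≡ coeff f (suc i)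
coeff-tail []      i = refl
coeff-tail (_ ∷ f) i = refl

X∣ᴾ : ∀ f → coeff f 0 ≡ 0ℤ → X ∣ᴾ f
X∣ᴾ f e = tailᴾ f , ≈-trans (*-x· (tailᴾ f) P.1ᴾ) (≈-trans
  (P.∷-cong (sym e) (P.*-identityʳ (tailᴾ f))) (≈-sym (head∷tail f)))

coeff-*-0 : ∀ f g → coeff (f P.* g) 0 ≡ coeff f 0 * coeff g 0
coeff-*-0 []      g = sym (ℤ.*-zeroˡ (coeff g 0))
coeff-*-0 (a ∷ f) g = trans (P.coeff-+ (a P.· g) (0ℤ ∷ f P.* g) 0)
  (trans (ℤ.+-identityʳ _) (P.coeff-· a g 0))

∣ᴾ⇒coeff₀∣ : ∀ {a f} → a ∣ᴾ f → coeff a 0 ∣ coeff f 0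
∣ᴾ⇒coeff₀∣ {a} (q , e) = divides (coeff q 0) (trans (sym (coeff-≡ e 0)) (coeff-*-0 q a))

coeff-∷* : ∀ c u a i → coeff ((c ∷ u) P.* a) (suc i) ≡ c * coeff a (suc i) + coeff (u P.* a) i
coeff-∷* c u a i = trans (P.coeff-+ (c P.· a) (0ℤ ∷ u P.* a) (suc i))
  (cong (_+ coeff (u P.* a) i) (P.coeff-· c a (suc i)))

coeff-∣-* : ∀ {h} u a → (∀ i → h ∣ coeff u i) → ∀ i → h ∣ coeff (u P.* a) i
coeff-∣-* []      a h∣u i = divides 0ℤ refl
coeff-∣-* (c ∷ u) a h∣u zero    = subst (_ ∣_) (sym (coeff-*-0 (c ∷ u) a)) (ℤ.∣m⇒∣m*n (coeff a 0) (h∣u 0))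
coeff-∣-* (c ∷ u) a h∣u (suc i) = subst (_ ∣_) (sym (coeff-∷* c u a i))
  (ℤ.∣m∣n⇒∣m+n (ℤ.∣m⇒∣m*n (coeff a (suc i)) (h∣u 0)) (coeff-∣-* u a (h∣u ∘ suc) i))

-- For h = 0 this is the statement over ℤ, which gives cancellation of monic factors.
monic-multiple : ∀ {d a h} → MonicOfDegree d a → ∀ u →
  (∀ i → d ℕ.≤ i → h ∣ coeff (u P.* a) i) → ∀ i → h ∣ coeff u i
monic-multiple monic [] h∣ i = divides 0ℤ refl
monic-multiple {d} {a} {h} (lead , above) (c ∷ u) h∣ = λ { zero → h∣c d above lead h∣ ; (suc i) → h∣u i }
  where
  h∣u : ∀ i → h ∣ coeff u i
  h∣u = monic-multiple (lead , above) u λ i d≤i →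
    subst (h ∣_) (trans (coeff-∷* c u a i)
        (trans (cong (λ z → c * z + coeff (u P.* a) i) (above (suc i) (ℕ.s≤s d≤i)))
          (trans (cong (_+ coeff (u P.* a) i) (ℤ.*-zeroʳ c)) (ℤ.+-identityˡ _))))
      (h∣ (suc i) (ℕ.m≤n⇒m≤1+n d≤i))
  h∣c : ∀ d → (∀ i → d ℕ.< i → coeff a i ≡ 0ℤ) → coeff a d ≡ 1ℤ →
    (∀ i → d ℕ.≤ i → h ∣ coeff ((c ∷ u) P.* a) i) → h ∣ c
  h∣c zero _ lead h∣ = subst (h ∣_) (trans (coeff-*-0 (c ∷ u) a) (trans (cong (c *_) lead) (ℤ.*-identityʳ c)))
    (h∣ 0 ℕ.z≤n)
  h∣c (suc d) _ lead h∣ = subst (h ∣_) (ℤ.*-identityʳ c) (ℤ.∣m+n∣n⇒∣m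
    (subst (h ∣_) (trans (coeff-∷* c u a d) (cong (λ z → c * z + coeff (u P.* a) d) lead))
        (h∣ (suc d) ℕ.≤-refl))
    (coeff-∣-* u a h∣u d))

-- Membership of `f` in the ideal generated by `a` and `h`; the case `h = 0ℤ` gives the multiples of
-- `a`.
InIdeal : ℤ[x] → ℤ → ℤ[x] → Set
InIdeal a h f = ∃ λ u → ∀ i → h ∣ coeff f i - coeff (u P.* a) i

-- Modulo `h` the polynomial `f` equals `u * a`, whose coefficients from degree `d` on are therefore
-- divisible by `h`. By `monic-multiple` so is `u`, and then `f`.
reduced-mod : ∀ {d a h f} → MonicOfDegree d a → (∀ i → d ℕ.≤ i → coeff f i ≡ 0ℤ) → InIdeal a h f →
  ∀ i → h ∣ coeff f i
reduced-mod {d} {a} {h} {f} monic small (u , h∣) i =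
  subst (h ∣_) (restore (coeff f i) (coeff (u P.* a) i))
    (ℤ.∣m∣n⇒∣m+n (h∣ i) (coeff-∣-* u a (monic-multiple monic u λ j d≤j →
      subst (h ∣_) (cancel (coeff (u P.* a) j)) (ℤ.∣m⇒∣-m
        (subst (λ z → h ∣ z - coeff (u P.* a) j) (small j d≤j) (h∣ j)))) i))
  where
  restore : ∀ x y → x - y + y ≡ x
  restore = solve-∀
  cancel : ∀ y → - (0ℤ - y) ≡ y
  cancel = solve-∀

monic-tail : ∀ {e a} → MonicOfDegree (suc e) a → MonicOfDegree e (tailᴾ a)
monic-tail {e} {a} (lead , above) = trans (coeff-tail a e) lead ,
  λ i e<i → trans (coeff-tail a i) (above (suc i) (ℕ.s≤s e<i))

monic-x· : ∀ {a} → MonicNonconstant a → MonicNonconstant (x· a)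
monic-x· (d , 1≤d , lead , above) = suc d , ℕ.s≤s ℕ.z≤n , lead , λ { (suc i) (ℕ.s≤s d<i) → above i d<i }

monic-X : MonicNonconstant X
monic-X = 1 , ℕ.≤-refl , refl , λ { (suc (suc _)) _ → refl ; (suc zero) (ℕ.s≤s ()) }

-- Polynomials acting through an endomorphism

sumᴹ : Vector (Vector ℤ n) k → Vector ℤ n
sumᴹ {n} = Sum.sum (Zⁿ.+ᴹ-commutativeMonoid {n})

sumᴹ-cong : {v w : Vector (Vector ℤ n) k} → (∀ i → v i ≗ w i) → sumᴹ v ≗ sumᴹ w
sumᴹ-cong {n} = Sum.sum-cong-≋ (Zⁿ.+ᴹ-commutativeMonoid {n})

sumᴹ-+ : (v w : Vector (Vector ℤ n) k) → sumᴹ (λ i → v i +ᴹ w i) ≗ sumᴹ v +ᴹ sumᴹ w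
sumᴹ-+ {n} = Sum.∑-distrib-+ (Zⁿ.+ᴹ-commutativeMonoid {n})

sumᴹ-0 : {v : Vector (Vector ℤ n) k} → (∀ i → v i ≗ 0ᴹ) → sumᴹ v ≗ 0ᴹ
sumᴹ-0 {n} {k} e i = trans (sumᴹ-cong e i) (Sum.sum-replicate-zero (Zⁿ.+ᴹ-commutativeMonoid {n}) k i)

sumᴹ-*ₗ : (c : ℤ) (v : Vector (Vector ℤ n) k) → sumᴹ (λ i → c *ₗ v i) ≗ c *ₗ sumᴹ v
sumᴹ-*ₗ c v i = sym (⟦⟧-sum (scaleₗ c) v i)

∣ᵛ-+ : ∀ {h} {v w : Vector ℤ n} → h ∣ᵛ v → h ∣ᵛ w → h ∣ᵛ (v +ᴹ w)
∣ᵛ-+ h∣v h∣w i = ℤ.∣m∣n⇒∣m+n (h∣v i) (h∣w i)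

∣ᵛ-sum : ∀ {h} (v : Vector (Vector ℤ n) k) → (∀ i → h ∣ᵛ v i) → h ∣ᵛ sumᴹ v
∣ᵛ-sum {k = zero}  v h∣ i = divides 0ℤ refl
∣ᵛ-sum {k = suc k} v h∣ = ∣ᵛ-+ (h∣ zero) (∣ᵛ-sum (v ∘ suc) (h∣ ∘ suc))

module Action {n} (φ : n ⇒ᶻ n) where
  open PolynomialAction (ℤ^ n) φ public
    using (act; act-congˡ; act-congʳ; act-distribˡ; act-distribʳ; act-·; act-assoc; act-identityˡ; act-zeroʳ)

  act-*ₗ : ∀ f c v → act f (c *ₗ v) ≗ c *ₗ act f v
  act-*ₗ []      c v i = sym (ℤ.*-zeroʳ c)
  act-*ₗ (a ∷ f) c v i = trans
    (cong (λ z → a * (c * v i) + z) (trans (⟦⟧-cong φ (act-*ₗ f c v) i) (*ₗ-homo φ c (act f v) i)))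
    (eq a c (v i) (⟦ φ ⟧ (act f v) i))
    where
    eq : ∀ a c x y → a * (c * x) + c * y ≡ c * (a * x + y)
    eq = solve-∀

  act-kernel : ∀ f {v} → ⟦ φ ⟧ v ≗ 0ᴹ → act f v ≗ coeff f 0 *ₗ v
  act-kernel []      {v} e i = sym (ℤ.*-zeroˡ (v i))
  act-kernel (a ∷ f) {v} e i = trans (cong (λ z → a * v i + z)
    (trans (⟦⟧-cong φ (act-kernel f e) i) (trans (*ₗ-homo φ (coeff f 0) v i)
      (trans (cong (coeff f 0 *_) (e i)) (ℤ.*-zeroʳ (coeff f 0)))))) (ℤ.+-identityʳ _)

  act-const : ∀ c v → act (const c) v ≗ c *ₗ v
  act-const c v i = trans (cong (λ z → c * v i + z) (0ᴹ-homo φ i)) (ℤ.+-identityʳ _)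

  act-x· : ∀ f v → act (x· f) v ≗ ⟦ φ ⟧ (act f v)
  act-x· f v i = trans (cong (_+ ⟦ φ ⟧ (act f v) i) (ℤ.*-zeroˡ (v i))) (ℤ.+-identityˡ _)

  act-head-tail : ∀ f v → act f v ≗ coeff f 0 *ₗ v +ᴹ ⟦ φ ⟧ (act (tailᴾ f) v)
  act-head-tail f v = act-congˡ f (coeff f 0 ∷ tailᴾ f) (head∷tail f)

  act-∣ᴾ : ∀ {a f v} → a ∣ᴾ f → act a v ≗ 0ᴹ → act f v ≗ 0ᴹ
  act-∣ᴾ {a} {f} {v} (q , e) av≗0 i = trans (act-congˡ f (q P.* a) (≈-sym e) i)
    (trans (act-assoc q a v i) (trans (act-congʳ q av≗0 i) (act-zeroʳ q i)))

  comb : Vector ℤ[x] k → Vector (Vector ℤ n) k → Vector ℤ n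
  comb f g = sumᴹ λ i → act (f i) (g i)

  comb-+ : (f f′ : Vector ℤ[x] k) (g : Vector (Vector ℤ n) k) →
    comb (λ i → f i P.+ f′ i) g ≗ comb f g +ᴹ comb f′ g
  comb-+ f f′ g i = trans (sumᴹ-cong (λ j → act-distribʳ (g j) (f j) (f′ j)) i)
    (sumᴹ-+ (λ j → act (f j) (g j)) (λ j → act (f′ j) (g j)) i)

  comb-· : (c : ℤ) (f : Vector ℤ[x] k) (g : Vector (Vector ℤ n) k) →
    comb (λ i → c P.· f i) g ≗ c *ₗ comb f g
  comb-· c f g i = trans (sumᴹ-cong (λ j → act-· c (f j) (g j)) i) (sumᴹ-*ₗ c (λ j → act (f j) (g j)) i)

  single : Fin k → ℤ[x] → Vector ℤ[x] k
  single zero    f = f ◁ λ _ → []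
  single (suc i) f = [] ◁ single i f

  single-self : (i : Fin k) (f : ℤ[x]) → single i f i ≡ f
  single-self zero    f = refl
  single-self (suc i) f = single-self i f

  comb-single : (i : Fin k) (f : ℤ[x]) (g : Vector (Vector ℤ n) k) → comb (single i f) g ≗ act f (g i)
  comb-single zero    f g l = trans (cong (λ z → act f (g zero) l + z)
      (sumᴹ-0 {v = λ j → act [] (g (suc j))} (λ _ _ → refl) l)) (ℤ.+-identityʳ _)
  comb-single (suc i) f g l = trans (ℤ.+-identityˡ _) (comb-single i f (g ∘ suc) l)

act-intertwine : (T : m ⇒ᶻ n) (φ : m ⇒ᶻ m) (ψ : n ⇒ᶻ n) → (∀ v → ⟦ T ⟧ (⟦ φ ⟧ v) ≗ ⟦ ψ ⟧ (⟦ T ⟧ v)) →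
  ∀ f v → ⟦ T ⟧ (Action.act φ f v) ≗ Action.act ψ f (⟦ T ⟧ v)
act-intertwine T φ ψ comm []      v i = 0ᴹ-homo T i
act-intertwine T φ ψ comm (a ∷ f) v i = trans (+ᴹ-homo T _ _ i) (cong₂ _+_ (*ₗ-homo T a v i)
  (trans (comm _ i) (⟦⟧-cong ψ (act-intertwine T φ ψ comm f v) i)))

-- Rational canonical forms by generators and relations

-- Polynomial coefficients replace elements of cyclic submodules, because coefficients can be
-- transported unchanged along `D` and under a shift of `φ` by a scalar.
record Presentation {n} (φ : n ⇒ᶻ n) : Set where
  open Action φ
  field
    length    : ℕ
    g         : Vector (Vector ℤ n) length
    a         : Vector ℤ[x] length
    spans     : ∀ v → ∃ λ f → v ≗ comb f g
    relations : ∀ f → comb f g ≗ 0ᴹ → ∀ i → a i ∣ᴾ f i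
    kills     : ∀ i → act (a i) (g i) ≗ 0ᴹ
    monic     : ∀ i → MonicNonconstant (a i)
    chain     : ∀ i j → i Fin.≤ j → a i ∣ᴾ a j

  -- If the combination is `h` times `v`, write `v` with coefficients `f′`; then `f - h f′` is a
  -- relation.
  relations-mod : ∀ h f → h ∣ᵛ comb f g → ∀ i → InIdeal (a i) h (f i)
  relations-mod h f h∣ i = u , λ l → divides (coeff (f′ i) l)
    (trans (cong (λ z → coeff (f i) l - z) (trans (coeff-≡ e l)
        (trans (P.coeff-+ (f i) ((- h) P.· f′ i) l)
          (cong (λ z → coeff (f i) l + z) (P.coeff-· (- h) (f′ i) l)))))
      (difference (coeff (f i) l) h (coeff (f′ i) l)))
    where
    v  = proj₁ (∣ᵛ⇒≗ h∣)
    f′ = proj₁ (spans v)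
    cancel : ∀ h x → h * x + - h * x ≡ 0ℤ
    cancel = solve-∀
    difference : ∀ x h y → x - (x + - h * y) ≡ y * h
    difference = solve-∀
    a∣ : a i ∣ᴾ (f i P.+ (- h) P.· f′ i)
    a∣ = relations (λ j → f j P.+ (- h) P.· f′ j) (λ l →
      trans (comb-+ f (λ j → (- h) P.· f′ j) g l) (trans (cong₂ _+_ (proj₂ (∣ᵛ⇒≗ h∣) l)
        (trans (comb-· (- h) f′ g l) (cong (- h *_) (sym (proj₂ (spans v) l))))) (cancel h (v l)))) i
    u = _∣ᴾ_.quotient a∣
    e = _∣ᴾ_.equality a∣

module _ {n} {φ : n ⇒ᶻ n} where
  open Action φ

  -- Comparison with the zero decomposition splits a relation into its components, and the
  -- annihilators then give divisibility.
  RCF⇒Presentation : HasRationalCanonicalForm φ → Presentation φ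
  RCF⇒Presentation rcf = record
    { length    = F.k
    ; g         = F.generator
    ; a         = F.a
    ; spans     = λ v → let w , w∈ , v≗ = S.spans v in
        (λ i → proj₁ (w∈ i)) , λ l → trans (v≗ l) (sumᴹ-cong (λ i → proj₂ (w∈ i)) l)
    ; relations = λ f e i → Equivalence.to (F.annihilator i (f i))
        (annihilates {f i} (S.unique (λ j → act (f j) (F.generator j)) (λ _ → 0ᴹ)
          (λ j → f j , λ _ → refl) (λ j → [] , λ _ → refl)
          (λ l → trans (e l) (sym (sumᴹ-0 {k = F.k} (λ _ _ → refl) l))) i))
    ; kills     = λ i → Equivalence.from (F.annihilator i (F.a i)) ∣ᴾ-refl (F.generator i)
        (P.1ᴾ , λ l → sym (act-identityˡ (F.generator i) l))
    ; monic     = F.monic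
    ; chain     = F.chain
    }
    where
    module F = HasRationalCanonicalForm rcf
    module S = Submodules.IsDirectSum F.directSum
    annihilates : ∀ {f g} → act f g ≗ 0ᴹ → ∀ v → Submodules.⟨_⟩ (ℤ[x]-module (ℤ^ n) φ) g v → act f v ≗ 0ᴹ
    annihilates {f} {g} e v (h , v≗) i = trans (act-congʳ f v≗ i) (trans (sym (act-assoc f h g i))
      (act-∣ᴾ {f} {f P.* h} (h , P.*-comm h f) e i))

  Presentation⇒RCF : Presentation φ → HasRationalCanonicalForm φ
  Presentation⇒RCF pres = record
    { k           = length
    ; generator   = g
    ; a           = a
    ; directSum   = record
      { spans  = λ v → let f , v≗ = spans v in (λ i → act (f i) (g i)) , (λ i → f i , λ _ → refl) , v≗
      ; unique = unique
      }
    ; annihilator = λ i f → mk⇔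
        (λ ann → subst (a i ∣ᴾ_) (single-self i f) (relations (single i f)
          (λ l → trans (comb-single i f g l) (ann (g i) (P.1ᴾ , λ l → sym (act-identityˡ (g i) l)) l)) i))
        λ { a∣f v (h , v≗) l → trans (act-congʳ f v≗ l) (trans (sym (act-assoc f h (g i) l))
              (act-∣ᴾ (∣ᴾ-respʳ (P.*-comm h f) (∣ᴾ-* h a∣f)) (kills i) l)) }
    ; monic       = monic
    ; chain       = chain
    }
    where
    open Presentation pres
    unique : ∀ w w′ → (∀ i → ∃ λ f → w i ≗ act f (g i)) → (∀ i → ∃ λ f → w′ i ≗ act f (g i)) →
      sumᴹ w ≗ sumᴹ w′ → ∀ i → w i ≗ w′ i
    unique w w′ w∈ w′∈ e i l = trans (proj₂ (w∈ i) l) (trans (equal _ _ (trans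
        (sym (trans (act-distribʳ (g i) (f i) ((- 1ℤ) P.· f′ i) l)
          (cong (λ z → act (f i) (g i) l + z) (act-· (- 1ℤ) (f′ i) (g i) l))))
        (act-∣ᴾ (relations F F≗0 i) (kills i) l))) (sym (proj₂ (w′∈ i) l)))
      where
      f f′ F : Vector ℤ[x] length
      f  j = proj₁ (w∈ j)
      f′ j = proj₁ (w′∈ j)
      F j = f j P.+ (- 1ℤ) P.· f′ j
      equal : ∀ x y → x + - 1ℤ * y ≡ 0ℤ → x ≡ y
      equal x y e = trans (lemma x y) (trans (cong (_+ y) e) (ℤ.+-identityˡ y))
        where
        lemma : ∀ x y → x ≡ x + - 1ℤ * y + y
        lemma = solve-∀
      cancel : ∀ x → x + - 1ℤ * x ≡ 0ℤ
      cancel = solve-∀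
      F≗0 : comb F g ≗ 0ᴹ
      F≗0 l = trans (comb-+ f (λ j → (- 1ℤ) P.· f′ j) g l) (trans (cong₂ _+_
        (trans (sumᴹ-cong (λ j l → sym (proj₂ (w∈ j) l)) l) (e l))
        (trans (comb-· (- 1ℤ) f′ g l) (cong (- 1ℤ *_) (sumᴹ-cong (λ j l → sym (proj₂ (w′∈ j) l)) l))))
        (cancel (sumᴹ w′ l)))

_++ᵛ_ : ∀ {a} {A : Set a} → Vector A m → Vector A n → Vector A (m ℕ.+ n)
_++ᵛ_ {m = zero}  v w = w
_++ᵛ_ {m = suc m} v w = v zero ◁ (tail v ++ᵛ w)

++ᵛ-all : ∀ {a p} {A : Set a} {Q : A → Set p} (v : Vector A m) (w : Vector A n) →
  (∀ i → Q (v i)) → (∀ i → Q (w i)) → ∀ i → Q ((v ++ᵛ w) i)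
++ᵛ-all {m = zero}  v w Qv Qw = Qw
++ᵛ-all {m = suc m} v w Qv Qw zero    = Qv zero
++ᵛ-all {m = suc m} {Q = Q} v w Qv Qw (suc i) = ++ᵛ-all {Q = Q} (tail v) w (Qv ∘ suc) Qw i

++ᵛ-all₂ : ∀ {a b p} {A : Set a} {B : Set b} {Q : A → B → Set p}
  (v : Vector A m) (w : Vector A n) (v′ : Vector B m) (w′ : Vector B n) →
  (∀ i → Q (v i) (v′ i)) → (∀ i → Q (w i) (w′ i)) → ∀ i → Q ((v ++ᵛ w) i) ((v′ ++ᵛ w′) i)
++ᵛ-all₂ {m = zero}  v w v′ w′ Qv Qw = Qw
++ᵛ-all₂ {m = suc m} v w v′ w′ Qv Qw zero    = Qv zero
++ᵛ-all₂ {m = suc m} {Q = Q} v w v′ w′ Qv Qw (suc i) = ++ᵛ-all₂ {Q = Q} (tail v) w (tail v′) w′ (Qv ∘ suc) Qw i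

++ᵛ-mono : ∀ {a p} {A : Set a} (Q : A → A → Set p) (v : Vector A m) (w : Vector A n) →
  (∀ i j → Q (v i) (v j)) → (∀ i j → Q (v i) (w j)) → (∀ i j → i Fin.≤ j → Q (w i) (w j)) →
  ∀ i j → i Fin.≤ j → Q ((v ++ᵛ w) i) ((v ++ᵛ w) j)
++ᵛ-mono {m = zero}  Q v w vv vw ww = ww
++ᵛ-mono {m = suc m} Q v w vv vw ww zero    zero    _ = vv zero zero
++ᵛ-mono {m = suc m} Q v w vv vw ww zero    (suc j) _ =
  ++ᵛ-all {Q = Q (v zero)} (tail v) w (λ j → vv zero (suc j)) (vw zero) j
++ᵛ-mono {m = suc m} Q v w vv vw ww (suc i) (suc j) (ℕ.s≤s i≤j) =
  ++ᵛ-mono Q (tail v) w (λ i j → vv (suc i) (suc j)) (vw ∘ suc) ww i j i≤j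

module _ (φ : n ⇒ᶻ n) where
  open Action φ

  comb-++ : ∀ {l} (f : Vector ℤ[x] k) (f′ : Vector ℤ[x] l) (g : Vector (Vector ℤ n) k)
      (g′ : Vector (Vector ℤ n) l) →
    comb (f ++ᵛ f′) (g ++ᵛ g′) ≗ comb f g +ᴹ comb f′ g′
  comb-++ {k = zero}  f f′ g g′ i = sym (ℤ.+-identityˡ _)
  comb-++ {k = suc k} f f′ g g′ i = trans (cong (λ z → act (f zero) (g zero) i + z)
      (comb-++ (tail f) f′ (tail g) g′ i))
    (sym (ℤ.+-assoc (act (f zero) (g zero) i) _ _))

++ᵛ-split : ∀ {a} {A : Set a} m {n} (f : Vector A (m ℕ.+ n)) →
  ∃₂ λ (v : Vector A m) (w : Vector A n) → ∀ i → f i ≡ (v ++ᵛ w) i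
++ᵛ-split zero    f = (λ ()) , f , λ _ → refl
++ᵛ-split (suc m) f with v , w , e ← ++ᵛ-split m (tail f) =
  (f zero ◁ v) , w , λ { zero → refl ; (suc i) → e i }

⟦⟧-basis : (f : m ⇒ᶻ n) (t : Vector ℤ m) → ⟦ f ⟧ t ≗ sumᴹ (λ j → t j *ₗ ⟦ f ⟧ (basis ℤ-ring j))
⟦⟧-basis f t i = trans (⟦⟧-expand ℤ-ring f t i)
  (sym (sum-lookup ℤ-ring (λ j → t j *ₗ ⟦ f ⟧ (basis ℤ-ring j)) i))

private
  move : ∀ x y z → x + - 1ℤ * y ≡ z → x ≡ y + z
  move x y z e = trans (lemma x y) (cong (λ z → y + z) e)
    where
    lemma : ∀ x y → x ≡ y + (x + - 1ℤ * y)
    lemma = solve-∀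

  cancel-1 : ∀ x → x + - 1ℤ * x ≡ 0ℤ
  cancel-1 = solve-∀

-- What a `Presentation` passes on to its later generators. Spanning is lost on the way, so the
-- relations are recorded modulo every `h` beforehand.
record Family {n} (φ : n ⇒ᶻ n) {k} (g : Vector (Vector ℤ n) k) (a : Vector ℤ[x] k) : Set where
  open Action φ
  field
    relations-mod : ∀ h f → h ∣ᵛ comb f g → ∀ i → InIdeal (a i) h (f i)
    kills         : ∀ i → act (a i) (g i) ≗ 0ᴹ
    monic         : ∀ i → MonicNonconstant (a i)
    chain         : ∀ i j → i Fin.≤ j → a i ∣ᴾ a j

tail-Family : ∀ {φ : n ⇒ᶻ n} {g : Vector (Vector ℤ n) (suc k)} {a} → Family φ g a → Family φ (tail g) (tail a)
tail-Family F = record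
  { relations-mod = λ h f h∣ i → relations-mod h ([] ◁ f)
      (∣ᵛ-resp (λ l → sym (ℤ.+-identityˡ _)) h∣) (suc i)
  ; kills         = kills ∘ suc
  ; monic         = monic ∘ suc
  ; chain         = λ i j i≤j → chain (suc i) (suc j) (ℕ.s≤s i≤j)
  }
  where open Family F

family : ∀ {φ : n ⇒ᶻ n} (pres : Presentation φ) → Family φ (Presentation.g pres) (Presentation.a pres)
family pres = record { relations-mod = relations-mod ; kills = kills ; monic = monic ; chain = chain }
  where open Presentation pres

-- Lifting a canonical form from `D U` to `U D`

module Lift {m n d} (D : m ⇒ᶻ n) (U : n ⇒ᶻ m) (surj : LinearMap.Surjective D)
  (U-mod : ∀ h v → h ∣ᵛ ⟦ U ⟧ v → h ∣ᵛ v) (K : KernelBasis D d) where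

  θ : m ⇒ᶻ m
  θ = U ∘ₗ D

  ψ : n ⇒ᶻ n
  ψ = D ∘ₗ U

  private
    module K = KernelBasis K
    module θ = Action θ
    module ψ = Action ψ

  D-act : ∀ f v → ⟦ D ⟧ (θ.act f v) ≗ ψ.act f (⟦ D ⟧ v)
  D-act = act-intertwine D θ ψ (λ _ _ → refl)

  D-comb : (f : Vector ℤ[x] k) (w : Vector (Vector ℤ m) k) → ⟦ D ⟧ (θ.comb f w) ≗ ψ.comb f (λ i → ⟦ D ⟧ (w i))
  D-comb f w i = trans (⟦⟧-sum D (λ j → θ.act (f j) (w j)) i) (sumᴹ-cong (λ j → D-act (f j) (w j)) i)

  kernel-θ : ∀ {v} → ⟦ D ⟧ v ≗ 0ᴹ → ⟦ θ ⟧ v ≗ 0ᴹ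
  kernel-θ e i = trans (⟦⟧-cong U e i) (0ᴹ-homo U i)

  -- The lifts w of the generators g, together with a complement f of the span
  -- of the a(θ) w inside the kernel of D.
  record Lifted {k} (g : Vector (Vector ℤ n) k) (a : Vector ℤ[x] k) (ρ : ℕ) : Set where
    field
      w      : Vector (Vector ℤ m) k
      D-w    : ∀ i → ⟦ D ⟧ (w i) ≗ g i
      A      : Vector ℤ[x] k
      f      : ρ ⇒ᶻ m
      D-f    : ∀ t → ⟦ D ⟧ (⟦ f ⟧ t) ≗ 0ᴹ

    e : Vector (Vector ℤ m) k
    e i = θ.act (a i) (w i)

    span : Vector ℤ k → Vector ℤ m
    span β = sumᴹ λ i → β i *ₗ e i

    field
      spans  : ∀ {v} → ⟦ D ⟧ v ≗ 0ᴹ → ∃₂ λ β t → v ≗ span β +ᴹ ⟦ f ⟧ t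
      -- If `A i` is `x· a i`, the divisibility forces `β i = 0`; if `A i` is `a i`, it is no
      -- constraint, in accordance with `e i` being zero then.
      indep  : ∀ β t → span β +ᴹ ⟦ f ⟧ t ≗ 0ᴹ → t ≗ 0ᴹ × (∀ i → A i ∣ᴾ (β i P.· a i))
      kills  : ∀ i → θ.act (A i) (w i) ≗ 0ᴹ
      A∣x·a  : ∀ i → A i ∣ᴾ (x· a i)
      a∣A    : ∀ i → a i ∣ᴾ A i
      -- While a dimension is left, every index has taken exactly one and raised its annihilator to
      -- `x· a i`. Both the chain in `stepRoom` and the divisors `X` in `fromLifted` rest on this.
      room   : ∀ ρ′ → ρ ≡ suc ρ′ → ρ ℕ.+ k ≡ d × (∀ i → A i ≡ x· a i)
      monic  : ∀ i → MonicNonconstant (A i)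
      chain  : ∀ i j → i Fin.≤ j → A i ∣ᴾ A j

  initial : ∀ {g a} → Lifted {0} g a d
  initial = record
    { w = λ () ; D-w = λ () ; A = λ () ; f = K.κ ; D-f = K.sound
    ; spans = λ e → let t , v≗ = K.complete e in (λ ()) , t , λ i → trans (v≗ i) (sym (ℤ.+-identityˡ _))
    ; indep = λ β t e → K.injective (λ i → trans (sym (ℤ.+-identityˡ _)) (e i)) , λ ()
    ; kills = λ () ; A∣x·a = λ () ; a∣A = λ () ; room = λ _ _ → ℕ.+-identityʳ d , λ ()
    ; monic = λ () ; chain = λ ()
    }

  module Step {k} {g : Vector (Vector ℤ n) (suc k)} {a} (F : Family ψ g a) {ρ}
      (T : Lifted (tail g) (tail a) ρ) where
    private
      module F = Family F
      module T = Lifted T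

    a₀ = a zero
    N = coeff a₀ 0

    w₀ : Vector ℤ m
    w₀ = proj₁ (surj (g zero))

    D-w₀ : ⟦ D ⟧ w₀ ≗ g zero
    D-w₀ = proj₂ (surj (g zero)) (λ _ → refl)

    c : Vector ℤ m
    c = θ.act a₀ w₀

    D-e : ∀ {w} → ⟦ D ⟧ w ≗ g zero → ⟦ D ⟧ (θ.act a₀ w) ≗ 0ᴹ
    D-e {w} D-w i = trans (D-act a₀ w i) (trans (ψ.act-congʳ a₀ D-w i) (F.kills zero i))

    β : Vector ℤ k
    β = proj₁ (T.spans (D-e D-w₀))

    t : Vector ℤ ρ
    t = proj₁ (proj₂ (T.spans (D-e D-w₀)))

    c≗ : c ≗ T.span β +ᴹ ⟦ T.f ⟧ t
    c≗ = proj₂ (proj₂ (T.spans (D-e D-w₀)))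

    -- If h divides N and t, then θ of (q₀ w₀ - Σ βⱼ qⱼ wⱼ), with aⱼ = aⱼ(0) + x qⱼ,
    -- vanishes mod h; since U is injective mod h, q₀ lies in (a₀ , h), so h is a unit.
    coprime : ∀ h → h ∣ N → h ∣ᵛ t → h ∣ 1ℤ
    coprime h h∣N h∣t with suc e , _ , monic ← F.monic zero =
      subst (h ∣_) (proj₁ (monic-tail {e} {a₀} monic)) (reduced-mod {suc e} {a₀} {h} {tailᴾ a₀} monic
        (λ i e<i → proj₂ (monic-tail {e} {a₀} monic) i e<i)
        (F.relations-mod h q (U-mod h _ (∣ᵛ-resp θY h∣θY)) zero) e)
      where
      q : Vector ℤ[x] (suc k)
      q = tailᴾ a₀ ◁ λ j → (- β j) P.· tailᴾ (a (suc j))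

      Nⱼ : Vector ℤ k
      Nⱼ j = coeff (a (suc j)) 0

      h∣Nⱼ : ∀ j → h ∣ Nⱼ j
      h∣Nⱼ j = ℤ.∣-trans h∣N (∣ᴾ⇒coeff₀∣ (F.chain zero (suc j) ℕ.z≤n))

      tails : Vector (Vector ℤ m) k
      tails j = θ.act ((- β j) P.· tailᴾ (a (suc j))) (T.w j)

      W : Vector (Vector ℤ m) (suc k)
      W = w₀ ◁ T.w

      total : Vector ℤ m
      total = (⟦ T.f ⟧ t +ᴹ (- N) *ₗ w₀) +ᴹ sumᴹ (λ j → (β j * Nⱼ j) *ₗ T.w j)

      h∣θY : h ∣ᵛ total
      h∣θY = ∣ᵛ-+ (∣ᵛ-+ (⟦⟧-∣ᵛ T.f h∣t) (λ i → ℤ.∣m⇒∣m*n (w₀ i) (ℤ.∣m⇒∣-m h∣N)))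
        (∣ᵛ-sum _ λ j i → ℤ.∣m⇒∣m*n (T.w j i) (ℤ.∣n⇒∣m*n (β j) (h∣Nⱼ j)))

      θ-tail : ∀ f v i → ⟦ θ ⟧ (θ.act (tailᴾ f) v) i ≡ θ.act f v i + - coeff f 0 * v i
      θ-tail f v i = trans (lemma (coeff f 0) (v i) _) (cong (_+ - coeff f 0 * v i)
          (sym (θ.act-head-tail f v i)))
        where
        lemma : ∀ c x y → y ≡ c * x + y + - c * x
        lemma = solve-∀

      θ-tails : ∀ j i → ⟦ θ ⟧ (tails j) i + β j * T.e j i ≡ (β j * Nⱼ j) * T.w j i
      θ-tails j i = trans (cong (_+ β j * T.e j i)
          (trans (⟦⟧-cong θ (θ.act-· (- β j) (tailᴾ (a (suc j))) (T.w j)) i)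
            (trans (*ₗ-homo θ (- β j) _ i) (cong (- β j *_) (θ-tail (a (suc j)) (T.w j) i)))))
        (lemma (β j) (T.e j i) (Nⱼ j) (T.w j i))
        where
        lemma : ∀ b e n w → - b * (e + - n * w) + b * e ≡ (b * n) * w
        lemma = solve-∀

      θY′ : total ≗ ⟦ θ ⟧ (θ.comb q W)
      θY′ i = sym (trans (+ᴹ-homo θ (θ.act (tailᴾ a₀) w₀) (sumᴹ tails) i)
        (trans (cong₂ _+_ (trans (θ-tail a₀ w₀ i) (cong (_+ - N * w₀ i) (c≗ i))) (⟦⟧-sum θ tails i))
          (trans (regroup (T.span β i) (⟦ T.f ⟧ t i) (- N * w₀ i) (sumᴹ (λ j → ⟦ θ ⟧ (tails j)) i))
            (cong (λ z → (⟦ T.f ⟧ t i + - N * w₀ i) + z)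
              (trans (sym (sumᴹ-+ (λ j → ⟦ θ ⟧ (tails j)) (λ j → β j *ₗ T.e j) i))
                (sumᴹ-cong θ-tails i))))))
        where
        regroup : ∀ s f n x → (s + f + n) + x ≡ (f + n) + (x + s)
        regroup = solve-∀

      θY : total ≗ ⟦ U ⟧ (ψ.comb q g)
      θY i = trans (θY′ i) (⟦⟧-cong U (λ l → trans (D-comb q W l)
        (sumᴹ-cong {v = λ j → ψ.act (q j) (⟦ D ⟧ (W j))} {λ j → ψ.act (q j) (g j)}
          (λ { zero → ψ.act-congʳ (q zero) D-w₀ ; (suc j) → ψ.act-congʳ (q (suc j)) (T.D-w j) }) l)) i)

    act-a₀-+ : ∀ {u} → ⟦ D ⟧ u ≗ 0ᴹ → θ.act a₀ (w₀ +ᴹ u) ≗ c +ᴹ N *ₗ u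
    act-a₀-+ {u} Du≗0 i = trans (θ.act-distribˡ a₀ w₀ u i) (cong (λ z → c i + z)
        (θ.act-kernel a₀ (kernel-θ Du≗0) i))

    D-w₀+ : ∀ {u} → ⟦ D ⟧ u ≗ 0ᴹ → ⟦ D ⟧ (w₀ +ᴹ u) ≗ g zero
    D-w₀+ {u} Du≗0 i = trans (+ᴹ-homo D w₀ u i) (trans (cong₂ _+_ (D-w₀ i) (Du≗0 i)) (ℤ.+-identityʳ _))

  -- With `ρ = 0` the vector `t` is empty, so `coprime` at `h = N` makes `N` a unit, and the kernel
  -- vector `- N⁻¹ c` cancels `a₀(θ) w₀`. The annihilator therefore stays `a₀`.
  stepFull : ∀ {g : Vector (Vector ℤ n) (suc k)} {a} → Family ψ g a → Lifted (tail g) (tail a) 0 → Lifted g a 0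
  stepFull {k} {g} {a} F T = record
    { w = w₀′ ◁ T.w
    ; D-w = λ { zero → D-w₀+ Du≗0 ; (suc i) → T.D-w i }
    ; A = a₀ ◁ T.A
    ; f = T.f
    ; D-f = T.D-f
    ; spans = λ e → let γ , s , v≗ = T.spans e in (0ℤ ◁ γ) , s , λ i →
        trans (v≗ i) (cong (_+ ⟦ T.f ⟧ s i) (sym (trans (cong (_+ T.span γ i) (ℤ.*-zeroˡ (θ.act a₀ w₀′ i)))
            (ℤ.+-identityˡ (T.span γ i)))))
    ; indep = λ γ s e →
        let s≗0 , A∣ = T.indep (tail γ) s (λ i → trans (cong (_+ ⟦ T.f ⟧ s i)
              (sym (trans (cong (λ z → γ zero * z + T.span (tail γ) i) (e₀≗0 i))
                (trans (cong (_+ T.span (tail γ) i) (ℤ.*-zeroʳ (γ zero)))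
                    (ℤ.+-identityˡ (T.span (tail γ) i)))))) (e i))
        in s≗0 , λ { zero → const (γ zero) , const-* (γ zero) a₀ ; (suc i) → A∣ i }
    ; kills = λ { zero → e₀≗0 ; (suc i) → T.kills i }
    ; A∣x·a = λ { zero → ∣ᴾ-x· a₀ ; (suc i) → T.A∣x·a i }
    ; a∣A = λ { zero → ∣ᴾ-refl ; (suc i) → T.a∣A i }
    ; room = λ _ ()
    ; monic = λ { zero → F.monic zero ; (suc i) → T.monic i }
    ; chain = λ { zero zero _ → ∣ᴾ-refl
                ; zero (suc j) _ → ∣ᴾ-trans (F.chain zero (suc j) ℕ.z≤n) (T.a∣A j)
                ; (suc i) (suc j) (ℕ.s≤s i≤j) → T.chain i j i≤j }
    }
    where
    module F = Family F
    module T = Lifted T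
    open Step F T
    N∣1 : N ∣ 1ℤ
    N∣1 = coprime N ℤ.∣-refl λ ()
    ε = _∣_.quotient N∣1
    u : Vector ℤ m
    u = (- ε) *ₗ c
    Du≗0 : ⟦ D ⟧ u ≗ 0ᴹ
    Du≗0 i = trans (*ₗ-homo D (- ε) c i) (trans (cong (- ε *_) (D-e D-w₀ i)) (ℤ.*-zeroʳ (- ε)))
    w₀′ : Vector ℤ m
    w₀′ = w₀ +ᴹ u
    e₀≗0 : θ.act a₀ w₀′ ≗ 0ᴹ
    e₀≗0 i = trans (act-a₀-+ Du≗0 i) (trans (expand (c i) N ε)
        (trans (cong (λ z → c i - z * c i) (sym (_∣_.equality N∣1)))
      (vanish (c i))))
      where
      expand : ∀ c N ε → c + N * (- ε * c) ≡ c - ε * N * c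
      expand = solve-∀
      vanish : ∀ c → c - 1ℤ * c ≡ 0ℤ
      vanish = solve-∀

  -- Moving `w₀` by the kernel vector `f s` changes `t` into `t + N s`, the first column of `G`. Up
  -- to the old span, the new `a₀(θ) w₀` is then the first vector of the basis `f ∘ G`, and the
  -- others form the new complement.
  stepRoom : ∀ {ρ} {g : Vector (Vector ℤ n) (suc k)} {a} (F : Family ψ g a)
      (T : Lifted (tail g) (tail a) (suc ρ)) →
    Liftable (Step.t F T) (Step.N F T) → Lifted g a ρ
  stepRoom {k} {ρ} {g} {a} F T (s , G , G1≗) = record
    { w = w₀′ ◁ T.w
    ; D-w = λ { zero → D-w₀+ (T.D-f s) ; (suc i) → T.D-w i }
    ; A = (x· a₀) ◁ T.A
    ; f = T.f ∘ₗ Iso.to G ∘ₗ 0◁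
    ; D-f = λ u → T.D-f (⟦ Iso.to G ⟧ (0ℤ ◁ u))
    ; spans = spans
    ; indep = indep
    ; kills = λ { zero i → trans (θ.act-x· a₀ w₀′ i) (kernel-θ (D-e (D-w₀+ (T.D-f s))) i) ; (suc i)
        → T.kills i }
    ; A∣x·a = λ { zero → ∣ᴾ-refl ; (suc i) → T.A∣x·a i }
    ; a∣A = λ { zero → ∣ᴾ-x· a₀ ; (suc i) → T.a∣A i }
    ; room = λ _ _ → trans (ℕ.+-suc ρ k) (proj₁ (T.room ρ refl)) ,
        λ { zero → refl ; (suc i) → proj₂ (T.room ρ refl) i }
    ; monic = λ { zero → monic-x· (F.monic zero) ; (suc i) → T.monic i }
    ; chain = λ { zero zero _ → ∣ᴾ-refl
                ; zero (suc j) _ → subst ((x· a₀) ∣ᴾ_) (sym (proj₂ (T.room ρ refl) j))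
                    (x·-mono (F.chain zero (suc j) ℕ.z≤n))
                ; (suc i) (suc j) (ℕ.s≤s i≤j) → T.chain i j i≤j }
    }
    where
    module F = Family F
    module T = Lifted T
    open Step F T
    w₀′ e₀ : Vector ℤ m
    w₀′ = w₀ +ᴹ ⟦ T.f ⟧ s
    e₀ = θ.act a₀ w₀′

    fG : suc ρ ⇒ᶻ m
    fG = T.f ∘ₗ Iso.to G

    e₀≗ : e₀ ≗ T.span β +ᴹ ⟦ fG ⟧ (1ℤ ◁ 0ᴹ)
    e₀≗ i = trans (act-a₀-+ (T.D-f s) i) (trans (cong (_+ N * ⟦ T.f ⟧ s i) (c≗ i))
      (trans (ℤ.+-assoc (T.span β i) _ _) (cong (λ z → T.span β i + z)
        (sym (trans (⟦⟧-cong T.f G1≗ i) (trans (+ᴹ-homo T.f t (N *ₗ s) i)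
          (cong (λ z → ⟦ T.f ⟧ t i + z) (*ₗ-homo T.f N s i))))))))

    fG-split : ∀ σ i → ⟦ fG ⟧ σ i ≡ σ zero * ⟦ fG ⟧ (1ℤ ◁ 0ᴹ) i + ⟦ fG ⟧ (0ℤ ◁ tail σ) i
    fG-split σ i = trans (⟦⟧-cong fG shape i) (trans (+ᴹ-homo fG (σ zero *ₗ (1ℤ ◁ 0ᴹ)) (0ℤ ◁ tail σ) i)
      (cong (_+ ⟦ fG ⟧ (0ℤ ◁ tail σ) i) (*ₗ-homo fG (σ zero) (1ℤ ◁ 0ᴹ) i)))
      where
      shape : σ ≗ σ zero *ₗ (1ℤ ◁ 0ᴹ) +ᴹ (0ℤ ◁ tail σ)
      shape zero    = sym (trans (ℤ.+-identityʳ _) (ℤ.*-identityʳ (σ zero)))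
      shape (suc j) = sym (trans (cong (_+ σ (suc j)) (ℤ.*-zeroʳ (σ zero))) (ℤ.+-identityˡ _))

    span-shift : ∀ γ b i → T.span (λ j → γ j + b * β j) i ≡ T.span γ i + b * T.span β i
    span-shift γ b i = trans (sumᴹ-cong {w = λ j → (γ j *ₗ T.e j) +ᴹ b *ₗ (β j *ₗ T.e j)}
        (λ j l → distrib (γ j) b (β j) (T.e j l)) i)
      (trans (sumᴹ-+ (λ j → γ j *ₗ T.e j) (λ j → b *ₗ (β j *ₗ T.e j)) i)
        (cong (λ z → T.span γ i + z) (sumᴹ-*ₗ b (λ j → β j *ₗ T.e j) i)))
      where
      distrib : ∀ x b y e → (x + b * y) * e ≡ x * e + b * (y * e)
      distrib = solve-∀

    -- A unitriangular change of coordinates between the new family and the old one, as `e₀` is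
    -- `span β` plus the first vector of `fG`.
    convert : ∀ γ σ i → γ zero * e₀ i + T.span (tail γ) i + ⟦ fG ⟧ (0ℤ ◁ σ) i
      ≡ T.span (λ j → γ (suc j) + γ zero * β j) i + ⟦ fG ⟧ (γ zero ◁ σ) i
    convert γ σ i = trans (cong (λ z → γ zero * z + T.span (tail γ) i + ⟦ fG ⟧ (0ℤ ◁ σ) i) (e₀≗ i))
      (trans (regroup (γ zero) (T.span β i) (⟦ fG ⟧ (1ℤ ◁ 0ᴹ) i) (T.span (tail γ) i) (⟦ fG ⟧ (0ℤ ◁ σ) i))
        (cong₂ _+_ (sym (span-shift (tail γ) (γ zero) i)) (sym (fG-split (γ zero ◁ σ) i))))
      where
      regroup : ∀ g b x s y → g * (b + x) + s + y ≡ (s + g * b) + (g * x + y)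
      regroup = solve-∀

    spans : ∀ {v} → ⟦ D ⟧ v ≗ 0ᴹ → ∃₂ λ γ σ → v ≗ (sumᴹ λ i → γ i *ₗ θ.act (a i) ((w₀′ ◁ T.w) i)) +ᴹ ⟦ fG ⟧
        (0ℤ ◁ σ)
    spans e with γ , τ , v≗ ← T.spans e = (σ zero ◁ λ j → γ j - σ zero * β j) , tail σ , λ i →
      trans (v≗ i) (sym (trans (convert (σ zero ◁ λ j → γ j - σ zero * β j) (tail σ) i) (cong₂ _+_
        (sumᴹ-cong {w = λ j → γ j *ₗ T.e j} (λ j l → cong (_* T.e j l) (restore (γ j) (σ zero * β j))) i)
        (⟦⟧-cong T.f (λ l → trans (⟦⟧-cong (Iso.to G) (λ { zero → refl ; (suc _) → refl }) l)
            (Iso.to-from G τ l)) i))))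
      where
      σ = ⟦ Iso.from G ⟧ τ
      restore : ∀ x y → x - y + y ≡ x
      restore = solve-∀

    indep : ∀ γ σ → (sumᴹ λ i → γ i *ₗ θ.act (a i) ((w₀′ ◁ T.w) i)) +ᴹ ⟦ fG ⟧ (0ℤ ◁ σ) ≗ 0ᴹ →
      σ ≗ 0ᴹ × (∀ i → ((x· a₀) ◁ T.A) i ∣ᴾ (γ i P.· a i))
    indep γ σ e = σ≗0 ∘ suc , λ
      { zero    → [] , mk≈ λ i → sym (trans (P.coeff-· (γ zero) a₀ i)
          (trans (cong (_* coeff a₀ i) (σ≗0 zero)) (ℤ.*-zeroˡ (coeff a₀ i))))
      ; (suc j) → subst (λ z → T.A j ∣ᴾ (z P.· a (suc j))) (trans (cong (λ z → γ (suc j) + z * β j) (σ≗0 zero))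
          (trans (cong (λ z → γ (suc j) + z) (ℤ.*-zeroˡ (β j))) (ℤ.+-identityʳ (γ (suc j)))))
              (proj₂ shifted j) }
      where
      shifted = T.indep (λ j → γ (suc j) + γ zero * β j) (⟦ Iso.to G ⟧ (γ zero ◁ σ))
          (λ i → trans (sym (convert γ σ i)) (e i))
      σ≗0 : γ zero ◁ σ ≗ 0ᴹ
      σ≗0 = Iso.to-injective G (λ l → trans (proj₁ shifted l) (sym (0ᴹ-homo (Iso.to G) l)))

  -- The last free dimension is reached at the index `i` with `k ∸ i ≡ d`, since each later index
  -- has taken one. Only there does the lifting take place in dimension one, so `slack` concerns
  -- that index alone.
  lift : ∀ {k} {g : Vector (Vector ℤ n) k} {a} → Family ψ g a →
    (∀ i → k ∸ toℕ i ≡ d → coeff (a i) 0 ∣ + 3) → ∃ (Lifted g a)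
  lift {zero}  F slack = d , initial
  lift {suc k} F slack with lift (tail-Family F) (slack ∘ suc)
  ... | zero        , T = zero , stepFull F T
  ... | suc zero    , T = zero , stepRoom F T (liftable₁ _ _ (slack zero (proj₁ (Lifted.room T 0 refl)))
      (Step.coprime F T))
  ... | suc (suc ρ) , T = suc ρ , stepRoom F T (liftable _ _ (Step.coprime F T))

  -- For the relations, `D` shows that the coefficient of `w j` is some `u j * a j`. As `a j`
  -- carries `w j` into the kernel, only the constant term of `u j` acts there, and `indep` treats
  -- it; the rest of `u j` is a multiple of `x`, covered by `A∣x·a`. For spanning, a combination of
  -- lifts is corrected by a kernel vector.
  fromLifted : ∀ {ρ} (pres : Presentation ψ) → Lifted (Presentation.g pres) (Presentation.a pres) ρ
      → Presentation θ
  fromLifted {ρ} pres lifted = record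
    { length    = ρ ℕ.+ length
    ; g         = fⱼ ++ᵛ L.w
    ; a         = (λ _ → X) ++ᵛ L.A
    ; spans     = spans′
    ; relations = relations′
    ; kills     = ++ᵛ-all₂ {Q = λ f v → θ.act f v ≗ 0ᴹ} (λ _ → X) L.A fⱼ L.w
        (λ j i → trans (θ.act-kernel X (θ-fⱼ j) i) (ℤ.*-zeroˡ (fⱼ j i))) L.kills
    ; monic     = ++ᵛ-all {Q = MonicNonconstant} (λ _ → X) L.A (λ _ → monic-X) L.monic
    ; chain     = chain′
    }
    where
    open Presentation pres
    module L = Lifted lifted

    fⱼ : Vector (Vector ℤ m) ρ
    fⱼ j = ⟦ L.f ⟧ (basis ℤ-ring j)

    θ-fⱼ : ∀ j → ⟦ θ ⟧ (fⱼ j) ≗ 0ᴹ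
    θ-fⱼ j = kernel-θ (L.D-f (basis ℤ-ring j))

    comb-fⱼ : ∀ f → θ.comb f fⱼ ≗ ⟦ L.f ⟧ (λ j → coeff (f j) 0)
    comb-fⱼ f i = trans (sumᴹ-cong (λ j → θ.act-kernel (f j) (θ-fⱼ j)) i)
        (sym (⟦⟧-basis L.f (λ j → coeff (f j) 0) i))

    spans′ : ∀ v → ∃ λ f → v ≗ θ.comb f (fⱼ ++ᵛ L.w)
    spans′ v = ((λ j → const (t j)) ++ᵛ λ i → f i P.+ β i P.· a i) , λ i →
      trans (move _ _ _ (v′≗ i)) (trans (regroup (θ.comb f L.w i) (L.span β i) (⟦ L.f ⟧ t i)) (sym (trans
        (comb-++ θ (λ j → const (t j)) (λ i → f i P.+ β i P.· a i) fⱼ L.w i)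
        (cong₂ _+_ (comb-fⱼ (λ j → const (t j)) i) (trans (θ.comb-+ f (λ i → β i P.· a i) L.w i)
          (cong (λ z → θ.comb f L.w i + z) (sumᴹ-cong (λ j → θ.act-· (β j) (a j) (L.w j)) i)))))))
      where
      f = proj₁ (spans (⟦ D ⟧ v))
      v′ : Vector ℤ m
      v′ = v +ᴹ (- 1ℤ) *ₗ θ.comb f L.w
      Dv′≗0 : ⟦ D ⟧ v′ ≗ 0ᴹ
      Dv′≗0 i = trans (+ᴹ-homo D v ((- 1ℤ) *ₗ θ.comb f L.w) i) (trans (cong₂ _+_ (proj₂ (spans (⟦ D ⟧ v)) i)
        (trans (*ₗ-homo D (- 1ℤ) (θ.comb f L.w) i) (cong (- 1ℤ *_) (trans (D-comb f L.w i)
          (sumᴹ-cong (λ j → ψ.act-congʳ (f j) (L.D-w j)) i))))) (cancel-1 (ψ.comb f g i)))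
      β = proj₁ (L.spans Dv′≗0)
      t = proj₁ (proj₂ (L.spans Dv′≗0))
      v′≗ = proj₂ (proj₂ (L.spans Dv′≗0))
      regroup : ∀ x y z → x + (y + z) ≡ z + (x + y)
      regroup = solve-∀

    relations′ : ∀ f → θ.comb f (fⱼ ++ᵛ L.w) ≗ 0ᴹ → ∀ i → ((λ _ → X) ++ᵛ L.A) i ∣ᴾ f i
    relations′ f e with f₁ , f₂ , f≡ ← ++ᵛ-split ρ f = λ i → subst (((λ _ → X) ++ᵛ L.A) i ∣ᴾ_) (sym (f≡ i))
        (++ᵛ-all₂ {Q = _∣ᴾ_} (λ _ → X) L.A f₁ f₂ (λ j → X∣ᴾ (f₁ j) (proj₁ independent j)) A∣f₂ i)
      where
      e′ : ∀ i → ⟦ L.f ⟧ (λ j → coeff (f₁ j) 0) i + θ.comb f₂ L.w i ≡ 0ℤ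
      e′ i = trans (cong (_+ θ.comb f₂ L.w i) (sym (comb-fⱼ f₁ i))) (trans (sym (comb-++ θ f₁ f₂ fⱼ L.w i))
        (trans (sumᴹ-cong (λ j l → cong (λ z → θ.act z ((fⱼ ++ᵛ L.w) j) l) (sym (f≡ j))) i) (e i)))
      below : ψ.comb f₂ g ≗ 0ᴹ
      below i = trans (sumᴹ-cong (λ j l → ψ.act-congʳ (f₂ j) (λ l → sym (L.D-w j l)) l) i)
        (trans (sym (D-comb f₂ L.w i)) (trans (sym (trans (cong (_+ ⟦ D ⟧ (θ.comb f₂ L.w) i)
            (L.D-f (λ j → coeff (f₁ j) 0) i)) (ℤ.+-identityˡ _)))
          (trans (sym (+ᴹ-homo D (⟦ L.f ⟧ (λ j → coeff (f₁ j) 0)) (θ.comb f₂ L.w) i))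
              (trans (⟦⟧-cong D e′ i) (0ᴹ-homo D i)))))
      u : Vector ℤ[x] length
      u j = _∣ᴾ_.quotient (relations f₂ below j)
      u*a : ∀ j → u j P.* a j ≈ f₂ j
      u*a j = _∣ᴾ_.equality (relations f₂ below j)
      D-e : ∀ j → ⟦ D ⟧ (L.e j) ≗ 0ᴹ
      D-e j i = trans (D-act (a j) (L.w j) i) (trans (ψ.act-congʳ (a j) (L.D-w j) i) (kills j i))
      comb-f₂ : θ.comb f₂ L.w ≗ L.span (λ j → coeff (u j) 0)
      comb-f₂ = sumᴹ-cong λ j i → trans (θ.act-congˡ (f₂ j) (u j P.* a j) (≈-sym (u*a j)) i)
        (trans (θ.act-assoc (u j) (a j) (L.w j) i) (θ.act-kernel (u j) (kernel-θ (D-e j)) i))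
      independent = L.indep (λ j → coeff (u j) 0) (λ j → coeff (f₁ j) 0) λ i →
        trans (ℤ.+-comm (L.span (λ j → coeff (u j) 0) i) _) (trans
            (cong (λ z → ⟦ L.f ⟧ (λ j → coeff (f₁ j) 0) i + z) (sym (comb-f₂ i))) (e′ i))
      A∣f₂ : ∀ j → L.A j ∣ᴾ f₂ j
      A∣f₂ j = ∣ᴾ-respʳ (≈-trans (P.*-congʳ {coeff (u j) 0 ∷ tailᴾ (u j)} (≈-sym (head∷tail (u j))) (a j))
          (u*a j))
        (∣ᴾ-+ (proj₂ independent j) (∣ᴾ-respʳ (*-x· (tailᴾ (u j)) (a j)) (∣ᴾ-* (tailᴾ (u j)) (L.A∣x·a j))))

    chain′ : ∀ i j → i Fin.≤ j → ((λ _ → X) ++ᵛ L.A) i ∣ᴾ ((λ _ → X) ++ᵛ L.A) j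
    chain′ = ++ᵛ-mono _∣ᴾ_ (λ _ → X) L.A (λ _ _ → ∣ᴾ-refl) (λ i j → X∣A i j) L.chain
      where
      -- An element of `Fin ρ` shows that a dimension is left, so `room` makes every `A j` a
      -- multiple of `x`.
      X∣A : Fin ρ → ∀ j → X ∣ᴾ L.A j
      X∣A i j = subst (X ∣ᴾ_) (sym (proj₂ (L.room _ (proj₂ (nonempty i))) j)) (X∣ᴾ (x· a j) refl)
        where
        nonempty : ∀ {ρ} → Fin ρ → ∃ λ ρ′ → ρ ≡ suc ρ′
        nonempty {suc ρ} _ = ρ , refl

  lift-Presentation : (pres : Presentation ψ) → let open Presentation pres in
    (∀ i → length ∸ toℕ i ≡ d → coeff (a i) 0 ∣ + 3) → Presentation θ
  lift-Presentation pres slack = fromLifted pres (proj₂ (lift (family pres) slack))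

X-* : ∀ f → X P.* f ≈ x· f
X-* f = ≈-trans (P.0∷-* P.1ᴾ f) (P.∷-cong refl (P.*-identityˡ f))

const+x· : ∀ c f → const c P.+ x· f ≈ c ∷ f
const+x· c f = P.∷-cong (ℤ.+-identityʳ c) ≈-refl

-- Composition of polynomials

comp : ℤ[x] → ℤ[x] → ℤ[x]
comp t []      = []
comp t (a ∷ f) = const a P.+ t P.* comp t f

module _ (t : ℤ[x]) where
  open ≈ᴾ-Reasoning

  comp-≈0 : ∀ f → f ≈ [] → comp t f ≈ []
  comp-≈0 []      e = ≈-refl
  comp-≈0 (a ∷ f) e = begin
    const a P.+ t P.* comp t f ≈⟨ P.+-cong (P.∷-cong (coeff-≡ e 0) ≈-refl)
                                    (*ᴾ-congˡ t (comp-≈0 f (P.∷≈[]⇒tail≈[] e))) ⟩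
    const 0ℤ P.+ t P.* []      ≈⟨ P.+-cong P.0∷[]≈[] (P.*-zeroʳ t) ⟩
    []                         ∎

  comp-cong : ∀ f g → f ≈ g → comp t f ≈ comp t g
  comp-cong []      g       e = ≈-sym (comp-≈0 g (≈-sym e))
  comp-cong (a ∷ f) []      e = comp-≈0 (a ∷ f) e
  comp-cong (a ∷ f) (b ∷ g) e =
    P.+-cong (P.∷-cong (P.head-≡ e) ≈-refl) (*ᴾ-congˡ t (comp-cong f g (P.tail-≈ e)))

  comp-+ : ∀ f g → comp t (f P.+ g) ≈ comp t f P.+ comp t g
  comp-+ []      g       = ≈-refl
  comp-+ (a ∷ f) []      = ≈-sym (P.+-identityʳ _)
  comp-+ (a ∷ f) (b ∷ g) = begin
    (const a P.+ const b) P.+ t P.* comp t (f P.+ g)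
      ≈⟨ P.+-congˡ {const a P.+ const b} (*ᴾ-congˡ t (comp-+ f g)) ⟩
    (const a P.+ const b) P.+ t P.* (comp t f P.+ comp t g)
      ≈⟨ expand (const a) (const b) t (comp t f) (comp t g) ⟩
    (const a P.+ t P.* comp t f) P.+ (const b P.+ t P.* comp t g) ∎
    where
    expand : ∀ a b t f g → (a P.+ b) P.+ t P.* (f P.+ g) ≈ (a P.+ t P.* f) P.+ (b P.+ t P.* g)
    expand = solve-∀-in ℤ[x]-almostCommutativeRing

  comp-· : ∀ c f → comp t (c P.· f) ≈ const c P.* comp t f
  comp-· c []      = ≈-sym P.0∷[]≈[]
  comp-· c (a ∷ f) = begin
    const (c * a) P.+ t P.* comp t (c P.· f)
      ≈⟨ P.+-cong (≈-sym (const-* c (const a))) (*ᴾ-congˡ t (comp-· c f)) ⟩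
    const c P.* const a P.+ t P.* (const c P.* comp t f)
      ≈⟨ expand (const c) (const a) t (comp t f) ⟩
    const c P.* (const a P.+ t P.* comp t f) ∎
    where
    expand : ∀ c a t f → c P.* a P.+ t P.* (c P.* f) ≈ c P.* (a P.+ t P.* f)
    expand = solve-∀-in ℤ[x]-almostCommutativeRing

  comp-* : ∀ f g → comp t (f P.* g) ≈ comp t f P.* comp t g
  comp-* []      g = ≈-refl
  comp-* (a ∷ f) g = begin
    comp t (a P.· g P.+ (0ℤ ∷ f P.* g))
      ≈⟨ comp-+ (a P.· g) (0ℤ ∷ f P.* g) ⟩
    comp t (a P.· g) P.+ (const 0ℤ P.+ t P.* comp t (f P.* g))
      ≈⟨ P.+-cong (comp-· a g) (P.+-cong P.0∷[]≈[] (*ᴾ-congˡ t (comp-* f g))) ⟩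
    const a P.* comp t g P.+ t P.* (comp t f P.* comp t g)
      ≈⟨ expand (const a) t (comp t f) (comp t g) ⟩
    (const a P.+ t P.* comp t f) P.* comp t g ∎
    where
    expand : ∀ a t f g → a P.* g P.+ t P.* (f P.* g) ≈ (a P.+ t P.* f) P.* g
    expand = solve-∀-in ℤ[x]-almostCommutativeRing

  comp-const : ∀ c → comp t (const c) ≈ const c
  comp-const c = ≈-trans (P.+-congˡ {const c} (P.*-zeroʳ t)) ≈-refl

  comp-∣ᴾ : ∀ {f g} → f ∣ᴾ g → comp t f ∣ᴾ comp t g
  comp-∣ᴾ {f} {g} (q , e) = comp t q , ≈-trans (≈-sym (comp-* q f)) (comp-cong (q P.* f) g e)

  comp-inverse : ∀ s → comp t s ≈ X → ∀ f → comp t (comp s f) ≈ f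
  comp-inverse s e []      = ≈-refl
  comp-inverse s e (a ∷ f) = begin
    comp t (const a P.+ s P.* comp s f)
      ≈⟨ comp-+ (const a) (s P.* comp s f) ⟩
    comp t (const a) P.+ comp t (s P.* comp s f)
      ≈⟨ P.+-cong (comp-const a) (≈-trans (comp-* s (comp s f)) (P.*-cong e (comp-inverse s e f))) ⟩
    const a P.+ X P.* f
      ≈⟨ P.+-congˡ {const a} (X-* f) ⟩
    const a P.+ x· f
      ≈⟨ const+x· a f ⟩
    a ∷ f ∎

-- Linear polynomials

X-[_] : ℤ → ℤ[x]
X-[ c ] = - c ∷ 1ℤ ∷ []

monic-X- : ∀ c → MonicOfDegree 1 X-[ c ]
monic-X- c = refl , λ { (suc (suc _)) _ → refl ; (suc zero) (ℕ.s≤s ()) }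

coeff-X-* : ∀ c f i → coeff (X-[ c ] P.* f) (suc i) ≡ - c * coeff f (suc i) + coeff f i
coeff-X-* c f i = trans (coeff-∷* (- c) (1ℤ ∷ []) f i)
  (cong (λ z → - c * coeff f (suc i) + z) (coeff-≡ (P.*-identityˡ f) i))

comp-X-inverse : ∀ c → comp X-[ c ] X-[ - c ] ≈ X
comp-X-inverse c = mk≈ λ
  { zero → constant c ; (suc zero) → linear c ; (suc (suc zero)) → refl ; (suc (suc (suc _))) → refl }
  where
  constant : ∀ c → - - c + (- c * (1ℤ + 0ℤ) + 0ℤ) ≡ 0ℤ
  constant = solve-∀
  linear : ∀ c → - c * 0ℤ + (1ℤ + 0ℤ) ≡ 1ℤ
  linear = solve-∀

comp-X-leading : ∀ c f d → (∀ i → d ℕ.< i → coeff f i ≡ 0ℤ) →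
  coeff (comp X-[ c ] f) d ≡ coeff f d × (∀ i → d ℕ.< i → coeff (comp X-[ c ] f) i ≡ 0ℤ)
comp-X-leading c []      d above = refl , λ _ _ → refl
comp-X-leading c (a ∷ f) zero above = coeff-≡ const-a 0 , λ { (suc i) _ → coeff-≡ const-a (suc i) }
  where
  const-a : comp X-[ c ] (a ∷ f) ≈ const a
  const-a = ≈-trans (P.+-congˡ {const a} (≈-trans
    (*ᴾ-congˡ X-[ c ] (comp-≈0 X-[ c ] f (mk≈ λ i → above (suc i) (ℕ.s≤s ℕ.z≤n)))) (P.*-zeroʳ X-[ c ]))) ≈-refl
comp-X-leading c (a ∷ f) (suc d) above with lead , vanish ← comp-X-leading c f d
    (λ i d<i → above (suc i) (ℕ.s≤s d<i)) =
  trans (step d) (trans (drop d (vanish (suc d) ℕ.≤-refl)) lead) ,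
  λ { (suc i) (ℕ.s≤s d<i) → trans (step i) (trans (drop i (vanish (suc i) (ℕ.m≤n⇒m≤1+n d<i))) (vanish i d<i)) }
  where
  g = comp X-[ c ] f
  step : ∀ i → coeff (const a P.+ X-[ c ] P.* g) (suc i) ≡ - c * coeff g (suc i) + coeff g i
  step i = trans (P.coeff-+ (const a) (X-[ c ] P.* g) (suc i)) (trans (ℤ.+-identityˡ _) (coeff-X-* c g i))
  drop : ∀ i → coeff g (suc i) ≡ 0ℤ → - c * coeff g (suc i) + coeff g i ≡ coeff g i
  drop i e = trans (cong (λ z → - c * z + coeff g i) e) (trans (cong (_+ coeff g i) (ℤ.*-zeroʳ (- c)))
      (ℤ.+-identityˡ _))

comp-X-monic : ∀ c {f} → MonicNonconstant f → MonicNonconstant (comp X-[ c ] f)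
comp-X-monic c {f} (d , 1≤d , lead , above) =
  d , 1≤d , trans (proj₁ (comp-X-leading c f d above)) lead , proj₂ (comp-X-leading c f d above)

act-X- : ∀ (φ : n ⇒ᶻ n) c v → Action.act φ X-[ c ] v ≗ ⟦ φ ⟧ v +ᴹ (- c) *ₗ v
act-X- φ c v i = trans (cong (λ z → - c * v i + z) (⟦⟧-cong φ (λ l → trans
  (cong₂ _+_ (ℤ.*-identityˡ (v l)) (0ᴹ-homo φ l)) (ℤ.+-identityʳ (v l))) i)) (ℤ.+-comm (- c * v i) (⟦ φ ⟧ v i))

module _ {n} (φ θ : n ⇒ᶻ n) (c : ℤ) (φ≗ : ∀ v → ⟦ φ ⟧ v ≗ ⟦ θ ⟧ v +ᴹ c *ₗ v) where
  private
    module φ = Action φ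
    module θ = Action θ

  -- As `θ` is `φ - c`, evaluation at `θ` is the substitution of `x - c` followed by evaluation at
  -- `φ`.
  act-shift : ∀ f v → θ.act f v ≗ φ.act (comp X-[ c ] f) v
  act-shift []      v i = refl
  act-shift (a ∷ f) v i = sym (trans (φ.act-distribʳ v (const a) (X-[ c ] P.* g) i)
    (cong₂ _+_ (φ.act-const a v i) (trans (φ.act-assoc X-[ c ] g v i) (trans (act-X- φ c (φ.act g v) i)
      (trans (cong (_+ - c * φ.act g v i) (φ≗ (φ.act g v) i)) (trans
          (cancel (⟦ θ ⟧ (φ.act g v) i) c (φ.act g v i))
        (⟦⟧-cong θ (λ l → sym (act-shift f v l)) i)))))))
    where
    g = comp X-[ c ] f
    cancel : ∀ x c y → x + c * y + - c * y ≡ x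
    cancel = solve-∀

shift-Presentation : (φ θ : n ⇒ᶻ n) (c : ℤ) → (∀ v → ⟦ φ ⟧ v ≗ ⟦ θ ⟧ v +ᴹ c *ₗ v) → Presentation θ
    → Presentation φ
shift-Presentation φ θ c φ≗ pres = record
  { length    = length
  ; g         = g
  ; a         = λ i → comp X-[ c ] (a i)
  ; spans     = λ v → let f , v≗ = spans v in (λ i → comp X-[ c ] (f i)) , λ l →
      trans (v≗ l) (sumᴹ-cong (λ i → act-shift φ θ c φ≗ (f i) (g i)) l)
  ; relations = λ f e i → ∣ᴾ-respʳ (comp-inverse X-[ c ] X-[ - c ] (comp-X-inverse c) (f i))
      (comp-∣ᴾ X-[ c ] (relations (λ i → comp X-[ - c ] (f i)) (λ l →
        trans (sumᴹ-cong (λ i l → sym (act-shift θ φ (- c) θ≗ (f i) (g i) l)) l) (e l)) i))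
  ; kills     = λ i l → trans (sym (act-shift φ θ c φ≗ (a i) (g i) l)) (kills i l)
  ; monic     = λ i → comp-X-monic c {a i} (monic i)
  ; chain     = λ i j i≤j → comp-∣ᴾ X-[ c ] (chain i j i≤j)
  }
  where
  open Presentation pres
  θ≗ : ∀ v → ⟦ θ ⟧ v ≗ ⟦ φ ⟧ v +ᴹ (- c) *ₗ v
  θ≗ v i = trans (lemma (⟦ θ ⟧ v i) c (v i)) (cong (_+ - c * v i) (sym (φ≗ v i)))
    where
    lemma : ∀ x c y → x ≡ x + c * y + - c * y
    lemma = solve-∀

X-remainder : ∀ c f → ∃₂ λ q ρ → f ≈ q P.* X-[ c ] P.+ const ρ
X-remainder c []      = [] , 0ℤ , ≈-sym P.0∷[]≈[]
X-remainder c (a ∷ f) with q , ρ , e ← X-remainder c f = (ρ ∷ q) , a + c * ρ ,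
  P.∷-cong (constant ρ c a) (≈-trans e (≈-trans (P.+-comm (q P.* X-[ c ]) (const ρ))
    (≈-trans (P.+-congʳ {g = q P.* X-[ c ]} (P.∷-cong (sym (ℤ.*-identityʳ ρ)) ≈-refl))
        (≈-sym (P.+-identityʳ _)))))
  where
  constant : ∀ ρ c a → a ≡ ρ * - c + 0ℤ + (a + c * ρ)
  constant = solve-∀

X-cancel : ∀ c f → (∀ i → 1 ℕ.≤ i → coeff (f P.* X-[ c ]) i ≡ 0ℤ) → f ≈ []
X-cancel c f e = mk≈ λ i → ℤ.0∣⇒≡0 (monic-multiple {a = X-[ c ]} (monic-X- c) f
  (λ j 1≤j → ℤ.∣-reflexive (sym (e j 1≤j))) i)

-- The linear polynomial is prime: modulo it `u * a ≈ X-[ c ] * Q` becomes `ρu * ρa = 0` for the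
-- remainders, and `ρa` is nonzero. So `X-[ c ]` divides `u` and can be cancelled.
∣ᴾ-cancel-X- : ∀ c {a Q} → ¬ X-[ c ] ∣ᴾ a → a ∣ᴾ (X-[ c ] P.* Q) → a ∣ᴾ Q
∣ᴾ-cancel-X- c {a} {Q} ∤a (u , ua≈) with X-remainder c a | X-remainder c u
... | a′ , ρa , a≈ | u′ , ρu , u≈ = u′ , ≈-trans (≈-sym (P.+-identityʳ _))
    (≈-trans (P.+-congˡ {u′ P.* a} (≈-sym H≈0)) (restore u′ a Q))
  where
  open ≈ᴾ-Reasoning
  ℓ = X-[ c ]
  G = (Q P.+ P.- (u′ P.* a)) P.+ P.- (const ρu P.* a′)
  H = Q P.+ P.- (u′ P.* a)

  restore : ∀ u a Q → u P.* a P.+ (Q P.+ P.- (u P.* a)) ≈ Q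
  restore = solve-∀-in ℤ[x]-almostCommutativeRing

  Gℓ : G P.* ℓ ≈ const (ρu * ρa)
  Gℓ = begin
    G P.* ℓ
      ≈⟨ rearrange Q u′ a (const ρu) a′ ℓ ⟩
    ℓ P.* Q P.+ P.- ((u′ P.* ℓ) P.* a) P.+ P.- (const ρu P.* (a′ P.* ℓ))
      ≈⟨ P.+-congʳ {g = P.- (const ρu P.* (a′ P.* ℓ))} (P.+-congʳ {g = P.- ((u′ P.* ℓ) P.* a)}
           (≈-trans (≈-sym ua≈) (P.*-congʳ u≈ a))) ⟩
    (u′ P.* ℓ P.+ const ρu) P.* a P.+ P.- ((u′ P.* ℓ) P.* a) P.+ P.- (const ρu P.* (a′ P.* ℓ))
      ≈⟨ simplify (u′ P.* ℓ) (const ρu) a (a′ P.* ℓ) ⟩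
    const ρu P.* a P.+ P.- (const ρu P.* (a′ P.* ℓ))
      ≈⟨ P.+-congʳ {g = P.- (const ρu P.* (a′ P.* ℓ))} (*ᴾ-congˡ (const ρu) a≈) ⟩
    const ρu P.* (a′ P.* ℓ P.+ const ρa) P.+ P.- (const ρu P.* (a′ P.* ℓ))
      ≈⟨ collapse (const ρu) (a′ P.* ℓ) (const ρa) ⟩
    const ρu P.* const ρa
      ≈⟨ const-* ρu (const ρa) ⟩
    const (ρu * ρa) ∎
    where
    rearrange : ∀ Q u a p b ℓ → ((Q P.+ P.- (u P.* a)) P.+ P.- (p P.* b)) P.* ℓ
      ≈ ℓ P.* Q P.+ P.- ((u P.* ℓ) P.* a) P.+ P.- (p P.* (b P.* ℓ))
    rearrange = solve-∀-in ℤ[x]-almostCommutativeRing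
    simplify : ∀ x p a y → (x P.+ p) P.* a P.+ P.- (x P.* a) P.+ P.- (p P.* y) ≈ p P.* a P.+ P.- (p P.* y)
    simplify = solve-∀-in ℤ[x]-almostCommutativeRing
    collapse : ∀ p y q → p P.* (y P.+ q) P.+ P.- (p P.* y) ≈ p P.* q
    collapse = solve-∀-in ℤ[x]-almostCommutativeRing

  ρuρa≡0 : ρu * ρa ≡ 0ℤ
  ρuρa≡0 = trans (sym (coeff-≡ Gℓ 0)) (coeff-≡ (P.f≈[]⇒f*g≈[]
    (X-cancel c G λ { (suc i) _ → coeff-≡ Gℓ (suc i) }) ℓ) 0)

  ρa≢0 : ¬ ρa ≡ 0ℤ
  ρa≢0 refl = ∤a (a′ , ≈-sym (≈-trans a≈ (≈-trans (P.+-congˡ {a′ P.* ℓ} P.0∷[]≈[]) (P.+-identityʳ _))))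

  ρu≡0 : ρu ≡ 0ℤ
  ρu≡0 = [ id , (λ e → contradiction e ρa≢0) ]′ (ℤ.i*j≡0⇒i≡0∨j≡0 ρu ρuρa≡0)

  Hℓ : H P.* ℓ ≈ []
  Hℓ = begin
    H P.* ℓ
      ≈⟨ rearrange Q u′ a ℓ ⟩
    ℓ P.* Q P.+ P.- ((u′ P.* ℓ) P.* a)
      ≈⟨ P.+-congʳ {g = P.- ((u′ P.* ℓ) P.* a)} (≈-trans (≈-sym ua≈) (P.*-congʳ u≈ a)) ⟩
    (u′ P.* ℓ P.+ const ρu) P.* a P.+ P.- ((u′ P.* ℓ) P.* a)
      ≈⟨ simplify (u′ P.* ℓ) (const ρu) a ⟩
    const ρu P.* a
      ≈⟨ P.f≈[]⇒f*g≈[] (≈-trans (P.∷-cong ρu≡0 ≈-refl) P.0∷[]≈[]) a ⟩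
    [] ∎
    where
    rearrange : ∀ Q u a ℓ → (Q P.+ P.- (u P.* a)) P.* ℓ ≈ ℓ P.* Q P.+ P.- ((u P.* ℓ) P.* a)
    rearrange = solve-∀-in ℤ[x]-almostCommutativeRing
    simplify : ∀ x p a → (x P.+ p) P.* a P.+ P.- (x P.* a) ≈ p P.* a
    simplify = solve-∀-in ℤ[x]-almostCommutativeRing

  H≈0 : H ≈ []
  H≈0 = X-cancel c H λ i _ → coeff-≡ Hℓ i

-- Roots and constant terms of the annihilators

-- For `c = 1` and `J = n + 1` the roots are r, 2r, ..., (n + 1) r, and the product annihilates
-- `DU n` by `linearProduct-kills`.
linearProduct : ℕ → ℕ → ℕ → ℤ[x]
linearProduct r c zero    = P.1ᴾ
linearProduct r c (suc J) = X-[ + (c ℕ.* r) ] P.* linearProduct r (suc c) J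

weightProduct : (ℕ → ℤ) → ℕ → ℕ → ℤ
weightProduct w c zero    = 1ℤ
weightProduct w c (suc J) = w c * weightProduct w (suc c) J

-- A factor that does not divide `a` cancels by primality, and including its weight only weakens the
-- conclusion. A factor that may divide `a` is moved into `Q`, where it multiplies the constant term
-- by its weight up to sign.
coeff₀-∣-weights : ∀ r (w : ℕ → ℤ) {a} J c Q →
  (∀ c′ → c ℕ.≤ c′ → c′ ℕ.< c ℕ.+ J → ¬ X-[ + (c′ ℕ.* r) ] ∣ᴾ a ⊎ w c′ ≡ + (c′ ℕ.* r)) →
  a ∣ᴾ (Q P.* linearProduct r c J) → coeff a 0 ∣ coeff Q 0 * weightProduct w c J
coeff₀-∣-weights r w {a} zero c Q roots a∣ =
  subst (coeff a 0 ∣_) (coeff-*-0 Q P.1ᴾ) (∣ᴾ⇒coeff₀∣ a∣)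
coeff₀-∣-weights r w {a} (suc J) c Q roots a∣ with roots c ℕ.≤-refl (ℕ.m<m+n c (ℕ.s≤s ℕ.z≤n))
... | inj₁ ∤a = subst (coeff a 0 ∣_) (commute (w c) (coeff Q 0) _) (ℤ.∣n⇒∣m*n (w c)
    (coeff₀-∣-weights r w J (suc c) Q roots′ (∣ᴾ-cancel-X- (+ (c ℕ.* r)) ∤a
        (∣ᴾ-respʳ (exchange Q X-[ + (c ℕ.* r) ] (linearProduct r (suc c) J)) a∣))))
  where
  roots′ = λ c′ c<c′ c′<c+J → roots c′ (ℕ.<⇒≤ c<c′) (subst (c′ ℕ.<_) (sym (ℕ.+-suc c J)) c′<c+J)
  exchange : ∀ Q ℓ L → Q P.* (ℓ P.* L) ≈ ℓ P.* (Q P.* L)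
  exchange = solve-∀-in ℤ[x]-almostCommutativeRing
  commute : ∀ w q W → w * (q * W) ≡ q * (w * W)
  commute = solve-∀
... | inj₂ w≡ = subst (coeff a 0 ∣_) (trans (cong (λ z → - (z * weightProduct w (suc c) J))
    (coeff-*-0 Q X-[ + (c ℕ.* r) ]))
    (trans (commute (coeff Q 0) (+ (c ℕ.* r)) _) (cong (λ z → coeff Q 0 * (z * weightProduct w (suc c) J))
        (sym w≡))))
    (ℤ.∣m⇒∣-m (coeff₀-∣-weights r w J (suc c) (Q P.* X-[ + (c ℕ.* r) ]) roots′
      (∣ᴾ-respʳ (≈-sym (P.*-assoc Q X-[ + (c ℕ.* r) ] (linearProduct r (suc c) J))) a∣)))
  where
  roots′ = λ c′ c<c′ c′<c+J → roots c′ (ℕ.<⇒≤ c<c′) (subst (c′ ℕ.<_) (sym (ℕ.+-suc c J)) c′<c+J)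
  commute : ∀ q c W → - (q * - c * W) ≡ q * (c * W)
  commute = solve-∀

-- Counting

indicator : ∀ {p} {Q : Set p} → Dec Q → ℤ
indicator Q? = if does Q? then 1ℤ else 0ℤ

indicator-* : ∀ {p q} {Q : Set p} {Q′ : Set q} (Q? : Dec Q) (Q′? : Dec Q′) →
  indicator Q? * indicator Q′? ≡ indicator (Q? ×-dec Q′?)
indicator-* Q? Q′? with does Q? | does Q′?
... | true  | true  = refl
... | true  | false = refl
... | false | true  = refl
... | false | false = refl

count : ∀ {q} {Q : Fin n → Set q} → (∀ i → Dec (Q i)) → ℕ
count {zero}  Q? = 0
count {suc n} Q? = if does (Q? zero) then suc (count (Q? ∘ suc)) else count (Q? ∘ suc)

∑-indicator : ∀ {q} {Q : Fin n → Set q} (Q? : ∀ i → Dec (Q i)) → ∑ (indicator ∘ Q?) ≡ + count Q?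
∑-indicator {zero}  Q? = refl
∑-indicator {suc n} Q? with does (Q? zero)
... | true  = cong (λ z → 1ℤ + z) (∑-indicator (Q? ∘ suc))
... | false = trans (ℤ.+-identityˡ _) (∑-indicator (Q? ∘ suc))

record Enumeration {q} (Q : Fin n → Set q) (k : ℕ) : Set q where
  field
    elem      : Fin k → Fin n
    sound     : ∀ l → Q (elem l)
    injective : ∀ {l l′} → elem l ≡ elem l′ → l ≡ l′
    complete  : ∀ {i} → Q i → ∃ λ l → i ≡ elem l

enumerate : ∀ {q} {Q : Fin n → Set q} (Q? : ∀ i → Dec (Q i)) → Enumeration Q (count Q?)
enumerate {zero}  Q? = record { elem = λ () ; sound = λ () ; injective = λ {} ; complete = λ {} }
enumerate {suc n} Q? with enumerate (Q? ∘ suc) | Q? zero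
... | E | yes Q₀ = record
  { elem      = λ { zero → zero ; (suc l) → suc (E.elem l) }
  ; sound     = λ { zero → Q₀ ; (suc l) → E.sound l }
  ; injective = λ { {zero} {zero} _ → refl ; {suc l} {suc l′} e → cong suc (E.injective (Fin.suc-injective e)) }
  ; complete  = λ { {zero} _ → zero , refl ; {suc i} Qi → let l , e = E.complete Qi in suc l , cong suc e }
  }
  where module E = Enumeration E
... | E | no ¬Q₀ = record
  { elem      = suc ∘ E.elem
  ; sound     = E.sound
  ; injective = E.injective ∘ Fin.suc-injective
  ; complete  = λ { {zero} Q₀ → contradiction Q₀ ¬Q₀ ; {suc i} Qi
      → let l , e = E.complete Qi in l , cong suc e }
  }
  where module E = Enumeration E

module Cardinalities {s ℓ} (S : Setoid s ℓ) where
  open Setoid S using (Carrier) renaming (_≈_ to _≋_; sym to ≋-sym; trans to ≋-trans; reflexive to ≋-reflexive)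
  open Cardinality S

  HasCard-≤ : ∀ {q q′ k l} {Q : Pred Carrier q} {Q′ : Pred Carrier q′} →
    (∀ {x} → Q x → Q′ x) → Q HasCard k → Q′ HasCard l → k ℕ.≤ l
  HasCard-≤ {k = k} {l} Q⇒Q′ A B = Fin.injective⇒≤ {f = f} f-injective
    where
    module A = _HasCard_ A
    module B = _HasCard_ B
    f : Fin k → Fin l
    f i = proj₁ (B.complete (Q⇒Q′ (A.sound i)))
    f-≋ : ∀ i → A.elem i ≋ B.elem (f i)
    f-≋ i = proj₂ (B.complete (Q⇒Q′ (A.sound i)))
    f-injective : ∀ {i j} → f i ≡ f j → i ≡ j
    f-injective {i} {j} e = A.distinct (≋-trans (f-≋ i)
      (≋-trans (≋-reflexive (cong B.elem e)) (≋-sym (f-≋ j))))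

  HasCard-unique : ∀ {q q′ k l} {Q : Pred Carrier q} {Q′ : Pred Carrier q′} →
    (∀ {x} → Q x → Q′ x) → (∀ {x} → Q′ x → Q x) → Q HasCard k → Q′ HasCard l → k ≡ l
  HasCard-unique to from A B = ℕ.≤-antisym (HasCard-≤ to A B) (HasCard-≤ from B A)

  HasCard-map : ∀ {q q′ k} {Q : Pred Carrier q} {Q′ : Pred Carrier q′} →
    (∀ {x} → Q x → Q′ x) → (∀ {x} → Q′ x → Q x) → Q HasCard k → Q′ HasCard k
  HasCard-map to from A = record
    { elem = A.elem ; sound = to ∘ A.sound ; distinct = A.distinct ; complete = A.complete ∘ from }
    where module A = _HasCard_ A

  HasCard-filter : ∀ {q t k} {T : Pred Carrier t} {Q : Pred Carrier q} (A : T HasCard k) →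
    (∀ {x} → Q x → T x) → (∀ {x y} → x ≋ y → Q x → Q y) →
    (Q? : ∀ i → Dec (Q (_HasCard_.elem A i))) → Q HasCard count Q?
  HasCard-filter A Q⇒T Q-resp Q? = record
    { elem     = A.elem ∘ E.elem
    ; sound    = E.sound
    ; distinct = E.injective ∘ A.distinct
    ; complete = λ Qx → let i , x≋ = A.complete (Q⇒T Qx)
                            l , e  = E.complete (Q-resp x≋ Qx)
                        in l , ≋-trans x≋ (≋-reflexive (cong A.elem e))
    }
    where
    module A = _HasCard_ A
    module E = Enumeration (enumerate Q?)

-- Commutation of the up and down maps

module DifferentialPosetProperties {r c ℓ₁ ℓ₂} (𝒫 : DifferentialPoset r c ℓ₁ ℓ₂) where
  open DifferentialPoset 𝒫 hiding (refl; trans) renaming (_≈_ to _≋_)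
  open UpDown 𝒫
  open Cardinalities (DifferentialPoset.Eq.setoid 𝒫)
  open PosetProperties poset using (<-respˡ-≈; <-respʳ-≈)

  ⋖-respʳ : ∀ {x y z} → y ≋ z → x ⋖ y → x ⋖ z
  ⋖-respʳ y≋z (x<y , none) = <-respʳ-≈ y≋z x<y , λ w (x<w , w<z) → none w (x<w , <-respʳ-≈ (Eq.sym y≋z) w<z)

  ⋖-respˡ : ∀ {x y z} → y ≋ z → y ⋖ x → z ⋖ x
  ⋖-respˡ y≋z (y<x , none) = <-respˡ-≈ y≋z y<x , λ w (z<w , w<x) → none w (<-respˡ-≈ (Eq.sym y≋z) z<w , w<x)

  private
    module Rank n = _HasCard_ (proj₂ (finiteRanks n))

  covers? : ∀ n (x y : Carrier) j → Dec (x ⋖ P[ suc n ] j × y ⋖ P[ suc n ] j)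
  covers? n x y j = (x ⋖? P[ suc n ] j) ×-dec (y ⋖? P[ suc n ] j)

  cocovers? : ∀ n (x y : Carrier) i → Dec (P[ n ] i ⋖ x × P[ n ] i ⋖ y)
  cocovers? n x y i = (P[ n ] i ⋖? x) ×-dec (P[ n ] i ⋖? y)

  -- Common covers all have rank `n + 1`, so filtering that rank finds them; the counts that occur
  -- as matrix entries thus become cardinalities to which `D2` and `D3` apply.
  covers-card : ∀ n {x y} → rank x ≡ n → (λ z → x ⋖ z × y ⋖ z) HasCard count (covers? n x y)
  covers-card n {x} {y} rank-x = HasCard-filter (proj₂ (finiteRanks (suc n)))
    (λ (x⋖z , _) → trans (rank-⋖ x⋖z) (cong suc rank-x))
    (λ e (x⋖ , y⋖) → ⋖-respʳ e x⋖ , ⋖-respʳ e y⋖)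
    (covers? n x y)

  cocovers-card : ∀ n {x y} → rank x ≡ suc n → (λ z → z ⋖ x × z ⋖ y) HasCard count (cocovers? n x y)
  cocovers-card n {x} {y} rank-x = HasCard-filter (proj₂ (finiteRanks n))
    (λ (z⋖x , _) → ℕ.suc-injective (trans (sym (rank-⋖ z⋖x)) rank-x))
    (λ e (⋖x , ⋖y) → ⋖-respˡ e ⋖x , ⋖-respˡ e ⋖y)
    (cocovers? n x y)

  bottom-card : ∀ {x y} → rank x ≡ 0 → (λ z → z ⋖ x × z ⋖ y) HasCard 0
  bottom-card {x} rank-x = record
    { elem = λ () ; sound = λ () ; distinct = λ {} ; complete = λ (z⋖x , _) → contradiction
        (trans (sym (rank-⋖ z⋖x)) rank-x) λ () }

  covers-distinct : ∀ n k {i i′} → ¬ i ≡ i′ → (λ z → z ⋖ P[ n ] i × z ⋖ P[ n ] i′) HasCard k →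
    count (covers? n (P[ n ] i) (P[ n ] i′)) ≡ k
  covers-distinct n k {i} {i′} i≢i′ card = HasCard-unique id id
    (covers-card n (Rank.sound n i)) (D2 k (i≢i′ ∘ Rank.distinct n) card)

  covers-equal : ∀ n k {i} → (λ z → z ⋖ P[ n ] i × z ⋖ P[ n ] i) HasCard k →
    count (covers? n (P[ n ] i) (P[ n ] i)) ≡ k ℕ.+ r
  covers-equal n k {i} card = HasCard-unique proj₁ (λ x → x , x)
    (covers-card n (Rank.sound n i)) (D3 k (HasCard-map proj₁ (λ x → x , x) card))

  -- Axiom `D3` gives the diagonal entries and `D2` the others; `basis` serves as the Kronecker
  -- delta.
  covers-count : ∀ n k (i i′ : Fin ∣P n ∣) → (λ z → z ⋖ P[ n ] i × z ⋖ P[ n ] i′) HasCard k →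
    + count (covers? n (P[ n ] i) (P[ n ] i′)) ≡ + k + + r * basis ℤ-ring i i′
  covers-count n k i i′ card with i′ Fin.≟ i
  ... | yes refl = trans (cong +_ (covers-equal n k card)) (cong (λ z → + k + z) (sym (ℤ.*-identityʳ (+ r))))
  ... | no i′≢i  = trans (cong +_ (covers-distinct n k (i′≢i ∘ sym) card))
    (sym (trans (cong (λ z → + k + z) (ℤ.*-zeroʳ (+ r))) (ℤ.+-identityʳ (+ k))))

  B : ∀ n → Fin ∣P n ∣ → Fin ∣P suc n ∣ → ℤ
  B n i j = indicator (P[ n ] i ⋖? P[ suc n ] j)

  U-lookup : ∀ n v j → ⟦ U n ⟧ v j ≡ ∑ (λ i → v i * B n i j)
  U-lookup n v j = sum-lookup ℤ-ring (λ i → v i *ₗ B n i) j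

  D-lookup : ∀ n v i → ⟦ D[1+ n ] ⟧ v i ≡ ∑ (λ j → v j * B n i j)
  D-lookup n v i = sum-lookup ℤ-ring (λ j → v j *ₗ λ i → B n i j) i

  private
    ∑∑ : ∀ {m n} (v : Vector ℤ m) (M : Matrix ℤ m n) (w : Vector ℤ n) →
      ∑ (λ j → ∑ (λ i → v i * M i j) * w j) ≡ ∑ (λ i → v i * ∑ (λ j → M i j * w j))
    ∑∑ v M w = trans (∑-cong λ j → *-distribʳ-sum (w j) (λ i → v i * M i j))
      (trans (∑-swap (λ j i → v i * M i j * w j))
        (∑-cong λ i → trans (∑-cong λ j → ℤ.*-assoc (v i) (M i j) (w j))
          (sym (*-distribˡ-sum (v i) (λ j → M i j * w j)))))

  DU-lookup : ∀ n v i → ⟦ DU n ⟧ v i ≡ ∑ (λ i′ → v i′ * + count (covers? n (P[ n ] i′) (P[ n ] i)))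
  DU-lookup n v i = trans (D-lookup n (⟦ U n ⟧ v) i) (trans (∑-cong λ j → cong (_* B n i j) (U-lookup n v j))
    (trans (∑∑ v (B n) (B n i)) (∑-cong λ i′ → cong (v i′ *_)
      (trans (∑-cong λ j → indicator-* (P[ n ] i′ ⋖? P[ suc n ] j) (P[ n ] i ⋖? P[ suc n ] j))
        (∑-indicator (covers? n (P[ n ] i′) (P[ n ] i)))))))

  UD-lookup : ∀ n v j → ⟦ U n ∘ₗ D[1+ n ] ⟧ v j ≡ ∑ (λ j′ → v j′ * + count
      (cocovers? n (P[ suc n ] j′) (P[ suc n ] j)))
  UD-lookup n v j = trans (U-lookup n (⟦ D[1+ n ] ⟧ v) j) (trans
      (∑-cong λ i → cong (_* B n i j) (D-lookup n v i))
    (trans (∑∑ v (λ j′ i → B n i j′) (λ i → B n i j)) (∑-cong λ j′ → cong (v j′ *_)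
      (trans (∑-cong λ i → indicator-* (P[ n ] i ⋖? P[ suc n ] j′) (P[ n ] i ⋖? P[ suc n ] j))
        (∑-indicator (cocovers? n (P[ suc n ] j′) (P[ suc n ] j)))))))

  private
    ∑-scaled-basis : ∀ {n} (v : Vector ℤ n) i → ∑ (λ j → v j * (+ r * basis ℤ-ring j i)) ≡ + r * v i
    ∑-scaled-basis v i = trans (∑-cong λ j → exchange (v j) (+ r) (basis ℤ-ring j i))
      (trans (sym (*-distribˡ-sum (+ r) (λ j → v j * basis ℤ-ring j i))) (cong (+ r *_) (sum-basis ℤ-ring v i)))
      where
      exchange : ∀ v r b → v * (r * b) ≡ r * (v * b)
      exchange = solve-∀

  DU₀ : ∀ v → ⟦ DU 0 ⟧ v ≗ (+ r) *ₗ v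
  DU₀ v i = trans (DU-lookup 0 v i) (trans (∑-cong λ i′ → cong (v i′ *_)
    (trans (covers-count 0 0 i′ i (bottom-card (Rank.sound 0 i′))) (ℤ.+-identityˡ _))) (∑-scaled-basis v i))

  DU≗UD+r : ∀ n v → ⟦ DU (suc n) ⟧ v ≗ ⟦ U n ∘ₗ D[1+ n ] ⟧ v +ᴹ (+ r) *ₗ v
  DU≗UD+r n v j = trans (DU-lookup (suc n) v j) (trans
    (∑-cong λ j′ → trans (cong (v j′ *_) (covers-count (suc n) _ j′ j
        (cocovers-card n (Rank.sound (suc n) j′))))
      (ℤ.*-distribˡ-+ (v j′) (+ count (cocovers? n (P[ suc n ] j′) (P[ suc n ] j))) (+ r * basis ℤ-ring j′ j)))
    (trans (∑-+ (λ j′ → v j′ * + count (cocovers? n (P[ suc n ] j′) (P[ suc n ] j)))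
        (λ j′ → v j′ * (+ r * basis ℤ-ring j′ j)))
      (cong₂ _+_ (sym (UD-lookup n v j)) (∑-scaled-basis v j))))

  D-U-adjoint : ∀ n w v → ∑ (λ i → ⟦ D[1+ n ] ⟧ w i * v i) ≡ ∑ (λ j → w j * ⟦ U n ⟧ v j)
  D-U-adjoint n w v = trans (∑-cong λ i → cong (_* v i) (D-lookup n w i))
    (trans (∑∑ w (λ j i → B n i j) v) (∑-cong λ j → cong (w j *_)
      (trans (∑-cong λ i → ℤ.*-comm (B n i j) (v i)) (sym (U-lookup n v j)))))

  -- U is the transpose of D, so a right inverse of D transposes to a left inverse of U.
  U-mod : (∀ n → LinearMap.Surjective D[1+ n ]) → ∀ n h v → h ∣ᵛ ⟦ U n ⟧ v → h ∣ᵛ v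
  U-mod surj n h v h∣ i = subst (h ∣_) eq (∑-∣ (λ j → s j * ⟦ U n ⟧ v j) λ j → ℤ.∣n⇒∣m*n (s j) (h∣ j))
    where
    s = proj₁ (surj n (λ l → basis ℤ-ring l i))
    ∑-∣ : ∀ {k} (x : Vector ℤ k) → (∀ i → h ∣ x i) → h ∣ ∑ x
    ∑-∣ {zero}  x h∣ = divides 0ℤ refl
    ∑-∣ {suc k} x h∣ = ℤ.∣m∣n⇒∣m+n (h∣ zero) (∑-∣ (x ∘ suc) (h∣ ∘ suc))
    eq : ∑ (λ j → s j * ⟦ U n ⟧ v j) ≡ v i
    eq = trans (sym (D-U-adjoint n s v)) (trans
      (∑-cong λ l → trans (cong (_* v l) (proj₂ (surj n (λ l → basis ℤ-ring l i)) (λ _ → refl) l))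
          (ℤ.*-comm _ (v l)))
      (sum-basis ℤ-ring v i))

-- Kernels and eigenvectors over the integers

infixl 6 _-ₗ_
_-ₗ_ : n ⇒ᶻ n → ℤ → n ⇒ᶻ n
φ -ₗ c = linearMapᶻ (λ v → ⟦ φ ⟧ v +ᴹ (- c) *ₗ v)
  (λ e i → cong₂ _+_ (⟦⟧-cong φ e i) (cong (- c *_) (e i)))
  (λ v w i → trans (cong (_+ - c * (v i + w i)) (+ᴹ-homo φ v w i))
      (additive (⟦ φ ⟧ v i) (⟦ φ ⟧ w i) (- c) (v i) (w i)))
  (λ a v i → trans (cong (_+ - c * (a * v i)) (*ₗ-homo φ a v i)) (homogeneous a (⟦ φ ⟧ v i) (- c) (v i)))
  where
  additive : ∀ x y c v w → x + y + c * (v + w) ≡ (x + c * v) + (y + c * w)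
  additive = solve-∀
  homogeneous : ∀ a x c v → a * x + c * (a * v) ≡ a * (x + c * v)
  homogeneous = solve-∀

-- Kernels are saturated: `κ u = h w` forces `F w = 0` because `h` cancels, so `w` is some `κ u′`,
-- and `u = h u′` by injectivity.
kernel-∣ᵛ : ∀ {F : m ⇒ᶻ n} (K : KernelBasis F d) {h} → ¬ h ≡ 0ℤ → ∀ {u} →
  h ∣ᵛ ⟦ KernelBasis.κ K ⟧ u → h ∣ᵛ u
kernel-∣ᵛ {F = F} K {h} h≢0 {u} h∣ = ≗⇒∣ᵛ λ i → equal (u i) (h * u′ i) (injective (λ l →
    trans (+ᴹ-homo κ u ((- 1ℤ) *ₗ (h *ₗ u′)) l) (trans (cong₂ _+_ (κu≗ l)
      (trans (*ₗ-homo κ (- 1ℤ) (h *ₗ u′) l) (cong (- 1ℤ *_) (trans (*ₗ-homo κ h u′ l)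
          (cong (h *_) (sym (w≗ l)))))))
      (vanish (h * w l)))) i)
  where
  open KernelBasis K
  instance _ = ℤ.≢-nonZero h≢0
  w = proj₁ (∣ᵛ⇒≗ h∣)
  κu≗ = proj₂ (∣ᵛ⇒≗ h∣)
  Fw≗0 : ⟦ F ⟧ w ≗ 0ᴹ
  Fw≗0 i = ℤ.*-cancelˡ-≡ h _ _ (trans (sym (*ₗ-homo F h w i)) (trans (⟦⟧-cong F (sym ∘ κu≗) i)
    (trans (sound u i) (sym (ℤ.*-zeroʳ h)))))
  u′ = proj₁ (complete Fw≗0)
  w≗ = proj₂ (complete Fw≗0)
  equal : ∀ x y → x + - 1ℤ * y ≡ 0ℤ → x ≡ y
  equal x y e = trans (lemma x y) (trans (cong (_+ y) e) (ℤ.+-identityˡ y))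
    where
    lemma : ∀ x y → x ≡ x + - 1ℤ * y + y
    lemma = solve-∀
  vanish : ∀ x → x + - 1ℤ * x ≡ 0ℤ
  vanish = solve-∀

fromBasis : Vector (Vector ℤ n) k → k ⇒ᶻ n
fromBasis {n} = linearExtension (ℤ^ n)

⟦⟧-fromBasis : (f : m ⇒ᶻ n) (v : Vector (Vector ℤ m) k) (α : Vector ℤ k) →
  ⟦ f ⟧ (⟦ fromBasis v ⟧ α) ≗ ⟦ fromBasis (λ l → ⟦ f ⟧ (v l)) ⟧ α
⟦⟧-fromBasis f v α i = trans (⟦⟧-sum f (λ l → α l *ₗ v l) i) (sumᴹ-cong (λ l → *ₗ-homo f (α l) (v l)) i)

fromBasis-cong : {v w : Vector (Vector ℤ n) k} → (∀ l → v l ≗ w l) → ∀ α → ⟦ fromBasis v ⟧ α ≗ ⟦ fromBasis w ⟧ α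
fromBasis-cong e α = sumᴹ-cong λ l i → cong (α l *_) (e l i)

kernel-relation : ∀ {F : m ⇒ᶻ n} → KernelBasis F d → d ℕ.< k → (v : Vector (Vector ℤ m) k) →
  (∀ l → ⟦ F ⟧ (v l) ≗ 0ᴹ) → ∃ λ α → Primitive α × ⟦ fromBasis v ⟧ α ≗ 0ᴹ
kernel-relation K d<k v v∈ = α , prim , λ i →
  trans (fromBasis-cong (λ l → proj₂ (K.complete (v∈ l))) α i)
    (trans (sym (⟦⟧-fromBasis K.κ u α i)) (trans (⟦⟧-cong K.κ uα≗0 i) (0ᴹ-homo K.κ i)))
  where
  module K = KernelBasis K
  u = λ l → proj₁ (K.complete (v∈ l))
  α = proj₁ (primitive-relation d<k (fromBasis u))
  prim = proj₁ (proj₂ (primitive-relation d<k (fromBasis u)))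
  uα≗0 = proj₂ (proj₂ (primitive-relation d<k (fromBasis u)))

x-cy≡0⇒x≡cy : ∀ x c y → x + - c * y ≡ 0ℤ → x ≡ c * y
x-cy≡0⇒x≡cy x c y e = trans (lemma x c y) (trans (cong (_+ c * y) e) (ℤ.+-identityˡ _))
  where
  lemma : ∀ x c y → x ≡ x + - c * y + c * y
  lemma = solve-∀

-- The columns of `V Z κ` lie in the kernel of `D` modulo `h`; subtracting `h` times a preimage puts
-- them into the kernel exactly. With more than `d` of them, a primitive relation `α` would make `h`
-- divide `V Z κ α`, hence `κ α`, hence `α`, impossible for a nonunit.
kernel-embedding : ∀ {m n p q d e h} {D : m ⇒ᶻ n} {F : p ⇒ᶻ q} → LinearMap.Surjective D →
  KernelBasis D d → (K : KernelBasis F e) (Z : p ⇒ᶻ n) (V : n ⇒ᶻ m) → ¬ h ≡ 0ℤ → ¬ h ∣ 1ℤ →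
  let open KernelBasis K in
  (∀ u → ⟦ D ⟧ (⟦ V ⟧ (⟦ Z ⟧ (⟦ κ ⟧ u))) ≗ h *ₗ ⟦ Z ⟧ (⟦ κ ⟧ u)) →
  (∀ v → h ∣ᵛ ⟦ V ⟧ (⟦ Z ⟧ v) → h ∣ᵛ v) → e ℕ.≤ d
kernel-embedding {m} {n} {d = d} {e} {h} {D} surj KD K Z V h≢0 h∤1 DVZ mod = ℕ.≮⇒≥ impossible
  where
  module K = KernelBasis K
  T : e ⇒ᶻ m
  T = V ∘ₗ Z ∘ₗ K.κ

  z : Vector (Vector ℤ n) e
  z l = ⟦ Z ⟧ (⟦ K.κ ⟧ (basis ℤ-ring l))

  s y : Vector (Vector ℤ m) e
  s l = proj₁ (surj (z l))
  y l = ⟦ T ⟧ (basis ℤ-ring l) +ᴹ (- h) *ₗ s l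

  Dy≗0 : ∀ l → ⟦ D ⟧ (y l) ≗ 0ᴹ
  Dy≗0 l i = trans (+ᴹ-homo D (⟦ T ⟧ (basis ℤ-ring l)) ((- h) *ₗ s l) i)
    (trans (cong₂ _+_ (DVZ (basis ℤ-ring l) i)
      (trans (*ₗ-homo D (- h) (s l) i) (cong (- h *_) (proj₂ (surj (z l)) (λ _ → refl) i))))
      (vanish h (z l i)))
    where
    vanish : ∀ h x → h * x + - h * x ≡ 0ℤ
    vanish = solve-∀

  split : ∀ α i → ⟦ fromBasis y ⟧ α i ≡ ⟦ T ⟧ α i + - h * ⟦ fromBasis s ⟧ α i
  split α i = trans (sumᴹ-cong {w = λ l → α l *ₗ ⟦ T ⟧ (basis ℤ-ring l) +ᴹ (- h) *ₗ (α l *ₗ s l)}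
      (λ l i → distrib (α l) (⟦ T ⟧ (basis ℤ-ring l) i) (- h) (s l i)) i)
    (trans (sumᴹ-+ (λ l → α l *ₗ ⟦ T ⟧ (basis ℤ-ring l)) (λ l → (- h) *ₗ (α l *ₗ s l)) i)
      (cong₂ _+_ (sym (⟦⟧-basis T α i)) (sumᴹ-*ₗ (- h) (λ l → α l *ₗ s l) i)))
    where
    distrib : ∀ a t h s → a * (t + h * s) ≡ a * t + h * (a * s)
    distrib = solve-∀

  impossible : ¬ d ℕ.< e
  impossible lt = refute (kernel-relation KD lt y Dy≗0)
    where
    refute : ¬ ∃ λ α → Primitive α × ⟦ fromBasis y ⟧ α ≗ 0ᴹ
    refute (α , prim , yα≗0) = h∤1 (prim h (kernel-∣ᵛ K h≢0 (mod (⟦ K.κ ⟧ α) (≗⇒∣ᵛ λ i →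
      x-cy≡0⇒x≡cy (⟦ T ⟧ α i) h (⟦ fromBasis s ⟧ α i) (trans (sym (split α i)) (yα≗0 i))))))

-- Since U D multiplies the eigenvectors of φ by c ≠ 0, D is injective on their span.
relation-through-D : ∀ {m n c λ₀} (D : m ⇒ᶻ n) (U : n ⇒ᶻ m) (φ : m ⇒ᶻ m) → ¬ c ≡ 0ℤ →
  (∀ {w} → ⟦ φ ⟧ w ≗ λ₀ *ₗ w → ⟦ U ⟧ (⟦ D ⟧ w) ≗ c *ₗ w) →
  (v : Vector (Vector ℤ m) k) → (∀ l → ⟦ φ ⟧ (v l) ≗ λ₀ *ₗ v l) →
  ∀ α → ⟦ fromBasis (λ l → ⟦ D ⟧ (v l)) ⟧ α ≗ 0ᴹ → ⟦ fromBasis v ⟧ α ≗ 0ᴹ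
relation-through-D {m = m} {c = c} {λ₀} D U φ c≢0 UD v ev α e i =
  ℤ.*-cancelˡ-≡ c (x i) 0ℤ (trans (sym (UD φx i)) (trans (⟦⟧-cong U
      (λ l → trans (⟦⟧-fromBasis D v α l) (e l)) i)
    (trans (0ᴹ-homo U i) (sym (ℤ.*-zeroʳ c)))))
  where
  instance _ = ℤ.≢-nonZero c≢0
  x : Vector ℤ m
  x = ⟦ fromBasis v ⟧ α
  φx : ⟦ φ ⟧ x ≗ λ₀ *ₗ x
  φx i = trans (⟦⟧-fromBasis φ v α i) (trans (fromBasis-cong ev α i)
    (trans (sumᴹ-cong (λ l i → exchange (α l) λ₀ (v l i)) i) (sumᴹ-*ₗ λ₀ (λ l → α l *ₗ v l) i)))
    where
    exchange : ∀ a c x → a * (c * x) ≡ c * (a * x)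
    exchange = solve-∀

ℕ-elim : ∀ {p} (Q : ℕ → Set p) → Q 0 → (∀ n → Q n → Q (suc n)) → ∀ n → Q n
ℕ-elim Q base step zero    = base
ℕ-elim Q base step (suc n) = step n (ℕ-elim Q base step n)

-- Eigenspaces of `DU` and the growth of the ranks

module Eigenspaces {r c ℓ₁ ℓ₂} (𝒫 : DifferentialPoset r c ℓ₁ ℓ₂) (1≤r : 1 ℕ.≤ r)
  (surj : ∀ n → LinearMap.Surjective (UpDown.D[1+_] 𝒫 n)) where
  open DifferentialPoset 𝒫 using (∣P_∣; Δp)
  open UpDown 𝒫
  open DifferentialPosetProperties 𝒫

  private
    U-mod′ = U-mod surj

    abstract
      D-kernel : ∀ b → ∃ λ d → d ℕ.+ ∣P b ∣ ≡ ∣P suc b ∣ × KernelBasis D[1+ b ] d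
      D-kernel b = kernelBasis D[1+ b ] (surj b)

    cancel : ∀ x y → x + y + - y ≡ x
    cancel = solve-∀

  U-injective : ∀ n {v} → ⟦ U n ⟧ v ≗ 0ᴹ → v ≗ 0ᴹ
  U-injective n {v} e i = ℤ.0∣⇒≡0 (U-mod′ n 0ℤ v (λ j → ℤ.∣-reflexive (sym (e j))) i)

  -- The rank of the kernel of the down map on rank `b`. On rank 0 that map has target zero, so its
  -- kernel is everything; this makes `Δp≡dim` hold in all ranks.
  dim : ℕ → ℕ
  dim zero    = ∣P 0 ∣
  dim (suc b) = proj₁ (D-kernel b)

  dim-kernel : ∀ b → KernelBasis D[1+ b ] (dim (suc b))
  dim-kernel b = proj₂ (proj₂ (D-kernel b))

  UD≗DU-r : ∀ n v → ⟦ U n ∘ₗ D[1+ n ] ⟧ v ≗ ⟦ DU (suc n) -ₗ + r ⟧ v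
  UD≗DU-r n v i = sym (trans (cong (_+ - + r * v i) (DU≗UD+r n v i))
    (trans (cong (λ z → ⟦ U n ∘ₗ D[1+ n ] ⟧ v i + + r * v i + z) (sym (ℤ.neg-distribˡ-* (+ r) (v i))))
        (cancel _ (+ r * v i))))

  -- In positive ranks `DU b - r` is `U D`, and `U` is injective, so the eigenspace is the kernel of
  -- `D`; in rank 0 `DU` is multiplication by `r`.
  r-eigenspace : ∀ b → KernelBasis (DU b -ₗ + r) (dim b)
  r-eigenspace zero = record
    { κ = idₗ ; sound = λ v i → vanish v i
    ; complete = λ {v} _ → v , λ _ → refl ; injective = id }
    where
    vanish : ∀ v → ⟦ DU 0 -ₗ + r ⟧ v ≗ 0ᴹ
    vanish v i = trans (cong (_+ - + r * v i) (DU₀ v i)) (lemma (+ r) (v i))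
      where
      lemma : ∀ r x → r * x + - r * x ≡ 0ℤ
      lemma = solve-∀
  r-eigenspace (suc b) = record
    { κ = K.κ
    ; sound = λ u i → trans (sym (UD≗DU-r b (⟦ K.κ ⟧ u) i)) (trans (⟦⟧-cong (U b) (K.sound u) i)
        (0ᴹ-homo (U b) i))
    ; complete = λ {v} e → K.complete (U-injective b (λ i → trans (UD≗DU-r b v i) (e i)))
    ; injective = K.injective
    }
    where module K = KernelBasis (dim-kernel b)

  eigen : ∀ b u → ⟦ DU b ⟧ (⟦ KernelBasis.κ (r-eigenspace b) ⟧ u) ≗ (+ r) *ₗ ⟦ KernelBasis.κ
      (r-eigenspace b) ⟧ u
  eigen b u i = trans (restore (⟦ DU b ⟧ v i) (+ r) (v i)) (trans
      (cong (_+ + r * v i) (KernelBasis.sound (r-eigenspace b) u i)) (ℤ.+-identityˡ _))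
    where
    v = ⟦ KernelBasis.κ (r-eigenspace b) ⟧ u
    restore : ∀ x r y → x ≡ x + - r * y + r * y
    restore = solve-∀

  Δp≡dim : ∀ b → Δp (+ b) ≡ + dim b
  Δp≡dim zero    = ℤ.+-identityʳ _
  Δp≡dim (suc b) = trans (cong (λ z → + z - + ∣P b ∣) (sym (proj₁ (proj₂ (D-kernel b)))))
      (cancel (+ dim (suc b)) (+ ∣P b ∣))

  U^ : ∀ a b → ∣P b ∣ ⇒ᶻ ∣P a ℕ.+ b ∣
  U^ zero    b = idₗ
  U^ (suc a) b = U (a ℕ.+ b) ∘ₗ U^ a b

  U^-mod : ∀ a b h v → h ∣ᵛ ⟦ U^ a b ⟧ v → h ∣ᵛ v
  U^-mod zero    b h v h∣ = h∣
  U^-mod (suc a) b h v h∣ = U^-mod a b h v (U-mod′ (a ℕ.+ b) h (⟦ U^ a b ⟧ v) h∣)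

  DU-U^ : ∀ a b {v} → ⟦ DU b ⟧ v ≗ (+ r) *ₗ v → ⟦ DU (a ℕ.+ b) ⟧ (⟦ U^ a b ⟧ v) ≗
      (+ (suc a ℕ.* r)) *ₗ ⟦ U^ a b ⟧ v
  DU-U^ zero    b {v} e i = trans (e i) (cong (λ z → + z * v i) (sym (ℕ.+-identityʳ r)))
  DU-U^ (suc a) b {v} e i = trans (DU≗UD+r (a ℕ.+ b) w′ i) (trans
    (cong (_+ + r * w′ i) (trans (⟦⟧-cong (U (a ℕ.+ b)) (DU-U^ a b e) i)
        (*ₗ-homo (U (a ℕ.+ b)) (+ (suc a ℕ.* r)) w i)))
    (collect (+ (suc a ℕ.* r)) (+ r) (w′ i)))
    where
    w = ⟦ U^ a b ⟧ v
    w′ = ⟦ U^ (suc a) b ⟧ v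
    collect : ∀ s r x → s * x + r * x ≡ (r + s) * x
    collect = solve-∀

  -- Modulo h = a r, U^a maps ker D into ker D.
  dim-mono : ∀ a b → 1 ℕ.≤ a → 2 ℕ.≤ a ℕ.* r → dim b ℕ.≤ dim (a ℕ.+ b)
  dim-mono (suc a) b _ 2≤ar = kernel-embedding (surj (a ℕ.+ b)) (dim-kernel (a ℕ.+ b)) (r-eigenspace b)
      (U^ a b) (U (a ℕ.+ b))
    (λ e → contradiction (ℤ.+-injective e) (ℕ.>⇒≢ (ℕ.<-≤-trans (ℕ.s≤s ℕ.z≤n) 2≤ar)))
    (λ h∣1 → ℕ.<⇒≱ 2≤ar (ℕ.∣⇒≤ (ℤ.∣⇒∣ᵤ h∣1)))
    (λ u → DU-U^ a b (eigen b u))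
    (U^-mod (suc a) b (+ (suc a ℕ.* r)))

  private
    subtract : ∀ {x y} c e → x ≡ c * y → x + - e * y ≡ (c - e) * y
    subtract {y = y} c e refl = lemma c e y
      where
      lemma : ∀ c e y → c * y + - e * y ≡ (c - e) * y
      lemma = solve-∀

  -- D carries the eigenvalue c r of DU in rank n + 1 to (c - 1) r in rank n, injectively unless c = 1.
  eigen-relation : ∀ j b (v : Vector (Vector ℤ ∣P j ℕ.+ b ∣) k) →
    (∀ l → ⟦ DU (j ℕ.+ b) ⟧ (v l) ≗ (+ (suc j ℕ.* r)) *ₗ v l) →
    dim b ℕ.< k → ∃ λ α → Primitive α × ⟦ fromBasis v ⟧ α ≗ 0ᴹ
  eigen-relation zero b v ev lt = kernel-relation (r-eigenspace b) lt v λ l i →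
    trans (subtract (+ (1 ℕ.* r)) (+ r) (ev l i)) (trans (cong (λ z → (+ z - + r) * v l i) (ℕ.+-identityʳ r))
      (trans (cong (_* v l i) (ℤ.+-inverseʳ (+ r))) (ℤ.*-zeroˡ (v l i))))
  eigen-relation {k} (suc j) b v ev lt = transfer (eigen-relation j b Dv Dv-eigen lt)
    where
    C = + (suc j ℕ.* r)
    C≢0 : ¬ C ≡ 0ℤ
    C≢0 e = contradiction (ℤ.+-injective e) (ℕ.>⇒≢ (ℕ.<-≤-trans 1≤r (ℕ.m≤m+n r (j ℕ.* r))))
    D = D[1+ j ℕ.+ b ]
    UD-eigen : ∀ {w} → ⟦ DU (suc j ℕ.+ b) ⟧ w ≗ (+ (suc (suc j) ℕ.* r)) *ₗ w → ⟦ U (j ℕ.+ b) ⟧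
        (⟦ D ⟧ w) ≗ C *ₗ w
    UD-eigen {w} e i = trans (UD≗DU-r (j ℕ.+ b) w i) (trans (subtract (+ (suc (suc j) ℕ.* r)) (+ r) (e i))
      (cong (_* w i) (lemma (+ r) C)))
      where
      lemma : ∀ r s → r + s - r ≡ s
      lemma = solve-∀
    Dv : Vector (Vector ℤ ∣P j ℕ.+ b ∣) k
    Dv l = ⟦ D ⟧ (v l)
    Dv-eigen : ∀ l → ⟦ DU (j ℕ.+ b) ⟧ (Dv l) ≗ C *ₗ Dv l
    Dv-eigen l i = trans (⟦⟧-cong D {y = C *ₗ v l} (UD-eigen {v l} (ev l)) i) (*ₗ-homo D C (v l) i)
    transfer : (∃ λ α → Primitive α × ⟦ fromBasis Dv ⟧ α ≗ 0ᴹ) → ∃ λ α → Primitive α × ⟦ fromBasis v ⟧ α ≗ 0ᴹ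
    transfer (α , prim , e) = α , prim ,
      relation-through-D {c = C} {λ₀ = + (suc (suc j) ℕ.* r)} D (U (j ℕ.+ b)) (DU (suc j ℕ.+ b)) C≢0
          (λ {w} → UD-eigen {w}) v ev α e

  -- Dividing each `a l` by the common factor yields eigenvectors `v l`. They are independent, since
  -- a constant multiple `α` of the quotient lies in the ideal of `a l` only for `α = 0`, and
  -- `eigen-relation` excludes more than `dim b` of them.
  root-multiplicity : ∀ j b {g : Vector (Vector ℤ ∣P j ℕ.+ b ∣) k} {a} → Family (DU (j ℕ.+ b)) g a →
    (∀ l → X-[ + (suc j ℕ.* r) ] ∣ᴾ a l) → k ℕ.≤ dim b
  root-multiplicity {k} j b {g} {a} F ℓ∣ = ℕ.≮⇒≥ impossible
    where
    module F = Family F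
    open Action (DU (j ℕ.+ b))
    ℓ = X-[ + (suc j ℕ.* r) ]
    s : Vector ℤ[x] k
    s l = _∣ᴾ_.quotient (ℓ∣ l)
    sℓ≈a : ∀ l → s l P.* ℓ ≈ a l
    sℓ≈a l = _∣ᴾ_.equality (ℓ∣ l)
    v : Vector (Vector ℤ ∣P j ℕ.+ b ∣) k
    v l = act (s l) (g l)
    ev : ∀ l → ⟦ DU (j ℕ.+ b) ⟧ (v l) ≗ (+ (suc j ℕ.* r)) *ₗ v l
    ev l i = x-cy≡0⇒x≡cy (⟦ DU (j ℕ.+ b) ⟧ (v l) i) (+ (suc j ℕ.* r)) (v l i)
        (trans (sym (act-X- (DU (j ℕ.+ b)) (+ (suc j ℕ.* r)) (v l) i))
      (trans (sym (act-assoc ℓ (s l) (g l) i)) (trans (act-congˡ (ℓ P.* s l) (a l)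
          (≈-trans (P.*-comm ℓ (s l)) (sℓ≈a l)) i) (F.kills l i))))

    -- From `α s = u a = u s ℓ` the monic `a` cancels to give `α = u ℓ`, and a constant that is a
    -- multiple of a monic linear polynomial is 0.
    coefficient≡0 : ∀ l α → InIdeal (a l) 0ℤ (α P.· s l) → 0ℤ ∣ α
    coefficient≡0 l α (u , 0∣) = reduced-mod {f = const α} (monic-X- (+ (suc j ℕ.* r))) (λ { (suc _) _ → refl })
      (u , λ i → ℤ.∣-reflexive (sym (trans (cong (λ z → coeff (const α) i - z) (coeff-≡ uℓ≈α i))
          (ℤ.+-inverseʳ (coeff (const α) i))))) 0
      where
      open ≈ᴾ-Reasoning
      G = u P.* ℓ P.+ P.- const α
      αs≈ua : const α P.* s l ≈ u P.* a l
      αs≈ua = ≈-trans (const-* α (s l)) (mk≈ λ i → ℤ.i-j≡0⇒i≡j _ _ (ℤ.0∣⇒≡0 (0∣ i)))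
      Ga≈0 : G P.* a l ≈ []
      Ga≈0 = begin
        G P.* a l
          ≈⟨ expand u ℓ (const α) (a l) ⟩
        (u P.* a l) P.* ℓ P.+ P.- (const α P.* a l)
          ≈⟨ P.+-cong (P.*-congʳ (≈-sym αs≈ua) ℓ) (P.-‿cong (*ᴾ-congˡ (const α) (≈-sym (sℓ≈a l)))) ⟩
        (const α P.* s l) P.* ℓ P.+ P.- (const α P.* (s l P.* ℓ))
          ≈⟨ P.+-congʳ {g = P.- (const α P.* (s l P.* ℓ))} (P.*-assoc (const α) (s l) ℓ) ⟩
        const α P.* (s l P.* ℓ) P.+ P.- (const α P.* (s l P.* ℓ))
          ≈⟨ P.-‿inverseʳ (const α P.* (s l P.* ℓ)) ⟩
        [] ∎
        where
        expand : ∀ u ℓ α a → (u P.* ℓ P.+ P.- α) P.* a ≈ (u P.* a) P.* ℓ P.+ P.- (α P.* a)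
        expand = solve-∀-in ℤ[x]-almostCommutativeRing
      G≈0 : G ≈ []
      G≈0 = mk≈ λ i → ℤ.0∣⇒≡0 (monic-multiple {a = a l} (proj₂ (proj₂ (F.monic l))) G
        (λ m _ → ℤ.∣-reflexive (sym (coeff-≡ Ga≈0 m))) i)
      uℓ≈α : u P.* ℓ ≈ const α
      uℓ≈α = begin
        u P.* ℓ           ≈⟨ regroup (u P.* ℓ) (const α) ⟩
        G P.+ const α     ≈⟨ P.+-congʳ {g = const α} G≈0 ⟩
        const α           ∎
        where
        regroup : ∀ x y → x ≈ (x P.+ P.- y) P.+ y
        regroup = solve-∀-in ℤ[x]-almostCommutativeRing

    impossible : ¬ dim b ℕ.< k
    impossible lt = refute (eigen-relation j b v ev lt)
      where
      refute : ¬ ∃ λ α → Primitive α × ⟦ fromBasis v ⟧ α ≗ 0ᴹ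
      refute (α , prim , vα≗0) = contradiction (ℤ.0∣⇒≡0 (prim 0ℤ λ l → coefficient≡0 l (α l)
        (F.relations-mod 0ℤ (λ l → α l P.· s l) (λ i → ℤ.∣-reflexive (sym
          (trans (sumᴹ-cong (λ l → act-· (α l) (s l) (g l)) i) (vα≗0 i)))) l))) λ ()

  -- By the chain a root of `a i` is a root of all later annihilators, so the bound applies to the
  -- generators from `i` on.
  suffix-multiplicity : ∀ j b {g : Vector (Vector ℤ ∣P j ℕ.+ b ∣) k} {a} → Family (DU (j ℕ.+ b)) g a →
    ∀ i → X-[ + (suc j ℕ.* r) ] ∣ᴾ a i → k ∸ toℕ i ℕ.≤ dim b
  suffix-multiplicity j b F zero    ℓ∣ = root-multiplicity j b F λ l → ∣ᴾ-trans ℓ∣ (Family.chain F zero l ℕ.z≤n)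
  suffix-multiplicity j b F (suc i) ℓ∣ = suffix-multiplicity j b (tail-Family F) i ℓ∣

  -- Since `D` intertwines `DU (suc n)` with `DU n + r`, each factor has its root lowered by `r`.
  D-linearProduct : ∀ n c J v → ⟦ D[1+ n ] ⟧ (Action.act (DU (suc n)) (linearProduct r (suc c) J) v)
    ≗ Action.act (DU n) (linearProduct r c J) (⟦ D[1+ n ] ⟧ v)
  D-linearProduct n c zero v i = trans (⟦⟧-cong D[1+ n ] (Action.act-identityˡ (DU (suc n)) v) i)
    (sym (Action.act-identityˡ (DU n) (⟦ D[1+ n ] ⟧ v) i))
  D-linearProduct n c (suc J) v i = trans (⟦⟧-cong D (λ l → trans (φ.act-assoc X-[ + (suc c ℕ.* r) ] L v l)
      (act-X- (DU (suc n)) (+ (suc c ℕ.* r)) y l)) i)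
    (trans (+ᴹ-homo D (⟦ DU (suc n) ⟧ y) ((- + (suc c ℕ.* r)) *ₗ y) i) (trans (cong₂ _+_
      (trans (⟦⟧-cong D (DU≗UD+r n y) i) (trans (+ᴹ-homo D (⟦ U n ∘ₗ D ⟧ y) ((+ r) *ₗ y) i)
          (cong (λ z → ⟦ DU n ⟧ (⟦ D ⟧ y) i + z) (*ₗ-homo D (+ r) y i))))
      (*ₗ-homo D (- + (suc c ℕ.* r)) y i))
    (trans (lemma (⟦ DU n ⟧ (⟦ D ⟧ y) i) (+ r) (+ (c ℕ.* r)) (⟦ D ⟧ y i))
        (sym (trans (ψ.act-assoc X-[ + (c ℕ.* r) ] L′ (⟦ D ⟧ v) i)
      (trans (act-X- (DU n) (+ (c ℕ.* r)) (ψ.act L′ (⟦ D ⟧ v)) i)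
          (cong₂ _+_ (⟦⟧-cong (DU n) (λ l → sym (IH l)) i) (cong (- + (c ℕ.* r) *_) (sym (IH i))))))))))
    where
    module φ = Action (DU (suc n))
    module ψ = Action (DU n)
    D = D[1+ n ]
    L = linearProduct r (suc (suc c)) J
    L′ = linearProduct r (suc c) J
    y = φ.act L v
    IH : ⟦ D ⟧ y ≗ ψ.act L′ (⟦ D ⟧ v)
    IH = D-linearProduct n (suc c) J v
    lemma : ∀ x r c y → (x + r * y) + - (r + c) * y ≡ x + - c * y
    lemma = solve-∀

  -- The factor with root `r` acts as `U D`. Its `D` moves the other factors to the rank below,
  -- where their roots again start at `r`, and induction applies.
  linearProduct-kills : ∀ n v → Action.act (DU n) (linearProduct r 1 (suc n)) v ≗ 0ᴹ
  linearProduct-kills n v i = trans (φ.act-assoc X-[ + (1 ℕ.* r) ] L v i)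
    (trans (act-X- (DU n) (+ (1 ℕ.* r)) (φ.act L v) i) (trans (cong
        (λ z → ⟦ DU n ⟧ (φ.act L v) i + - + z * φ.act L v i) (ℕ.+-identityʳ r)) (last n v i)))
    where
    L = linearProduct r 2 n
    module φ = Action (DU n)
    last : ∀ n v → ⟦ DU n -ₗ + r ⟧ (Action.act (DU n) (linearProduct r 2 n) v) ≗ 0ᴹ
    last zero    v = KernelBasis.sound (r-eigenspace 0) _
    last (suc n) v i = trans (sym (UD≗DU-r n (Action.act (DU (suc n)) (linearProduct r 2 (suc n)) v) i))
        (trans (⟦⟧-cong (U n) {y = 0ᴹ} (λ l → trans (D-linearProduct n 1 (suc n) v l)
        (linearProduct-kills n (⟦ D[1+ n ] ⟧ v) l)) i) (0ᴹ-homo (U n) i))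

  -- Only for r = 1 and c = 1, 3 can c r be a root of the critical annihilator a,
  -- and it then contributes at most the factor c r to a(0).
  weight : ℕ → ℤ
  weight 3 = + 3
  weight _ = 1ℤ

  weightProduct∣3 : ∀ J → weightProduct weight 1 J ∣ + 3
  weightProduct∣3 0 = divides (+ 3) refl
  weightProduct∣3 1 = divides (+ 3) refl
  weightProduct∣3 2 = divides (+ 3) refl
  weightProduct∣3 (suc (suc (suc J))) = ℤ.∣-reflexive (cong (λ z → 1ℤ * (1ℤ * (+ 3 * z))) (trivial 0 J))
    where
    trivial : ∀ c J → weightProduct weight (4 ℕ.+ c) J ≡ 1ℤ
    trivial c zero    = refl
    trivial c (suc J) = trans (ℤ.*-identityˡ _) (trivial (suc c) J)

  -- The index `j` stands for the possible root `(j + 1) r`. The first alternative keeps it away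
  -- from the annihilator that takes the last dimension, the second lets the weight account for it.
  Growth : ℕ → Set
  Growth m = ∀ j b → j ℕ.+ b ≡ m → dim b ℕ.< dim (suc m) ⊎ weight (suc j) ≡ + (suc j ℕ.* r)

  -- A root of this `a i` is shared by all `dim (suc m)` generators from `i` on, which the first
  -- alternative of `Growth` forbids. Only weighted roots remain, and the weights multiply to a
  -- divisor of 3.
  growth⇒slack : ∀ m (pres : Presentation (DU m)) → Growth m → ∀ i →
    Presentation.length pres ∸ toℕ i ≡ dim (suc m) → coeff (Presentation.a pres i) 0 ∣ + 3
  growth⇒slack m pres growth i full = ℤ.∣-trans
    (subst (coeff (a i) 0 ∣_) (ℤ.*-identityˡ _) (coeff₀-∣-weights r weight (suc m) 1 P.1ᴾ roots
      (∣ᴾ-respʳ (≈-sym (P.*-identityˡ _)) a∣)))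
    (weightProduct∣3 (suc m))
    where
    open Presentation pres
    open Action (DU m)
    L = linearProduct r 1 (suc m)
    a∣ : a i ∣ᴾ L
    a∣ = subst (a i ∣ᴾ_) (single-self i L) (relations (single i L)
        (λ l → trans (comb-single i L g l) (linearProduct-kills m (g i) l)) i)
    ∤a : ∀ j b → j ℕ.+ b ≡ m → dim b ℕ.< dim (suc m) → ¬ X-[ + (suc j ℕ.* r) ] ∣ᴾ a i
    ∤a j b refl lt ℓ∣ = ℕ.<⇒≱ lt (subst (ℕ._≤ dim b) full (suffix-multiplicity j b (family pres) i ℓ∣))
    roots : ∀ c → 1 ℕ.≤ c → c ℕ.< 1 ℕ.+ suc m → ¬ X-[ + (c ℕ.* r) ] ∣ᴾ a i ⊎ weight c ≡ + (c ℕ.* r)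
    roots (suc j) _ (ℕ.s≤s (ℕ.s≤s j≤m)) =
      map₁ (∤a j (m ∸ j) (ℕ.m+[n∸m]≡n j≤m)) (growth j (m ∸ j) (ℕ.m+[n∸m]≡n j≤m))

  ascend : ∀ m → Growth m → Presentation (DU m) → Presentation (DU (suc m))
  ascend m growth pres = shift-Presentation (DU (suc m)) (U m ∘ₗ D[1+ m ]) (+ r) (DU≗UD+r m)
    (Lift.lift-Presentation D[1+ m ] (U m) (surj m) (U-mod′ m) (dim-kernel m) pres (growth⇒slack m pres growth))

  -- The hypothesis is strict against one lower rank, and `dim-mono` carries this down by every
  -- distance `a` with `a r ≥ 2`. For `r ≥ 2` it starts at rank `m` and reaches all ranks below; for
  -- `r = 1` it starts at `m - 1`.
  Δp-growth⇒Growth : ∀ m → Δp (+ suc m ℤ.- 1ℤ ℤ.- δ r 1) + 1ℤ ℤ.≤ Δp (+ suc m) → Growth m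
  Δp-growth⇒Growth m hyp = growth (r ℕ.≟ 1)
    where
    dim< : ∀ b → + suc m ℤ.- 1ℤ ℤ.- δ r 1 ≡ + b → dim b ℕ.< dim (suc m)
    dim< b e = subst (ℕ._≤ dim (suc m)) (ℕ.+-comm (dim b) 1)
      (ℤ.drop‿+≤+ (subst₂ (λ x y → x + 1ℤ ℤ.≤ y) (trans (cong Δp e) (Δp≡dim b)) (Δp≡dim (suc m)) hyp))

    δ≡0 : ∀ r → ¬ r ≡ 1 → δ r 1 ≡ 0ℤ
    δ≡0 zero          _   = refl
    δ≡0 (suc zero)    r≢1 = contradiction refl r≢1
    δ≡0 (suc (suc _)) _   = refl

    dim<₁ : r ≡ 1 → ∀ {b} → suc b ≡ m → dim b ℕ.< dim (suc m)
    dim<₁ r≡1 {b} 1+b≡m = dim< b (trans (cong (λ z → + m ℤ.- δ z 1) r≡1) (cong (λ z → + z ℤ.- 1ℤ) (sym 1+b≡m)))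

    dim<₂ : ¬ r ≡ 1 → dim m ℕ.< dim (suc m)
    dim<₂ r≢1 = dim< m (trans (cong (λ z → + m ℤ.- z) (δ≡0 r r≢1)) (ℤ.+-identityʳ (+ m)))

    growth : Dec (r ≡ 1) → Growth m
    -- Rank `m` lies above the starting rank, but the root 1 has weight 1.
    growth (yes r≡1) 0 b _ = inj₂ (cong (λ z → + (1 ℕ.* z)) (sym r≡1))
    growth (yes r≡1) 1 b e = inj₁ (dim<₁ r≡1 e)
    -- Rank `m - 2` is at distance 1 from the starting rank, where the comparison would be modulo 1;
    -- the root 3 is left to the weight 3.
    growth (yes r≡1) 2 b _ = inj₂ (cong (λ z → + (3 ℕ.* z)) (sym r≡1))
    growth (yes r≡1) (suc (suc (suc j))) b e = inj₁ (ℕ.≤-<-trans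
      (dim-mono (2 ℕ.+ j) b (ℕ.s≤s ℕ.z≤n) (subst (λ z → 2 ℕ.≤ (2 ℕ.+ j) ℕ.* z) (sym r≡1) (ℕ.s≤s (ℕ.s≤s ℕ.z≤n))))
      (dim<₁ r≡1 {2 ℕ.+ j ℕ.+ b} e))
    growth (no r≢1) 0 b e = inj₁ (subst (λ z → dim z ℕ.< dim (suc m)) (sym e) (dim<₂ r≢1))
    growth (no r≢1) (suc j) b e = inj₁ (ℕ.≤-<-trans
      (dim-mono (suc j) b (ℕ.s≤s ℕ.z≤n) (ℕ.≤-trans (ℕ.≤∧≢⇒< 1≤r (r≢1 ∘ sym)) (ℕ.m≤m+n r (j ℕ.* r))))
      (subst (λ z → dim z ℕ.< dim (suc m)) (sym e) (dim<₂ r≢1)))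

  module _ (l : ℕ) (growth : ∀ m → l ℕ.≤ m → Growth m) (small : ∀ n → n ℕ.≤ l → Presentation (DU n)) where

    next : ∀ n → Dec (suc n ℕ.≤ l) → Presentation (DU n) → Presentation (DU (suc n))
    next n (yes n<l) _    = small (suc n) n<l
    next n (no  n≮l) pres = ascend n (growth n (ℕ.≤-pred (ℕ.≰⇒> n≮l))) pres

    presentations : ∀ n → Presentation (DU n)
    presentations = ℕ-elim (λ n → Presentation (DU n)) (small 0 ℕ.z≤n) (λ n → next n (suc n ℕ.≤? l))

-- Bijective linear maps

module _ {r ℓr} {R : Ring r ℓr} where
  open Ring R using () renaming (Carrier to A; _≈_ to _≋_; sym to ≋-sym; trans to ≋-trans; +-cong to ⊕-cong; *-congˡ to ⊛-congˡ)

  -- Only a set-theoretic section is asked for: injectivity makes it linear in `inverse`.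
  record IsBijective {m n} (F : LinearMap (freeModule R m) (freeModule R n)) : Set (r ⊔ ℓr) where
    field
      injective : ∀ {v w} → (∀ i → ⟦ F ⟧ v i ≋ ⟦ F ⟧ w i) → ∀ i → v i ≋ w i
      section   : Vector A n → Vector A m
      inverseʳ  : ∀ u i → ⟦ F ⟧ (section u) i ≋ u i

    inverse : LinearMap (freeModule R n) (freeModule R m)
    inverse = linearMap (freeModule R n) (freeModule R m) section
      (λ e → injective λ i → ≋-trans (inverseʳ _ i) (≋-trans (e i) (≋-sym (inverseʳ _ i))))
      (λ v w → injective λ i → ≋-trans (inverseʳ _ i) (≋-sym (≋-trans (+ᴹ-homo F (section v) (section w) i)
        (⊕-cong (inverseʳ v i) (inverseʳ w i)))))
      (λ a v → injective λ i → ≋-trans (inverseʳ _ i) (≋-sym (≋-trans (*ₗ-homo F a (section v) i)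
        (⊛-congˡ (inverseʳ v i)))))

    inverseˡ : ∀ v i → section (⟦ F ⟧ v) i ≋ v i
    inverseˡ v = injective (inverseʳ (⟦ F ⟧ v))

  ∘-IsBijective : ∀ {l m n} {F : LinearMap (freeModule R m) (freeModule R n)} {G : LinearMap
      (freeModule R l) (freeModule R m)} →
    IsBijective F → IsBijective G → IsBijective (F ∘ₗ G)
  ∘-IsBijective {F = F} F-bij G-bij = record
    { injective = G.injective ∘ F.injective
    ; section   = G.section ∘ F.section
    ; inverseʳ  = λ u i → ≋-trans (⟦⟧-cong F (G.inverseʳ (F.section u)) i) (F.inverseʳ u i)
    }
    where
    module F = IsBijective F-bij
    module G = IsBijective G-bij

kernel-trivial⇒injective : (F : m ⇒ᶻ n) → (∀ {v} → ⟦ F ⟧ v ≗ 0ᴹ → v ≗ 0ᴹ) → ∀ {v w} → ⟦ F ⟧ v ≗ ⟦ F ⟧ w → v ≗ w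
kernel-trivial⇒injective F trivial {v} {w} e i = trans (x-cy≡0⇒x≡cy (v i) 1ℤ (w i)
    (trivial {v +ᴹ (- 1ℤ) *ₗ w} (λ l →
  trans (+ᴹ-homo F v ((- 1ℤ) *ₗ w) l) (trans (cong₂ _+_ (e l) (*ₗ-homo F (- 1ℤ) w l))
      (vanish (⟦ F ⟧ w l)))) i)) (ℤ.*-identityˡ (w i))
  where
  vanish : ∀ x → x + - 1ℤ * x ≡ 0ℤ
  vanish = solve-∀

-- A larger source would put a primitive vector into the kernel, and primitive vectors are nonzero.
injective⇒≤ᶻ : (F : m ⇒ᶻ n) → (∀ {v w} → ⟦ F ⟧ v ≗ ⟦ F ⟧ w → v ≗ w) → m ℕ.≤ n
injective⇒≤ᶻ {m} {n} F inj = ℕ.≮⇒≥ λ lt → refute (primitive-relation lt F)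
  where
  refute : ¬ ∃ λ α → Primitive α × ⟦ F ⟧ α ≗ 0ᴹ
  refute (α , prim , e) = contradiction (ℤ.0∣⇒≡0 (prim 0ℤ λ i → ℤ.∣-reflexive
    (sym (inj {w = 0ᴹ} (λ l → trans (e l) (sym (0ᴹ-homo F l))) i)))) λ ()

bijective⇒≡ : {F : m ⇒ᶻ n} → IsBijective F → m ≡ n
bijective⇒≡ {F = F} bij = ℕ.≤-antisym (injective⇒≤ᶻ F injective)
  (injective⇒≤ᶻ inverse λ {v} {w} e i → trans (sym (inverseʳ v i)) (trans (⟦⟧-cong F e i) (inverseʳ w i)))
  where open IsBijective bij

-- Extension of scalars from ℤ to ℤ[x]

infix 4 _⇒ᴾ_
_⇒ᴾ_ : ℕ → ℕ → Set
m ⇒ᴾ n = LinearMap (freeModule ℤ[x]-ring m) (freeModule ℤ[x]-ring n)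

linearMapᴾ : (f : Vector ℤ[x] m → Vector ℤ[x] n) → (∀ {v w} → (∀ i → v i ≈ w i) → ∀ i → f v i ≈ f w i) →
  (∀ v w i → f (λ j → v j P.+ w j) i ≈ f v i P.+ f w i) → (∀ a v i → f (λ j → a P.* v j) i ≈ a P.* f v i)
      → m ⇒ᴾ n
linearMapᴾ {m} {n} = linearMap (freeModule ℤ[x]-ring m) (freeModule ℤ[x]-ring n)

open SemiringSum (Ring.semiring ℤ[x]-ring) using ()
  renaming (sum to ∑ᴾ; sum-cong-≋ to ∑ᴾ-cong; ∑-distrib-+ to ∑ᴾ-+; *-distribˡ-sum to *ᴾ-∑ᴾ)

coeff-∑ᴾ : (f : Vector ℤ[x] k) → ∀ l → coeff (∑ᴾ f) l ≡ ∑ (λ j → coeff (f j) l)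
coeff-∑ᴾ {zero}  f l = refl
coeff-∑ᴾ {suc k} f l = trans (P.coeff-+ (f zero) (∑ᴾ (tail f)) l)
    (cong (λ z → coeff (f zero) l + z) (coeff-∑ᴾ (tail f) l))

coeffs : Vector ℤ[x] n → ℕ → Vector ℤ n
coeffs v l i = coeff (v i) l

multiply : Matrix ℤ[x] n m → m ⇒ᴾ n
multiply {n} {m} M = linearMapᴾ (λ v i → ∑ᴾ λ j → M i j P.* v j)
  (λ {v} {w} e i → ∑ᴾ-cong {m} (λ j → *ᴾ-congˡ (M i j) (e j)))
  (λ v w i → ≈-trans (∑ᴾ-cong {m} (λ j → P.*-distribˡ (M i j) (v j) (w j)))
      (∑ᴾ-+ (λ j → M i j P.* v j) (λ j → M i j P.* w j)))
  (λ a v i → ≈-trans (∑ᴾ-cong {m} (λ j → exchange (M i j) a (v j))) (≈-sym (*ᴾ-∑ᴾ a (λ j → M i j P.* v j))))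
  where
  exchange : ∀ m a v → m P.* (a P.* v) ≈ a P.* (m P.* v)
  exchange = solve-∀-in ℤ[x]-almostCommutativeRing

extend : m ⇒ᶻ n → m ⇒ᴾ n
extend f = multiply λ i j → const (⟦ f ⟧ (basis ℤ-ring j) i)

-- The matrix entries are constants, so the powers of `x` do not mix; bijectivity over the integers
-- thereby passes to `extend`.
coeff-extend : (f : m ⇒ᶻ n) (v : Vector ℤ[x] m) → ∀ l → coeffs (⟦ extend f ⟧ v) l ≗ ⟦ f ⟧ (coeffs v l)
coeff-extend f v l i = trans (coeff-∑ᴾ (λ j → const (⟦ f ⟧ (basis ℤ-ring j) i) P.* v j) l)
  (trans (∑-cong λ j → trans (coeff-≡ (const-* (⟦ f ⟧ (basis ℤ-ring j) i) (v j)) l)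
      (trans (P.coeff-· (⟦ f ⟧ (basis ℤ-ring j) i) (v j) l) (ℤ.*-comm (⟦ f ⟧ (basis ℤ-ring j) i)
          (coeff (v j) l))))
    (sym (⟦⟧-expand ℤ-ring f (coeffs v l) i)))

extend-IsBijective : {f : m ⇒ᶻ n} → IsBijective f → IsBijective (extend f)
extend-IsBijective {f = f} bij = record
  { injective = λ {v} {w} e i → mk≈ λ l → F.injective (λ j →
      trans (sym (coeff-extend f v l j)) (trans (coeff-≡ (e j) l) (coeff-extend f w l j))) i
  ; section   = ⟦ extend F.inverse ⟧
  ; inverseʳ  = λ u i → mk≈ λ l → trans (coeff-extend f (⟦ extend F.inverse ⟧ u) l i)
      (trans (⟦⟧-cong f (coeff-extend F.inverse u l) i) (F.inverseʳ (coeffs u l) i))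
  }
  where module F = IsBijective bij

open SmithNormalForm ℤ[x]-commutativeRing using (_≈ₘ_; _+ₘ_; _*ₘ_; scalarₘ; Iₘ; Invertible) renaming
    (HasSmithNormalForm to HasSNF)

matrixOf-∘ : ∀ {l m n} (F : m ⇒ᴾ n) (G : l ⇒ᴾ m) →
  matrixOf ℤ[x]-ring (F ∘ₗ G) ≈ₘ (matrixOf ℤ[x]-ring F *ₘ matrixOf ℤ[x]-ring G)
matrixOf-∘ {m = m} F G i k = ≈-trans (⟦⟧-expand ℤ[x]-ring F (⟦ G ⟧ (basis ℤ[x]-ring k)) i)
  (∑ᴾ-cong {m} (λ j → P.*-comm (⟦ G ⟧ (basis ℤ[x]-ring k) j) (⟦ F ⟧ (basis ℤ[x]-ring j) i)))

matrixOf-multiply : (M : Matrix ℤ[x] n m) → matrixOf ℤ[x]-ring (multiply M) ≈ₘ M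
matrixOf-multiply M i j = sum-basis′
  where
  sum-basis′ : ∑ᴾ (λ l → M i l P.* basis ℤ[x]-ring j l) ≈ M i j
  sum-basis′ = ≈-trans (∑ᴾ-cong (λ l → *ᴾ-congˡ (M i l) (basis-sym j l))) (sum-basis ℤ[x]-ring (M i) j)
    where
    basis-sym : ∀ {n} (j l : Fin n) → basis ℤ[x]-ring j l ≈ basis ℤ[x]-ring l j
    basis-sym j l with l Fin.≟ j | j Fin.≟ l
    ... | yes _   | yes _   = ≈-refl
    ... | no  _   | no  _   = ≈-refl
    ... | yes l≡j | no  j≢l = contradiction (sym l≡j) j≢l
    ... | no  l≢j | yes j≡l = contradiction (sym j≡l) l≢j

IsBijective⇒Invertible : {F : n ⇒ᴾ n} (bij : IsBijective F) →
  Invertible (matrixOf ℤ[x]-ring F) × Invertible (matrixOf ℤ[x]-ring (IsBijective.inverse bij))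
IsBijective⇒Invertible {F = F} bij = (mat F⁻¹ , FF⁻¹ , F⁻¹F) , (mat F , F⁻¹F , FF⁻¹)
  where
  open IsBijective bij renaming (inverse to F⁻¹)
  mat = matrixOf ℤ[x]-ring
  FF⁻¹ : (mat F *ₘ mat F⁻¹) ≈ₘ Iₘ
  FF⁻¹ i j = ≈-trans (≈-sym (matrixOf-∘ F F⁻¹ i j)) (inverseʳ (basis ℤ[x]-ring j) i)
  F⁻¹F : (mat F⁻¹ *ₘ mat F) ≈ₘ Iₘ
  F⁻¹F i j = ≈-trans (≈-sym (matrixOf-∘ F⁻¹ F i j)) (inverseˡ (basis ℤ[x]-ring j) i)

diagonalise : (A : Matrix ℤ[x] n n) (S T : n ⇒ᴾ n) → IsBijective S → IsBijective T → (σ : Vector ℤ[x] n) →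
  (∀ u i → ⟦ multiply A ⟧ (⟦ S ⟧ u) i ≈ ⟦ T ⟧ (λ j → σ j P.* u j) i) →
  (∀ i j → i Fin.≤ j → σ i ∣ᴾ σ j) → HasSNF A
diagonalise {n} A S T S-bij T-bij σ AS≈TΔ σ-chain =
  mat T⁻¹ , mat S , proj₂ (IsBijective⇒Invertible T-bij) , proj₁ (IsBijective⇒Invertible S-bij) , record
    { diagonal = λ i j i≢j → ≈-trans (entry i j) (off-diagonal i j (i≢j ∘ cong toℕ))
    ; chain    = λ i j i′ j′ i≡j i′≡j′ i≤i′ →
        ∣ᴾ-respʳ (≈-sym (on-diagonal i′ j′ (Fin.toℕ-injective i′≡j′)))
          (∣ᴾ-respˡ (≈-sym (on-diagonal i j (Fin.toℕ-injective i≡j))) (σ-chain i i′ i≤i′))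
    }
  where
  open IsBijective T-bij using (inverseˡ) renaming (inverse to T⁻¹)
  mat = matrixOf ℤ[x]-ring

  *ₘ-congˡ : ∀ {l m n} {M M′ : Matrix ℤ[x] l m} (N : Matrix ℤ[x] m n) → M ≈ₘ M′ → (M *ₘ N) ≈ₘ (M′ *ₘ N)
  *ₘ-congˡ {m = m} N e i k = ∑ᴾ-cong {m} (λ j → P.*-congʳ (e i j) (N j k))

  *ₘ-congʳ : ∀ {l m n} (M : Matrix ℤ[x] l m) {N N′ : Matrix ℤ[x] m n} → N ≈ₘ N′ → (M *ₘ N) ≈ₘ (M *ₘ N′)
  *ₘ-congʳ {m = m} M e i k = ∑ᴾ-cong {m} (λ j → *ᴾ-congˡ (M i j) (e j k))

  entry : ∀ i j → (mat T⁻¹ *ₘ A *ₘ mat S) i j ≈ σ i P.* basis ℤ[x]-ring j i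
  entry i j = ≈-trans (*ₘ-congˡ (mat S) (λ i j → ≈-trans (*ₘ-congʳ (mat T⁻¹)
      (λ i j → ≈-sym (matrixOf-multiply A i j)) i j)
      (≈-sym (matrixOf-∘ T⁻¹ (multiply A) i j))) i j)
    (≈-trans (≈-sym (matrixOf-∘ (T⁻¹ ∘ₗ multiply A) S i j))
      (≈-trans (⟦⟧-cong T⁻¹ (AS≈TΔ (basis ℤ[x]-ring j)) i) (inverseˡ (λ l → σ l P.* basis ℤ[x]-ring j l) i)))

  off-diagonal : ∀ i j → ¬ i ≡ j → σ i P.* basis ℤ[x]-ring j i ≈ []
  off-diagonal i j i≢j with i Fin.≟ j
  ... | yes i≡j = contradiction i≡j i≢j
  ... | no  _   = P.*-zeroʳ (σ i)

  on-diagonal : ∀ i j → i ≡ j → (mat T⁻¹ *ₘ A *ₘ mat S) i j ≈ σ i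
  on-diagonal i j refl = ≈-trans (entry i i) unit
    where
    unit : σ i P.* basis ℤ[x]-ring i i ≈ σ i
    unit with i Fin.≟ i
    ... | yes _   = P.*-identityʳ (σ i)
    ... | no  i≢i = contradiction refl i≢i

-- Positions of the coordinates of a sum of blocks of sizes 1 + e i; the first
-- coordinates of the blocks come last, in order.

record Blocks {k} (e : Fin k → ℕ) (n : ℕ) : Set where
  field
    pos       : ∀ i → Fin (suc (e i)) → Fin n
    unpos     : Fin n → Σ (Fin k) (Fin ∘ suc ∘ e)
    pos-unpos : ∀ x → uncurry pos (unpos x) ≡ x
    unpos-pos : ∀ i j → unpos (pos i j) ≡ (i , j)
    first-last : ∀ i i′ j → pos i′ (suc j) Fin.< pos i zero
    first-mono : ∀ i i′ → pos i zero Fin.≤ pos i′ zero → i Fin.≤ i′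

  module _ {a} {A : Set a} where
    unflatten : Vector A n → ∀ i → Vector A (suc (e i))
    unflatten v i j = v (pos i j)

    flatten : (∀ i → Vector A (suc (e i))) → Vector A n
    flatten w x = uncurry w (unpos x)

    unflatten-flatten : ∀ w i j → unflatten (flatten w) i j ≡ w i j
    unflatten-flatten w i j = cong (uncurry w) (unpos-pos i j)

    flatten-unflatten : ∀ v x → flatten (unflatten v) x ≡ v x
    flatten-unflatten v x = cong v (pos-unpos x)

total : (Fin k → ℕ) → ℕ
total {zero}  e = 0
total {suc k} e = e zero ℕ.+ total (e ∘ suc)

flat : (e : Fin k → ℕ) → ∀ i → Fin (e i) → Fin (total e)
flat {suc k} e zero    j = j Fin.↑ˡ total (e ∘ suc)
flat {suc k} e (suc i) j = e zero Fin.↑ʳ flat (e ∘ suc) i j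

unflat : (e : Fin k → ℕ) → Fin (total e) → Σ (Fin k) (Fin ∘ e)
unflat {suc k} e x = [ (zero ,_) , (λ y → let i , j = unflat (e ∘ suc) y in suc i , j) ]′
    (Fin.splitAt (e zero) x)

unflat-flat : (e : Fin k → ℕ) → ∀ i j → unflat e (flat e i j) ≡ (i , j)
unflat-flat {suc k} e zero    j = cong [ (zero ,_) , _ ]′ (Fin.splitAt-↑ˡ (e zero) j (total (e ∘ suc)))
unflat-flat {suc k} e (suc i) j = trans (cong [ (zero ,_) , _ ]′
    (Fin.splitAt-↑ʳ (e zero) _ (flat (e ∘ suc) i j)))
  (cong (λ (i , j) → suc i , j) (unflat-flat (e ∘ suc) i j))

flat-unflat : (e : Fin k → ℕ) → ∀ x → uncurry (flat e) (unflat e x) ≡ x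
flat-unflat {suc k} e x = trans (split (Fin.splitAt (e zero) x)) (Fin.join-splitAt (e zero) _ x)
  where
  split : ∀ s → uncurry (flat e) ([ (zero ,_) , (λ y → let i , j = unflat (e ∘ suc) y in suc i , j) ]′ s)
    ≡ Fin.join (e zero) _ s
  split (inj₁ j) = refl
  split (inj₂ y) = cong (e zero Fin.↑ʳ_) (flat-unflat (e ∘ suc) y)

blocks : (e : Fin k → ℕ) → Blocks e (total e ℕ.+ k)
blocks {k} e = record
  { pos        = pos
  ; unpos      = unpos ∘ Fin.splitAt E
  ; pos-unpos  = λ x → trans (pos-unpos (Fin.splitAt E x)) (Fin.join-splitAt E k x)
  ; unpos-pos  = λ { i zero    → cong unpos (Fin.splitAt-↑ʳ E k i)
                   ; i (suc j) → trans (cong unpos (Fin.splitAt-↑ˡ E (flat e i j) k))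
                       (cong (λ (i , j) → i , suc j) (unflat-flat e i j)) }
  ; first-last = λ i i′ j → subst₂ ℕ._<_ (sym (Fin.toℕ-↑ˡ (flat e i′ j) k)) (sym (Fin.toℕ-↑ʳ E i))
      (ℕ.<-≤-trans (Fin.toℕ<n (flat e i′ j)) (ℕ.m≤m+n E (toℕ i)))
  ; first-mono = λ i i′ le → ℕ.+-cancelˡ-≤ E _ _ (subst₂ ℕ._≤_ (Fin.toℕ-↑ʳ E i) (Fin.toℕ-↑ʳ E i′) le)
  }
  where
  E = total e
  pos : ∀ i → Fin (suc (e i)) → Fin (E ℕ.+ k)
  pos i zero    = E Fin.↑ʳ i
  pos i (suc j) = flat e i j Fin.↑ˡ k
  unpos : Fin E ⊎ Fin k → Σ (Fin k) (Fin ∘ suc ∘ e)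
  unpos (inj₁ x) = let i , j = unflat e x in i , suc j
  unpos (inj₂ i) = i , zero
  pos-unpos : ∀ s → uncurry pos (unpos s) ≡ Fin.join E k s
  pos-unpos (inj₁ x) = cong (Fin._↑ˡ k) (flat-unflat e x)
  pos-unpos (inj₂ i) = refl

-- Within a block the source coordinates v are rotated, v₀ being the leading
-- coefficient, so that both source and target single out coordinate 0.

module _ {a} {A : Set a} where
  rot unrot : ∀ {e} → Vector A (suc e) → Vector A (suc e)
  rot {zero}  v = v
  rot {suc e} v = v (suc zero) ◁ rot (v zero ◁ tail (tail v))
  unrot {zero}  v = v
  unrot {suc e} v = unrot (tail v) zero ◁ v zero ◁ tail (unrot (tail v))

  rot-cong : ∀ {e} {v w : Vector A (suc e)} → v ≗ w → rot v ≗ rot w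
  rot-cong {zero}  v≗w = v≗w
  rot-cong {suc e} v≗w zero    = v≗w (suc zero)
  rot-cong {suc e} v≗w (suc j) = rot-cong (λ { zero → v≗w zero ; (suc j) → v≗w (suc (suc j)) }) j

  rot-unrot : ∀ {e} (v : Vector A (suc e)) → rot (unrot v) ≗ v
  rot-unrot {zero}  v j = refl
  rot-unrot {suc e} v zero    = refl
  rot-unrot {suc e} v (suc j) = trans (rot-cong (λ { zero → refl ; (suc j) → refl }) j) (rot-unrot (tail v) j)

  unrot-cong : ∀ {e} {v w : Vector A (suc e)} → v ≗ w → unrot v ≗ unrot w
  unrot-cong {zero}  v≗w = v≗w
  unrot-cong {suc e} v≗w zero          = unrot-cong (v≗w ∘ suc) zero
  unrot-cong {suc e} v≗w (suc zero)    = v≗w zero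
  unrot-cong {suc e} v≗w (suc (suc j)) = unrot-cong (v≗w ∘ suc) (suc j)

  unrot-rot : ∀ {e} (v : Vector A (suc e)) → unrot (rot v) ≗ v
  unrot-rot {zero}  v j = refl
  unrot-rot {suc e} v zero          = unrot-rot (v zero ◁ tail (tail v)) zero
  unrot-rot {suc e} v (suc zero)    = refl
  unrot-rot {suc e} v (suc (suc j)) = unrot-rot (v zero ◁ tail (tail v)) (suc j)

rot-+ : ∀ {e} (v w : Vector ℤ (suc e)) → rot (v +ᴹ w) ≗ rot v +ᴹ rot w
rot-+ {zero}  v w j = refl
rot-+ {suc e} v w zero    = refl
rot-+ {suc e} v w (suc j) = trans (rot-cong (λ { zero → refl ; (suc j) → refl }) j)
  (rot-+ (v zero ◁ tail (tail v)) (w zero ◁ tail (tail w)) j)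

rot-*ₗ : ∀ {e} c (v : Vector ℤ (suc e)) → rot (c *ₗ v) ≗ c *ₗ rot v
rot-*ₗ {zero}  c v j = refl
rot-*ₗ {suc e} c v zero    = refl
rot-*ₗ {suc e} c v (suc j) = trans (rot-cong (λ { zero → refl ; (suc j) → refl }) j)
    (rot-*ₗ c (v zero ◁ tail (tail v)) j)

-- Division by a monic polynomial and companion blocks

polyOf : Vector ℤ n → ℤ[x]
polyOf = tabulate

coeff-polyOf : (v : Vector ℤ n) (i : Fin n) → coeff (polyOf v) (toℕ i) ≡ v i
coeff-polyOf v zero    = refl
coeff-polyOf v (suc i) = coeff-polyOf (tail v) i

coeff-polyOf-≥ : (v : Vector ℤ n) → ∀ l → n ℕ.≤ l → coeff (polyOf v) l ≡ 0ℤ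
coeff-polyOf-≥ {zero}  v l       _         = refl
coeff-polyOf-≥ {suc n} v (suc l) (ℕ.s≤s p) = coeff-polyOf-≥ (tail v) l p

polyOf-cong : {v w : Vector ℤ n} → v ≗ w → polyOf v ≈ polyOf w
polyOf-cong {zero}  e = ≈-refl
polyOf-cong {suc n} e = P.∷-cong (e zero) (polyOf-cong (e ∘ suc))

polyOf-+ : (v w : Vector ℤ n) → polyOf (v +ᴹ w) ≈ polyOf v P.+ polyOf w
polyOf-+ {zero}  v w = ≈-refl
polyOf-+ {suc n} v w = P.∷-cong refl (polyOf-+ (tail v) (tail w))

polyOf-· : (c : ℤ) (v : Vector ℤ n) → polyOf (c *ₗ v) ≈ c P.· polyOf v
polyOf-· {zero}  c v = ≈-refl
polyOf-· {suc n} c v = P.∷-cong refl (polyOf-· c (tail v))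

-- Multiplication by x modulo a, with u added to the constant coefficient.
companion : ∀ {e} → ℤ → ℤ[x] → Vector ℤ (suc e) → Vector ℤ (suc e)
companion {zero}  u a v = λ _ → u + - coeff a 0 * v zero
companion {suc e} u a v = (u + - coeff a 0 * v zero) ◁ companion (v (suc zero)) (tailᴾ a)
    (v zero ◁ tail (tail v))

-- In `rot v` the leading coefficient `v zero` stands last. Multiplication by `x` overflows the
-- degree by one, and subtracting `v zero` times the monic `a` removes the overflow. A general `u`
-- makes the recursion along `a` possible.
x·-polyOf-rot : ∀ {e} u a (v : Vector ℤ (suc e)) → MonicOfDegree (suc e) a →
  (u ∷ polyOf (rot v)) ≈ polyOf (companion u a v) P.+ v zero P.· a
x·-polyOf-rot {zero} u a v (lead , above) = mk≈ λ l → sym (trans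
    (P.coeff-+ (const (u + - coeff a 0 * v zero)) (v zero P.· a) l)
  (trans (cong (λ z → coeff (const (u + - coeff a 0 * v zero)) l + z) (P.coeff-· (v zero) a l)) (at l)))
  where
  at : ∀ l → coeff (const (u + - coeff a 0 * v zero)) l + v zero * coeff a l ≡ coeff (u ∷ v zero ∷ []) l
  at zero = lemma u (coeff a 0) (v zero)
    where
    lemma : ∀ u a v → u + - a * v + v * a ≡ u
    lemma = solve-∀
  at (suc zero) = trans (ℤ.+-identityˡ _) (trans (cong (v zero *_) lead) (ℤ.*-identityʳ (v zero)))
  at (suc (suc l)) = trans (ℤ.+-identityˡ _) (trans (cong (v zero *_)
      (above (suc (suc l)) (ℕ.s≤s (ℕ.s≤s ℕ.z≤n)))) (ℤ.*-zeroʳ (v zero)))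
x·-polyOf-rot {suc e} u a v monic = begin
  u ∷ v (suc zero) ∷ polyOf (rot v′)
    ≈⟨ P.∷-cong (lemma u (coeff a 0) (v zero)) (x·-polyOf-rot (v (suc zero)) (tailᴾ a) v′
        (monic-tail {a = a} monic)) ⟩
  polyOf (companion u a v) P.+ v zero P.· (coeff a 0 ∷ tailᴾ a)
    ≈⟨ P.+-congˡ {polyOf (companion u a v)} (P.·-cong {v zero} refl (≈-sym (head∷tail a))) ⟩
  polyOf (companion u a v) P.+ v zero P.· a ∎
  where
  open ≈ᴾ-Reasoning
  v′ = v zero ◁ tail (tail v)
  lemma : ∀ u a v → u ≡ u + - a * v + v * a
  lemma = solve-∀

-- Horner's manner: from a remainder `ρ` of `f`, one companion step leads to a remainder of
-- `c + x f`.
remainder : ∀ {e a} → MonicOfDegree (suc e) a → ∀ f → ∃ λ (ρ : Vector ℤ (suc e)) → a ∣ᴾ (f P.+ P.- polyOf ρ)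
remainder {e} {a} monic [] = 0ᴹ , [] , mk≈ λ l → sym (trans (P.coeff-neg (polyOf {suc e} 0ᴹ) l)
    (cong -_ (coeff-0 {suc e} l)))
  where
  coeff-0 : ∀ {n} l → coeff (polyOf {n} 0ᴹ) l ≡ 0ℤ
  coeff-0 {zero}  l       = refl
  coeff-0 {suc n} zero    = refl
  coeff-0 {suc n} (suc l) = coeff-0 {n} l
remainder {e} {a} monic (c ∷ f) with ρ , q , qa≈ ← remainder {a = a} monic f =
  companion c a (unrot ρ) , (x· q P.+ const t) , (begin
    (x· q P.+ const t) P.* a
      ≈⟨ P.*-distribʳ a (x· q) (const t) ⟩
    x· q P.* a P.+ const t P.* a
      ≈⟨ P.+-cong (P.0∷-* q a) (const-* t a) ⟩
    x· (q P.* a) P.+ t P.· a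
      ≈⟨ P.+-congʳ {g = t P.· a} (P.∷-cong (sym (ℤ.+-inverseʳ c)) qa≈) ⟩
    ((c ∷ f) P.+ P.- (c ∷ polyOf ρ)) P.+ t P.· a
      ≈⟨ P.+-congʳ {g = t P.· a} (P.+-congˡ {c ∷ f} (P.-‿cong (≈-trans
          (P.∷-cong refl (polyOf-cong (λ i → sym (rot-unrot ρ i))))
           (x·-polyOf-rot c a (unrot ρ) monic)))) ⟩
    ((c ∷ f) P.+ P.- (R P.+ t P.· a)) P.+ t P.· a
      ≈⟨ collapse (c ∷ f) R (t P.· a) ⟩
    (c ∷ f) P.+ P.- R ∎)
  where
  open ≈ᴾ-Reasoning
  t = unrot ρ zero
  R = polyOf (companion c a (unrot ρ))
  collapse : ∀ f r a → (f P.+ P.- (r P.+ a)) P.+ a ≈ f P.+ P.- r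
  collapse = solve-∀-in ℤ[x]-almostCommutativeRing

-- As a matrix, `unhorner` has ones on the diagonal and `X` just above it; `horner` is the inverse
-- matrix.
unhorner horner : ∀ {e} → Vector ℤ[x] (suc e) → Vector ℤ[x] (suc e)
unhorner {zero}  y = y
unhorner {suc e} y = (y zero P.+ X P.* y (suc zero)) ◁ unhorner (tail y)
horner {zero}  w = w
horner {suc e} w = (w zero P.+ P.- (X P.* horner (tail w) zero)) ◁ horner (tail w)

unhorner-cong : ∀ {e} {v w : Vector ℤ[x] (suc e)} → (∀ j → v j ≈ w j) → ∀ j → unhorner v j ≈ unhorner w j
unhorner-cong {zero}  v≈w = v≈w
unhorner-cong {suc e} v≈w zero    = P.+-cong (v≈w zero) (*ᴾ-congˡ X (v≈w (suc zero)))
unhorner-cong {suc e} v≈w (suc j) = unhorner-cong (v≈w ∘ suc) j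

horner-cong : ∀ {e} {v w : Vector ℤ[x] (suc e)} → (∀ j → v j ≈ w j) → ∀ j → horner v j ≈ horner w j
horner-cong {zero}  v≈w = v≈w
horner-cong {suc e} v≈w zero    = P.+-cong (v≈w zero) (P.-‿cong (*ᴾ-congˡ X (horner-cong (v≈w ∘ suc) zero)))
horner-cong {suc e} v≈w (suc j) = horner-cong (v≈w ∘ suc) j

unhorner-+ : ∀ {e} (v w : Vector ℤ[x] (suc e)) j → unhorner (λ j → v j P.+ w j) j
    ≈ unhorner v j P.+ unhorner w j
unhorner-+ {zero}  v w j = ≈-refl
unhorner-+ {suc e} v w zero    = expand (v zero) (w zero) X (v (suc zero)) (w (suc zero))
  where
  expand : ∀ v w x v′ w′ → (v P.+ w) P.+ x P.* (v′ P.+ w′) ≈ (v P.+ x P.* v′) P.+ (w P.+ x P.* w′)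
  expand = solve-∀-in ℤ[x]-almostCommutativeRing
unhorner-+ {suc e} v w (suc j) = unhorner-+ (tail v) (tail w) j

unhorner-* : ∀ {e} c (v : Vector ℤ[x] (suc e)) j → unhorner (λ j → c P.* v j) j ≈ c P.* unhorner v j
unhorner-* {zero}  c v j = ≈-refl
unhorner-* {suc e} c v zero    = expand c (v zero) X (v (suc zero))
  where
  expand : ∀ c v x v′ → c P.* v P.+ x P.* (c P.* v′) ≈ c P.* (v P.+ x P.* v′)
  expand = solve-∀-in ℤ[x]-almostCommutativeRing
unhorner-* {suc e} c v (suc j) = unhorner-* c (tail v) j

horner-unhorner : ∀ {e} (y : Vector ℤ[x] (suc e)) j → horner (unhorner y) j ≈ y j
horner-unhorner {zero}  y j = ≈-refl
horner-unhorner {suc e} y zero    = ≈-trans (P.+-congˡ {y zero P.+ X P.* y (suc zero)}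
  (P.-‿cong (*ᴾ-congˡ X (horner-unhorner (tail y) zero)))) (cancel (y zero) (X P.* y (suc zero)))
  where
  cancel : ∀ a b → (a P.+ b) P.+ P.- b ≈ a
  cancel = solve-∀-in ℤ[x]-almostCommutativeRing
horner-unhorner {suc e} y (suc j) = horner-unhorner (tail y) j

unhorner-horner : ∀ {e} (w : Vector ℤ[x] (suc e)) j → unhorner (horner w) j ≈ w j
unhorner-horner {zero}  w j = ≈-refl
unhorner-horner {suc e} w zero    = cancel (w zero) (X P.* horner (tail w) zero)
  where
  cancel : ∀ a b → (a P.+ P.- b) P.+ b ≈ a
  cancel = solve-∀-in ℤ[x]-almostCommutativeRing
unhorner-horner {suc e} w (suc j) = unhorner-horner (tail w) j

-- The first column of a companion block of `[φ] + x I`, in rotated source coordinates, after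
-- applying `horner`.
pivots : ∀ {e} → ℤ[x] → Vector ℤ[x] (suc e)
pivots {zero}  a = λ _ → const (- coeff a 0) P.+ X
pivots {suc e} a = (const (- coeff a 0) P.+ P.- (X P.* pivots {e} (tailᴾ a) zero)) ◁ pivots (tailᴾ a)

-- The companion block plus `X` times `rot`: in rotated source coordinates, adding `x I` adds `X`
-- times the rotation. As in `companion`, `u` is what the previous coordinate hands over.
pencil : ∀ {e} → ℤ[x] → ℤ[x] → Vector ℤ[x] (suc e) → Vector ℤ[x] (suc e)
pencil {zero}  u a v = λ _ → u P.+ (const (- coeff a 0) P.* v zero P.+ X P.* v zero)
pencil {suc e} u a v = (u P.+ (const (- coeff a 0) P.* v zero P.+ X P.* v (suc zero))) ◁
  pencil (v (suc zero)) (tailᴾ a) (v zero ◁ tail (tail v))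

coeffs-pencil : ∀ {e} u a (v : Vector ℤ[x] (suc e)) → 
  coeffs (pencil u a v) 0 ≗ companion (coeff u 0) a (coeffs v 0) ×
  (∀ l → coeffs (pencil u a v) (suc l) ≗ companion (coeff u (suc l)) a (coeffs v (suc l)) +ᴹ rot (coeffs v l))
coeffs-pencil {e} u a v = constant u a v , higher u a v
  where
  coeff₀ : ∀ u c p q → coeff (u P.+ (const c P.* p P.+ X P.* q)) 0 ≡ coeff u 0 + c * coeff p 0
  coeff₀ u c p q = trans (P.coeff-+ u (const c P.* p P.+ X P.* q) 0) (cong (λ z → coeff u 0 + z)
    (trans (P.coeff-+ (const c P.* p) (X P.* q) 0) (trans (cong₂ _+_ (coeff-*-0 (const c) p)
      (trans (coeff-*-0 X q) (ℤ.*-zeroˡ (coeff q 0)))) (ℤ.+-identityʳ _))))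
  coeff₊ : ∀ u c p q l → coeff (u P.+ (const c P.* p P.+ X P.* q)) (suc l) ≡
      (coeff u (suc l) + c * coeff p (suc l)) + coeff q l
  coeff₊ u c p q l = trans (P.coeff-+ u (const c P.* p P.+ X P.* q) (suc l))
      (trans (cong (λ z → coeff u (suc l) + z)
    (trans (P.coeff-+ (const c P.* p) (X P.* q) (suc l)) (cong₂ _+_
        (trans (coeff-≡ (const-* c p) (suc l)) (P.coeff-· c p (suc l)))
      (coeff-≡ (X-* q) (suc l))))) (sym (ℤ.+-assoc (coeff u (suc l)) _ _)))
  companion-cong : ∀ {e} u a {v w : Vector ℤ (suc e)} → v ≗ w → companion u a v ≗ companion u a w
  companion-cong {zero}  u a v≗w j = cong (λ z → u + - coeff a 0 * z) (v≗w zero)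
  companion-cong {suc e} u a v≗w zero = cong (λ z → u + - coeff a 0 * z) (v≗w zero)
  companion-cong {suc e} u a {v} {w} v≗w (suc j) = trans (cong
      (λ z → companion z (tailᴾ a) (v zero ◁ tail (tail v)) j) (v≗w (suc zero)))
    (companion-cong (w (suc zero)) (tailᴾ a) (λ { zero → v≗w zero ; (suc j) → v≗w (suc (suc j)) }) j)
  shape : ∀ {e} (v : Vector ℤ[x] (suc (suc e))) l → coeffs (v zero ◁ tail (tail v)) l ≗
      (coeffs v l zero ◁ tail (tail (coeffs v l)))
  shape v l zero    = refl
  shape v l (suc j) = refl
  constant : ∀ {e} u a (v : Vector ℤ[x] (suc e)) → coeffs (pencil u a v) 0 ≗ companion (coeff u 0) a
      (coeffs v 0)
  constant {zero}  u a v zero = coeff₀ u (- coeff a 0) (v zero) (v zero)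
  constant {suc e} u a v zero = coeff₀ u (- coeff a 0) (v zero) (v (suc zero))
  constant {suc e} u a v (suc j) = trans (constant (v (suc zero)) (tailᴾ a) (v zero ◁ tail (tail v)) j)
    (companion-cong (coeff (v (suc zero)) 0) (tailᴾ a) (shape v 0) j)
  higher : ∀ {e} u a (v : Vector ℤ[x] (suc e)) l →
    coeffs (pencil u a v) (suc l) ≗ companion (coeff u (suc l)) a (coeffs v (suc l)) +ᴹ rot (coeffs v l)
  higher {zero}  u a v l zero = coeff₊ u (- coeff a 0) (v zero) (v zero) l
  higher {suc e} u a v l zero = coeff₊ u (- coeff a 0) (v zero) (v (suc zero)) l
  higher {suc e} u a v l (suc j) = trans (higher (v (suc zero)) (tailᴾ a) (v zero ◁ tail (tail v)) l j)
    (cong₂ _+_ (companion-cong (coeff (v (suc zero)) (suc l)) (tailᴾ a) (shape v (suc l)) j)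
        (rot-cong (shape v l) j))

-- For `u = []` this factors the block into `unhorner` and a matrix that differs from the identity
-- only in its first column, `pivots`. A column shear then leaves the top pivot and ones.
pencil-unhorner : ∀ {e} u a (v : Vector ℤ[x] (suc e)) j →
  pencil u a v j ≈ unhorner (λ j → (u ◁ tail v) j P.+ pivots {e} a j P.* v zero) j
pencil-unhorner {zero}  u a v zero = expand u (const (- coeff a 0)) X (v zero)
  where
  expand : ∀ u c x v → u P.+ (c P.* v P.+ x P.* v) ≈ u P.+ (c P.+ x) P.* v
  expand = solve-∀-in ℤ[x]-almostCommutativeRing
pencil-unhorner {suc e} u a v zero = expand u (const (- coeff a 0)) X (v zero) (v (suc zero))
    (pivots {e} (tailᴾ a) zero)
  where
  expand : ∀ u c x v v′ p → u P.+ (c P.* v P.+ x P.* v′) ≈ (u P.+ (c P.+ P.- (x P.* p)) P.* v) P.+ x P.*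
      (v′ P.+ p P.* v)
  expand = solve-∀-in ℤ[x]-almostCommutativeRing
pencil-unhorner {suc e} u a v (suc j) = ≈-trans (pencil-unhorner (v (suc zero)) (tailᴾ a)
    (v zero ◁ tail (tail v)) j)
  (unhorner-cong (λ { zero → ≈-refl ; (suc j) → ≈-refl }) j)

-- The recursion of `pivots` is Horner's scheme at `- x` with an overall sign; `- x` appears because
-- the pencil is `[φ] + x I` and not `x I - [φ]`.
pivot≈comp : ∀ {e} a → MonicOfDegree (suc e) a → pivots {e} a zero ≈ P.- comp (P.- X) a
pivot≈comp {e} a monic = ≈-trans (lemma {e} monic) (P.-‿cong (comp-cong (P.- X) (coeff a 0 ∷ tailᴾ a) a
    (≈-sym (head∷tail a))))
  where
  expand : ∀ c x p → P.- c P.+ P.- (x P.* P.- p) ≈ P.- (c P.+ P.- x P.* p)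
  expand = solve-∀-in ℤ[x]-almostCommutativeRing
  expand₀ : ∀ c x p → P.- c P.+ x P.* p ≈ P.- (c P.+ P.- x P.* p)
  expand₀ = solve-∀-in ℤ[x]-almostCommutativeRing
  monic⇒1 : ∀ {b} → MonicOfDegree 0 b → b ≈ P.1ᴾ
  monic⇒1 (lead , above) = mk≈ λ { zero → lead ; (suc i) → above (suc i) (ℕ.s≤s ℕ.z≤n) }
  lemma : ∀ {e} → MonicOfDegree (suc e) a → pivots {e} a zero ≈ P.- comp (P.- X) (coeff a 0 ∷ tailᴾ a)
  lemma {zero} monic = ≈-trans (P.+-congˡ {const (- coeff a 0)}
      (≈-trans (≈-sym (P.*-identityʳ X)) (*ᴾ-congˡ X (≈-sym
    (≈-trans (comp-cong (P.- X) (tailᴾ a) P.1ᴾ (monic⇒1 (monic-tail {a = a} monic)))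
        (comp-const (P.- X) 1ℤ))))))
    (expand₀ (const (coeff a 0)) X (comp (P.- X) (tailᴾ a)))
  lemma {suc e} monic = ≈-trans (P.+-congˡ {const (- coeff a 0)}
      (P.-‿cong (*ᴾ-congˡ X (pivot≈comp (tailᴾ a) (monic-tail {a = a} monic)))))
    (expand (const (coeff a 0)) X (comp (P.- X) (tailᴾ a)))

-- Block-diagonal maps and elementary bijections

module _ {r ℓr} {R : Ring r ℓr} {k} {e : Fin k → ℕ} {n} (ℬ : Blocks e n)
  (T : ∀ i → LinearMap (freeModule R (suc (e i))) (freeModule R (suc (e i)))) where
  open Blocks ℬ
  open Ring R using (reflexive) renaming (Carrier to A; trans to ≋-trans; sym to ≋-sym)

  blockMap : LinearMap (freeModule R n) (freeModule R n)
  blockMap = linearMap (freeModule R n) (freeModule R n) (λ v → flatten λ i → ⟦ T i ⟧ (unflatten v i))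
    (λ v≈w x → let i , j = unpos x in ⟦⟧-cong (T i) (λ l → v≈w (pos i l)) j)
    (λ v w x → let i , j = unpos x in +ᴹ-homo (T i) (unflatten v i) (unflatten w i) j)
    (λ a v x → let i , j = unpos x in *ₗ-homo (T i) a (unflatten v i) j)

  blockMap-IsBijective : (∀ i → IsBijective (T i)) → IsBijective blockMap
  blockMap-IsBijective bij = record
    { injective = λ {v} {w} eq x → let i , j = unpos x in
        ≋-trans (reflexive (sym (flatten-unflatten v x))) (≋-trans
          (IsBijective.injective (bij i) (λ l →
            ≋-trans (reflexive (sym (unflatten-flatten (λ i → ⟦ T i ⟧ (unflatten v i)) i l)))
              (≋-trans (eq (pos i l)) (reflexive (unflatten-flatten (λ i → ⟦ T i ⟧ (unflatten w i)) i l)))) j)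
          (reflexive (flatten-unflatten w x)))
    ; section   = section
    ; inverseʳ  = λ u x → let i , j = unpos x in
        ≋-trans (⟦⟧-cong (T i) (λ l → reflexive (unflatten-flatten
            (λ i → IsBijective.section (bij i) (unflatten u i)) i l)) j)
          (≋-trans (IsBijective.inverseʳ (bij i) (unflatten u i) j) (reflexive (flatten-unflatten u x)))
    }
    where
    section : Vector A n → Vector A n
    section u = flatten λ i → IsBijective.section (bij i) (unflatten u i)

rotₗ : ∀ e → suc e ⇒ᶻ suc e
rotₗ e = linearMapᶻ rot rot-cong rot-+ rot-*ₗ

rotₗ-IsBijective : ∀ e → IsBijective (rotₗ e)
rotₗ-IsBijective e = record
  { injective = λ {v} {w} eq j → trans (sym (unrot-rot v j)) (trans (unrot-cong eq j) (unrot-rot w j))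
  ; section   = unrot
  ; inverseʳ  = rot-unrot
  }

unhornerₗ : ∀ e → suc e ⇒ᴾ suc e
unhornerₗ e = linearMapᴾ unhorner unhorner-cong unhorner-+ unhorner-*

unhornerₗ-IsBijective : ∀ e → IsBijective (unhornerₗ e)
unhornerₗ-IsBijective e = record
  { injective = λ {v} {w} eq j → ≈-trans (≈-sym (horner-unhorner v j))
      (≈-trans (horner-cong eq j) (horner-unhorner w j))
  ; section   = horner
  ; inverseʳ  = unhorner-horner
  }

shearₗ : ∀ {e} → Vector ℤ[x] e → suc e ⇒ᴾ suc e
shearₗ c = linearMapᴾ (λ u → u zero ◁ λ j → u (suc j) P.+ c j P.* u zero)
  (λ { eq zero → eq zero ; eq (suc j) → P.+-cong (eq (suc j)) (*ᴾ-congˡ (c j) (eq zero)) })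
  (λ { v w zero → ≈-refl ; v w (suc j) → additive (v (suc j)) (w (suc j)) (c j) (v zero) (w zero) })
  (λ { a v zero → ≈-refl ; a v (suc j) → homogeneous a (v (suc j)) (c j) (v zero) })
  where
  additive : ∀ v w c v₀ w₀ → (v P.+ w) P.+ c P.* (v₀ P.+ w₀) ≈ (v P.+ c P.* v₀) P.+ (w P.+ c P.* w₀)
  additive = solve-∀-in ℤ[x]-almostCommutativeRing
  homogeneous : ∀ a v c v₀ → a P.* v P.+ c P.* (a P.* v₀) ≈ a P.* (v P.+ c P.* v₀)
  homogeneous = solve-∀-in ℤ[x]-almostCommutativeRing

shear-inverse : ∀ {e} (c : Vector ℤ[x] e) u j → ⟦ shearₗ c ⟧ (⟦ shearₗ (λ j → P.- c j) ⟧ u) j ≈ u j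
shear-inverse c u zero    = ≈-refl
shear-inverse c u (suc j) = cancel (u (suc j)) (c j) (u zero)
  where
  cancel : ∀ u c u₀ → (u P.+ P.- c P.* u₀) P.+ c P.* u₀ ≈ u
  cancel = solve-∀-in ℤ[x]-almostCommutativeRing

shear-inverse′ : ∀ {e} (c : Vector ℤ[x] e) u j → ⟦ shearₗ (λ j → P.- c j) ⟧ (⟦ shearₗ c ⟧ u) j ≈ u j
shear-inverse′ c u zero    = ≈-refl
shear-inverse′ c u (suc j) = cancel (u (suc j)) (c j) (u zero)
  where
  cancel : ∀ u c u₀ → (u P.+ c P.* u₀) P.+ P.- c P.* u₀ ≈ u
  cancel = solve-∀-in ℤ[x]-almostCommutativeRing

shearₗ-IsBijective : ∀ {e} (c : Vector ℤ[x] e) → IsBijective (shearₗ λ j → P.- c j)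
shearₗ-IsBijective c = record
  { injective = λ {v} {w} eq j → ≈-trans (≈-sym (shear-inverse c v j))
      (≈-trans (⟦⟧-cong (shearₗ c) eq j) (shear-inverse c w j))
  ; section   = ⟦ shearₗ c ⟧
  ; inverseʳ  = shear-inverse′ c
  }

-- Smith normal form from a presentation

module Smith {n} {φ : n ⇒ᶻ n} (pres : Presentation φ) where
  open Presentation pres
  open Action φ

  degree-1 : ∀ f → MonicNonconstant f → ∃ λ e → MonicOfDegree (suc e) f
  degree-1 f (suc e , _ , monic) = e , monic

  e : Fin length → ℕ
  e i = proj₁ (degree-1 (a i) (monic i))

  monicᵉ : ∀ i → MonicOfDegree (suc (e i)) (a i)
  monicᵉ i = proj₂ (degree-1 (a i) (monic i))

  module Coordinates {m} (ℬ : Blocks e m) where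
    open Blocks ℬ

    -- Coordinates on the vectors `x^j` applied to `g i` with `j ≤ e i`. Their number `m` is kept
    -- apart from `n`: the equality `size≡n` is deduced from the bijectivity of `β`.
    β : m ⇒ᶻ n
    β = linearMapᶻ (λ c → comb (λ i → polyOf (unflatten c i)) g)
      (λ {c} {c′} eq → sumᴹ-cong λ i → act-congˡ (polyOf (unflatten c i)) (polyOf (unflatten c′ i))
          (polyOf-cong (λ j → eq (pos i j))))
      (λ c c′ x → trans (sumᴹ-cong (λ i → act-congˡ (polyOf (unflatten (c +ᴹ c′) i))
          (polyOf (unflatten c i) P.+ polyOf (unflatten c′ i))
          (polyOf-+ (unflatten c i) (unflatten c′ i))) x)
        (comb-+ (λ i → polyOf (unflatten c i)) (λ i → polyOf (unflatten c′ i)) g x))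
      (λ s c x → trans (sumᴹ-cong (λ i → act-congˡ (polyOf (unflatten (s *ₗ c) i))
          (s P.· polyOf (unflatten c i)) (polyOf-· s (unflatten c i))) x)
        (comb-· s (λ i → polyOf (unflatten c i)) g x))

    β-flatten : ∀ (w : ∀ i → Vector ℤ (suc (e i))) → ⟦ β ⟧ (flatten w) ≗ comb (λ i → polyOf (w i)) g
    β-flatten w = sumᴹ-cong λ i → act-congˡ (polyOf (unflatten (flatten w) i)) (polyOf (w i))
        (polyOf-cong (unflatten-flatten w i))

    -- The polynomial of block `i` has degree below that of `a i`, so it lies in the ideal of `a i`
    -- only if it is zero.
    β-trivial : ∀ {c} → ⟦ β ⟧ c ≗ 0ᴹ → c ≗ 0ᴹ
    β-trivial {c} eq x = trans (sym (flatten-unflatten c x)) (vanish (proj₁ (unpos x)) (proj₂ (unpos x)))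
      where
      vanish : ∀ i j → unflatten c i j ≡ 0ℤ
      vanish i j = trans (sym (coeff-polyOf (unflatten c i) j))
          (ℤ.0∣⇒≡0 (reduced-mod {a = a i} {f = polyOf (unflatten c i)} (monicᵉ i)
        (coeff-polyOf-≥ (unflatten c i))
        (relations-mod 0ℤ (λ i → polyOf (unflatten c i)) (λ x → ℤ.∣-reflexive (sym (eq x))) i) (toℕ j)))

    β-IsBijective : IsBijective β
    β-IsBijective = record
      { injective = kernel-trivial⇒injective β β-trivial
      ; section   = λ v → flatten (ρ v)
      ; inverseʳ  = λ v x → trans (β-flatten (ρ v) x) (trans (sumᴹ-cong (λ i → reduce v i) x)
          (sym (proj₂ (spans v) x)))
      }
      where
      f : Vector ℤ n → Vector ℤ[x] length
      f v = proj₁ (spans v)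
      ρ : Vector ℤ n → ∀ i → Vector ℤ (suc (e i))
      ρ v i = proj₁ (remainder {a = a i} (monicᵉ i) (f v i))
      reduce : ∀ v i → act (polyOf (ρ v i)) (g i) ≗ act (f v i) (g i)
      reduce v i x = sym (trans (act-congˡ (f v i) ((f v i P.+ P.- polyOf (ρ v i)) P.+ polyOf (ρ v i))
          (restore (f v i) (polyOf (ρ v i))) x)
        (trans (act-distribʳ (g i) (f v i P.+ P.- polyOf (ρ v i)) (polyOf (ρ v i)) x)
          (trans (cong (_+ act (polyOf (ρ v i)) (g i) x) (act-∣ᴾ
              (proj₂ (remainder {a = a i} (monicᵉ i) (f v i))) (kills i) x)) (ℤ.+-identityˡ _))))
        where
        restore : ∀ f p → f ≈ (f P.+ P.- p) P.+ p
        restore = solve-∀-in ℤ[x]-almostCommutativeRing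

  size≡n : total e ℕ.+ length ≡ n
  size≡n = bijective⇒≡ (Coordinates.β-IsBijective (blocks e))

  ℬ : Blocks e n
  ℬ = subst (Blocks e) size≡n (blocks e)

  -- A variable `ℬ` keeps the transport along `size≡n` from ever being unfolded.
  module Diagonalisation (ℬ : Blocks e n) where
    open Blocks ℬ
    open Coordinates ℬ

    Rot βˢ : n ⇒ᶻ n
    Rot = blockMap ℬ (λ i → rotₗ (e i))
    βˢ = β ∘ₗ Rot

    βˢ-IsBijective : IsBijective βˢ
    βˢ-IsBijective = ∘-IsBijective β-IsBijective (blockMap-IsBijective ℬ (λ i → rotₗ (e i)) λ i
        → rotₗ-IsBijective (e i))

    φ-βˢ : ∀ c → ⟦ φ ⟧ (⟦ βˢ ⟧ c) ≗ ⟦ β ⟧ (flatten λ i → companion 0ℤ (a i) (unflatten c i))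
    φ-βˢ c x = trans (⟦⟧-cong φ (β-flatten (λ i → rot (unflatten c i))) x)
      (trans (⟦⟧-sum φ (λ i → act (polyOf (rot (unflatten c i))) (g i)) x) (trans (sumᴹ-cong step x)
        (sym (β-flatten (λ i → companion 0ℤ (a i) (unflatten c i)) x))))
      where
      step : ∀ i → ⟦ φ ⟧ (act (polyOf (rot (unflatten c i))) (g i)) ≗ act
          (polyOf (companion 0ℤ (a i) (unflatten c i))) (g i)
      step i y = trans (sym (act-x· (polyOf (rot v)) (g i) y))
        (trans (act-congˡ (x· polyOf (rot v)) (polyOf (companion 0ℤ (a i) v) P.+ v zero P.· a i)
            (x·-polyOf-rot 0ℤ (a i) v (monicᵉ i)) y)
        (trans (act-distribʳ (g i) (polyOf (companion 0ℤ (a i) v)) (v zero P.· a i) y)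
        (trans (cong (λ z → act (polyOf (companion 0ℤ (a i) v)) (g i) y + z)
          (trans (act-· (v zero) (a i) (g i) y) (trans (cong (v zero *_) (kills i y))
              (ℤ.*-zeroʳ (v zero))))) (ℤ.+-identityʳ _))))
        where v = unflatten c i

    A : Matrix ℤ[x] n n
    A = (λ i j → const (matrixOf ℤ-ring φ i j)) +ₘ scalarₘ X

    multiply-A : ∀ v x → ⟦ multiply A ⟧ v x ≈ ⟦ extend φ ⟧ v x P.+ X P.* v x
    multiply-A v x = ≈-trans (∑ᴾ-cong (λ j → P.*-distribʳ (v j) (const (matrixOf ℤ-ring φ x j))
        (scalarₘ X x j)))
      (≈-trans (∑ᴾ-+ (λ j → const (matrixOf ℤ-ring φ x j) P.* v j) (λ j → scalarₘ X x j P.* v j))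
        (P.+-congˡ {⟦ extend φ ⟧ v x} (≈-trans (∑ᴾ-cong (λ j → scalar x j))
            (≈-trans (≈-sym (*ᴾ-∑ᴾ X (λ j → v j P.* basis ℤ[x]-ring j x)))
          (*ᴾ-congˡ X (sum-basis ℤ[x]-ring v x))))))
      where
      scalar : ∀ x j → scalarₘ X x j P.* v j ≈ X P.* (v j P.* basis ℤ[x]-ring j x)
      scalar x j with x Fin.≟ j
      ... | yes _ = *ᴾ-congˡ X (≈-sym (P.*-identityʳ (v j)))
      ... | no  _ = ≈-sym (≈-trans (*ᴾ-congˡ X (P.*-zeroʳ (v j))) (P.*-zeroʳ X))

    pencils : Vector ℤ[x] n → Vector ℤ[x] n
    pencils v = flatten λ i → pencil [] (a i) (unflatten v i)

    -- Power `l` of `x` receives `φ` of coefficient `l` and, through `X`, the rotated coefficient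
    -- `l - 1`; read in the basis `β`, these are the two parts of `coeffs-pencil`.
    A-βˢ : ∀ v x → ⟦ multiply A ⟧ (⟦ extend βˢ ⟧ v) x ≈ ⟦ extend β ⟧ (pencils v) x
    A-βˢ v x = ≈-trans (multiply-A (⟦ extend βˢ ⟧ v) x) (≈-trans
        (P.+-congˡ {⟦ extend φ ⟧ (⟦ extend βˢ ⟧ v) x} (X-* (⟦ extend βˢ ⟧ v x))) (mk≈ coefficient))
      where
      companions : ℕ → Vector ℤ n
      companions l = flatten λ i → companion 0ℤ (a i) (unflatten (coeffs v l) i)
      φ-part : ∀ l → coeffs (⟦ extend φ ⟧ (⟦ extend βˢ ⟧ v)) l x ≡ ⟦ β ⟧ (companions l) x
      φ-part l = trans (coeff-extend φ (⟦ extend βˢ ⟧ v) l x) (trans (⟦⟧-cong φ (coeff-extend βˢ v l) x)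
          (φ-βˢ (coeffs v l) x))
      coefficient : ∀ l → coeff (⟦ extend φ ⟧ (⟦ extend βˢ ⟧ v) x P.+ x· ⟦ extend βˢ ⟧ v x) l ≡ coeff
          (⟦ extend β ⟧ (pencils v) x) l
      coefficient zero = trans (P.coeff-+ (⟦ extend φ ⟧ (⟦ extend βˢ ⟧ v) x) (x· ⟦ extend βˢ ⟧ v x) 0)
        (trans (ℤ.+-identityʳ _) (trans (φ-part 0) (sym (trans (coeff-extend β (pencils v) 0 x)
          (⟦⟧-cong β (λ y → let i , j = unpos y in proj₁ (coeffs-pencil [] (a i) (unflatten v i)) j) x)))))
      coefficient (suc l) = trans (P.coeff-+ (⟦ extend φ ⟧ (⟦ extend βˢ ⟧ v) x) (x· ⟦ extend βˢ ⟧ v x) (suc l))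
        (trans (cong₂ _+_ (φ-part (suc l)) (coeff-extend βˢ v l x))
          (trans (sym (+ᴹ-homo β (companions (suc l)) (⟦ Rot ⟧ (coeffs v l)) x))
              (sym (trans (coeff-extend β (pencils v) (suc l) x)
            (⟦⟧-cong β (λ y → let i , j = unpos y in proj₂ (coeffs-pencil [] (a i) (unflatten v i)) l j) x)))))

    pivotTail : ∀ i → Vector ℤ[x] (e i)
    pivotTail i j = pivots {e i} (a i) (suc j)

    -- The two changes of basis of the elimination: `S` performs the column shears in the rotated
    -- source coordinates, `T` contains the factor `unhorner` of each block.
    S T : n ⇒ᴾ n
    S = extend βˢ ∘ₗ blockMap ℬ (λ i → shearₗ λ j → P.- pivotTail i j)
    T = extend β ∘ₗ blockMap ℬ (λ i → unhornerₗ (e i))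

    S-IsBijective : IsBijective S
    S-IsBijective = ∘-IsBijective (extend-IsBijective βˢ-IsBijective)
      (blockMap-IsBijective ℬ (λ i → shearₗ λ j → P.- pivotTail i j) λ i → shearₗ-IsBijective (pivotTail i))

    T-IsBijective : IsBijective T
    T-IsBijective = ∘-IsBijective (extend-IsBijective β-IsBijective)
      (blockMap-IsBijective ℬ (λ i → unhornerₗ (e i)) λ i → unhornerₗ-IsBijective (e i))

    entry : Σ (Fin length) (λ i → Fin (suc (e i))) → ℤ[x]
    entry (i , zero)  = pivots {e i} (a i) zero
    entry (i , suc j) = P.1ᴾ

    σ : Vector ℤ[x] n
    σ x = entry (unpos x)

    AS≈TΔ : ∀ u x → ⟦ multiply A ⟧ (⟦ S ⟧ u) x ≈ ⟦ T ⟧ (λ y → σ y P.* u y) x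
    AS≈TΔ u x = ≈-trans (A-βˢ v x) (⟦⟧-cong (extend β) (λ y → let i , j = unpos y in block i j) x)
      where
      v : Vector ℤ[x] n
      v = ⟦ blockMap ℬ (λ i → shearₗ λ j → P.- pivotTail i j) ⟧ u
      cancel : ∀ u c u₀ → (u P.+ P.- c P.* u₀) P.+ c P.* u₀ ≈ u
      cancel = solve-∀-in ℤ[x]-almostCommutativeRing
      sheared : ∀ i j → unflatten v i j ≈ ⟦ shearₗ (λ j → P.- pivotTail i j) ⟧ (unflatten u i) j
      sheared i j = CommutativeRing.reflexive ℤ[x]-commutativeRing
          (unflatten-flatten (λ i → ⟦ shearₗ (λ j → P.- pivotTail i j) ⟧ (unflatten u i)) i j)
      diagonal : ∀ i j → ([] ◁ tail (unflatten v i)) j P.+ pivots {e i} (a i) j P.* unflatten v i zero ≈ σ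
          (pos i j) P.* u (pos i j)
      diagonal i j = ≈-trans (shape j) (P.*-congʳ (CommutativeRing.reflexive ℤ[x]-commutativeRing
          (cong entry (sym (unpos-pos i j)))) (u (pos i j)))
        where
        shape : ∀ j → ([] ◁ tail (unflatten v i)) j P.+ pivots {e i} (a i) j P.* unflatten v i zero ≈ entry
            (i , j) P.* u (pos i j)
        shape zero    = *ᴾ-congˡ (pivots {e i} (a i) zero) (sheared i zero)
        shape (suc j) = ≈-trans (P.+-cong (sheared i (suc j)) (*ᴾ-congˡ (pivotTail i j) (sheared i zero)))
          (≈-trans (cancel (u (pos i (suc j))) (pivotTail i j) (u (pos i zero))) (≈-sym (P.*-identityˡ _)))
      block : ∀ i j → pencil [] (a i) (unflatten v i) j ≈ unhorner (unflatten (λ y → σ y P.* u y) i) j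
      block i j = ≈-trans (pencil-unhorner [] (a i) (unflatten v i) j) (unhorner-cong (diagonal i) j)

    ∣ᴾ-neg : ∀ {f g} → f ∣ᴾ g → (P.- f) ∣ᴾ (P.- g)
    ∣ᴾ-neg {f} {g} (q , qf≈g) = q , ≈-trans (neg q f) (P.-‿cong qf≈g)
      where
      neg : ∀ q f → q P.* P.- f ≈ P.- (q P.* f)
      neg = solve-∀-in ℤ[x]-almostCommutativeRing

    -- `Blocks` places the coordinates `zero` behind all others, in the order of the `a i`. The
    -- diagonal thus consists of ones followed by the pivots, a chain because substituting `- x`
    -- preserves divisibility.
    entry-chain : ∀ s s′ → uncurry pos s Fin.≤ uncurry pos s′ → entry s ∣ᴾ entry s′
    entry-chain (i , suc j) s′           _  = entry s′ , P.*-identityʳ (entry s′)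
    entry-chain (i , zero)  (i′ , suc j) le = contradiction le (ℕ.<⇒≱ (first-last i i′ j))
    entry-chain (i , zero)  (i′ , zero)  le = ∣ᴾ-respʳ (≈-sym (pivot≈comp {e i′} (a i′) (monicᵉ i′)))
      (∣ᴾ-respˡ (≈-sym (pivot≈comp {e i} (a i) (monicᵉ i))) (∣ᴾ-neg
          (comp-∣ᴾ (P.- X) (chain i i′ (first-mono i i′ le)))))

    smith : HasSNF A
    smith = diagonalise A S T S-IsBijective T-IsBijective σ AS≈TΔ λ x y x≤y →
      entry-chain (unpos x) (unpos y) (subst₂ Fin._≤_ (sym (pos-unpos x)) (sym (pos-unpos y)) x≤y)

Presentation⇒Smith : ∀ {n} {φ : n ⇒ᶻ n} → Presentation φ →
  HasSNF ((λ i j → const (matrixOf ℤ-ring φ i j)) +ₘ scalarₘ X)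
Presentation⇒Smith pres = Smith.Diagonalisation.smith pres (Smith.ℬ pres)

mainTheorem6 : ∀ {c ℓ₁ ℓ₂ : Level} (r : ℕ) → 1 ℕ.≤ r →
  (P : DifferentialPoset r c ℓ₁ ℓ₂) →
  let open DifferentialPoset P using (Δp)
      open UpDown P
      open SmithNormalForm ℤ[x]-commutativeRing using (HasSmithNormalForm)
  in
  (∀ n → LinearMap.Surjective D[1+ n ]) →
  (∃ λ (l : ℕ) →
    (∀ n → l ℕ.+ 1 ℕ.≤ n →
      Δp (+ n ℤ.- 1ℤ ℤ.- δ r 1) ℤ.+ 1ℤ ℤ.≤ Δp (+ n)) ×
    (∀ n → n ℕ.≤ l → HasRationalCanonicalForm (DU n))) →
  (∀ n → HasRationalCanonicalForm (DU n)) ×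
  (∀ n → HasSmithNormalForm [DU n ]+xI)
mainTheorem6 r 1≤r P surj (l , growth , rcf) =
  (λ n → Presentation⇒RCF (pres n)) , (λ n → Presentation⇒Smith (pres n))
  where
  open Eigenspaces P 1≤r surj
  pres = presentations l
    -- Ascending from rank `m` uses the growth condition at `m + 1`, hence the shift of `l ≤ m` to
    -- `l + 1 ≤ m + 1`.
    (λ m l≤m → Δp-growth⇒Growth m (growth (suc m) (subst (ℕ._≤ suc m) (ℕ.+-comm 1 l) (ℕ.s≤s l≤m))))
    (λ n n≤l → RCF⇒Presentation (rcf n n≤l))
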